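{- Let $p\ge 3$ be a prime, and let $N$ be a positive integer which is not divisible by $p$ such that $pN\equiv 3\pmod 8$. Let $\alpha$ be any nonnegative integer. (1) If $p\equiv 1\pmod 5$, then \[\mathrm{pod}\Big(\frac{5p^{10\alpha+9}N+1}{8}\Big)\equiv 0\pmod 5.\] (2) If $p\equiv 2,3,4\pmod 5$, then \[\mathrm{pod}\Big(\frac{5p^{8\alpha+7}N+1}{8}\Big)\equiv 0\pmod 5.\]
   Context: For an integer $n\ge 0$, $\mathrm{pod}(n)$ denotes the number of partitions of $n$ in which the odd parts are distinct (even parts may repeat); equivalently $\sum_{n\ge 0}\mathrm{pod}(n)q^n=\prod_{i\ge 1}\frac{1+q^{2i-1}}{1-q^{2i}}$. -}

module Defs where

open import Data.List using (List; []; _∷_; map; filter; length; upTo; cartesianProductWith)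
open import Data.List.Membership.Propositional using (_∈_)
open import Data.List.Membership.Propositional.Properties
  using (∈-map⁺; ∈-upTo⁺; ∈-cartesianProductWith⁺; ∈-cartesianProductWith⁻; ∈-filter⁺; ∈-filter⁻)
open import Data.List.Properties using (∷-injective)
open import Data.List.Relation.Unary.All as All using (All; []; _∷_; all?)
open import Data.List.Relation.Unary.AllPairs using ([]; _∷_)
open import Data.List.Relation.Unary.Any using (here; there)
open import Data.List.Relation.Unary.Linked using (Linked; linked?)
open import Data.List.Relation.Unary.Unique.Propositional using (Unique)
import Data.List.Relation.Unary.Unique.Propositional.Properties as Unique
open import Data.Nat.ListAction using (sum)
open import Data.Nat using (ℕ; zero; suc; _≤_; _<_; _≥_; z≤n; s≤s; _≟_; _<?_; _≥?_)
open import Data.List.Relation.Unary.Unique.DecPropositional _≟_ using (unique?)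
open import Data.Nat.Divisibility using (_∣_; _∣?_)
open import Data.Nat.Properties using (≤-refl; ≤-trans; m≤m+n; m≤n+m; +-mono-≤; suc-injective)
open import Data.Product using (_×_; _,_; proj₂)
open import Function using (_⇔_; mk⇔)
open import Relation.Binary.PropositionalEquality using (_≡_; refl)
open import Relation.Nullary using (¬_)
open import Relation.Nullary.Decidable using (¬?; map′; _×-dec_)
open import Relation.Unary using (Decidable)

Odd : ℕ → Set
Odd m = ¬ 2 ∣ m

odd? : Decidable Odd
odd? m = ¬? (2 ∣? m)

record IsPartition (n : ℕ) (parts : List ℕ) : Set where
  constructor isPartition
  field
    decreasing : Linked _≥_ parts
    positive   : All (0 <_) parts
    sums       : sum parts ≡ n

OddPartsDistinct : List ℕ → Set
OddPartsDistinct parts = Unique (filter odd? parts)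

IsPodPartition : ℕ → List ℕ → Set
IsPodPartition n parts = IsPartition n parts × OddPartsDistinct parts

isPartition? : ∀ n → Decidable (IsPartition n)
isPartition? n parts =
  map′ (λ (d , p , s) → isPartition d p s) (λ (isPartition d p s) → d , p , s)
    (linked? _≥?_ parts ×-dec all? (0 <?_) parts ×-dec (sum parts ≟ n))

isPodPartition? : ∀ n → Decidable (IsPodPartition n)
isPodPartition? n parts = isPartition? n parts ×-dec unique? (filter odd? parts)

-- All lists of length at most l with entries in {1, …, n}.
candidates : ℕ → ℕ → List (List ℕ)
candidates n zero    = [] ∷ []
candidates n (suc l) = [] ∷ cartesianProductWith _∷_ (map suc (upTo n)) (candidates n l)

-- A partition of n has at most n parts, each at most n, so nothing is
-- missed; see podPartitions-complete and podPartitions-unique.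
podPartitions : ℕ → List (List ℕ)
podPartitions n = filter (isPodPartition? n) (candidates n n)

pod : ℕ → ℕ
pod n = length (podPartitions n)

candidates-unique : ∀ n l → Unique (candidates n l)
candidates-unique n zero    = [] ∷ []
candidates-unique n (suc l) =
  All.tabulate []≢ ∷
  Unique.cartesianProductWith⁺ _∷_ ∷-injective
    (Unique.map⁺ suc-injective (Unique.upTo⁺ n)) (candidates-unique n l)
  where
  []≢ : ∀ {ys} → ys ∈ cartesianProductWith _∷_ (map suc (upTo n)) (candidates n l) → ¬ [] ≡ ys
  []≢ ys∈ refl with ∈-cartesianProductWith⁻ _∷_ (map suc (upTo n)) (candidates n l) ys∈
  ... | _ , _ , _ , _ , ()

∈-candidates : ∀ {n} l {xs} → All (0 <_) xs → sum xs ≤ n → length xs ≤ l → xs ∈ candidates n l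
∈-candidates zero    []             _   _         = here refl
∈-candidates (suc l) []             _   _         = here refl
∈-candidates (suc l) {suc x ∷ xs}   (_ ∷ pos) sum≤n (s≤s len≤l) =
  there (∈-cartesianProductWith⁺ _∷_
    (∈-map⁺ suc (∈-upTo⁺ (≤-trans (m≤m+n (suc x) (sum xs)) sum≤n)))
    (∈-candidates l pos (≤-trans (m≤n+m (sum xs) (suc x)) sum≤n) len≤l))

length≤sum : ∀ {xs} → All (0 <_) xs → length xs ≤ sum xs
length≤sum []          = z≤n
length≤sum (0<x ∷ pos) = +-mono-≤ 0<x (length≤sum pos)

podPartitions-unique : ∀ n → Unique (podPartitions n)
podPartitions-unique n = Unique.filter⁺ (isPodPartition? n) (candidates-unique n n)

podPartitions-complete : ∀ n {xs} → xs ∈ podPartitions n ⇔ IsPodPartition n xs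
podPartitions-complete n = mk⇔ (λ xs∈ → proj₂ (∈-filter⁻ (isPodPartition? n) {xs = candidates n n} xs∈)) to∈
  where
  to∈ : ∀ {xs} → IsPodPartition n xs → xs ∈ podPartitions n
  to∈ h@(isPartition _ pos refl , _) =
    ∈-filter⁺ (isPodPartition? n) (∈-candidates n pos ≤-refl (length≤sum pos)) h

{-# OPTIONS --safe #-}
module Submission where

-- By Gauss, Σ (−1)ⁿ pod(n) qⁿ is the inverse of ψ(q) = θ(q)/2, where θ(q) = Σ q^{z(z+1)/2} over z ∈ ℤ; this
-- is the limit of a finite identity of Shanks. Modulo 5 one has θ⁵ ≡ θ(q⁵), and multiplication by the Gaussian
-- integer 1 + 2i shows that the terms of θ⁴ with exponents ≡ 2 (mod 5) add up to q²θ(q⁵)⁴. Hence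
-- pod(5n+2) ≡ ±2 r₃(8n+3) (mod 5), where r₃(m) is the number of vectors of squared length m in ℤ³.
-- For an odd prime p, conjugating by representatives q of the p + 1 classes of integral quaternions of norm p
-- and counting the pairs (q, v) with |v|² = n in two ways gives r₃(p²n) + p r₃(n/p²) = (p + 1) r₃(n) for p ∣ n. So
-- r₃(p²ᵏ⁺¹N) = (1 + p + ⋯ + pᵏ) r₃(pN), and the first factor vanishes modulo 5 for the exponents in question.

-- The exponents of p are odd so that p divides every n at which the Hecke relation is used. For
-- general n that relation contains a further term (-n/p) r₃(n) with a Legendre symbol. For p ∣ n it
-- vanishes: a vector v of squared length n that p does not divide is isotropic modulo p, hence a
-- point of the conic x² + y² + z² = 0 over 𝔽ₚ, and it singles out exactly one class of quaternions
-- q. The p + 1 points of this conic therefore serve as the index set of the classes. The quaternion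
-- that belongs to a point comes from Lagrange's four-square descent, confined to the right ideal of
-- the elements that the point annihilates modulo p; integer coordinates suffice for this. The
-- series θ runs over all of ℤ, not only over k ≥ 0, because z ↦ -1 - z then acts as a symmetry and
-- a triple of indices is the same thing as a vector with three odd coordinates of arbitrary sign.
-- The resulting factor 2 is invertible modulo 5.

open import Defs
open import Algebra using (CommutativeRing)
import Algebra.Construct.Pointwise as Pointwise
import Algebra.Properties.Group
import Algebra.Properties.Semiring.Exp
import Algebra.Solver.Ring.NaturalCoefficients.Default
open import Data.Empty using (⊥; ⊥-elim)
import Data.Integer.Properties as ℤ
open import Data.Integer.Tactic.RingSolver using (solve-∀)
open import Data.List using (List; []; _∷_; _++_; map; filter; length; cartesianProduct; upTo; allFin)
open import Data.List.Membership.Propositional using (_∈_)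
open import Data.List.Membership.Propositional.Properties
open import Data.List.Relation.Unary.All as All using (All; []; _∷_; all?)
open import Data.List.Relation.Unary.AllPairs using ([]; _∷_)
open import Data.List.Relation.Unary.Any using (here; there)
open import Data.List.Relation.Unary.Unique.Propositional using (Unique)
import Data.List.Relation.Unary.Unique.Propositional.Properties as Unique
open import Data.Nat as ℕ using (ℕ; zero; suc)
import Data.Nat.Coprimality as Coprime
import Data.Nat.Divisibility as ℕ
import Data.Nat.DivMod as ℕ
open import Data.Nat.GCD using (module Bézout)
open import Data.Nat.Induction using (Acc; acc; <-wellFounded; <-rec)
open import Data.Nat.ListAction using (sum)
open import Data.Nat.Primality using (Prime; euclidsLemma; prime⇒nonZero; prime⇒irreducible; ¬prime[0]; ¬prime[1])
import Data.Nat.Properties as ℕ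
import Data.Nat.Solver as ℕ
open import Data.Product using (_×_; _,_; ∃-syntax; proj₁; proj₂)
open import Data.Sum using (_⊎_; inj₁; inj₂; [_,_]′)
open import Data.Unit using (⊤; tt)
open import Function using (Equivalence; _∘_; id)
open import Level using (Level; 0ℓ)
import Relation.Binary.PropositionalEquality as ≡
import Relation.Binary.Reasoning.Setoid as SetoidReasoning
open import Relation.Nullary using (¬_; Dec; yes; no)
open import Relation.Nullary.Decidable using (¬?; map′; _×-dec_; toWitnessFalse; False)
open import Relation.Unary using (Decidable)

-- Counting by enumeration and by bijective relations

module Counting where
  open import Data.List.Properties using (length-map; length-++)
  open import Data.Nat using (_+_; _*_; _≤_; z≤n; s≤s)
  open import Data.Nat.Properties using (≤-antisym; ≤-trans; ≤-reflexive; +-suc)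
  open ≡

  private
    variable
      A B : Set
      m n : ℕ
      P Q : A → Set

  -- Elements are counted, not proofs: P may have many proofs at one x, as happens when it hides an
  -- existential. The enumerating list is immaterial, since `counts-unique` shows that P alone
  -- determines n.
  record Counts {A : Set} (P : A → Set) (n : ℕ) : Set where
    constructor counts
    field
      list : List A
      unique : Unique list
      sound : ∀ {x} → x ∈ list → P x
      complete : ∀ {x} → P x → x ∈ list
      len : length list ≡ n

  open Counts

  -- Pigeonhole by induction on xs: the partner y of the head is cut out of ys, and injectivity
  -- together with uniqueness keeps the partners of the tail away from y.
  length-≤ : ∀ {xs : List A} {ys : List B} (R : A → B → Set) → Unique xs →
             (∀ {x} → x ∈ xs → ∃[ y ] (y ∈ ys × R x y)) →
             (∀ {x x′ y} → x ∈ xs → x′ ∈ xs → R x y → R x′ y → x ≡ x′) →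
             length xs ≤ length ys
  length-≤ {xs = []} R _ tot inj = z≤n
  length-≤ {xs = x ∷ xs} R (x∉ ∷ uniq) tot inj with tot (here refl)
  ... | y , y∈ , Rxy with ∈-∃++ y∈
  ... | us , vs , refl = ≤-trans (s≤s (length-≤ {ys = us ++ vs} R uniq tot′ inj′)) (≤-reflexive (sym len≡))
    where
    len≡ : length (us ++ y ∷ vs) ≡ suc (length (us ++ vs))
    len≡ = trans (length-++ us) (trans (+-suc (length us) (length vs)) (cong suc (sym (length-++ us))))
    inj′ : ∀ {x x′ y} → x ∈ xs → x′ ∈ xs → R x y → R x′ y → x ≡ x′
    inj′ p q = inj (there p) (there q)
    tot′ : ∀ {x′} → x′ ∈ xs → ∃[ y′ ] (y′ ∈ us ++ vs × R x′ y′)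
    tot′ x′∈ with tot (there x′∈)
    ... | y′ , y′∈ , Rx′y′ with ∈-++⁻ us y′∈
    ... | inj₁ y′∈us = y′ , ∈-++⁺ˡ y′∈us , Rx′y′
    ... | inj₂ (there y′∈vs) = y′ , ∈-++⁺ʳ us y′∈vs , Rx′y′
    ... | inj₂ (here refl) = ⊥-elim (All.lookup x∉ x′∈ (inj (here refl) (there x′∈) Rxy Rx′y′))

  counts-≤ : (R : A → B → Set) → Counts P m → Counts Q n →
             (∀ {x} → P x → ∃[ y ] (Q y × R x y)) →
             (∀ {x x′ y} → P x → P x′ → R x y → R x′ y → x ≡ x′) → m ≤ n
  counts-≤ R CP CQ tot inj =
    subst₂ _≤_ (len CP) (len CQ)
      (length-≤ R (unique CP)
        (λ x∈ → let y , Qy , Rxy = tot (sound CP x∈) in y , complete CQ Qy , Rxy)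
        (λ p q → inj (sound CP p) (sound CP q)))

  -- A relation takes the place of a pair of inverse functions because the correspondences of the
  -- Hecke argument, such as q v = v′ q, need a division that is possible only under hypotheses on
  -- v.
  counts-bij : (R : A → B → Set) → Counts P m → Counts Q n →
               (∀ {x} → P x → ∃[ y ] (Q y × R x y)) →
               (∀ {y} → Q y → ∃[ x ] (P x × R x y)) →
               (∀ {x x′ y} → P x → P x′ → R x y → R x′ y → x ≡ x′) →
               (∀ {x y y′} → Q y → Q y′ → R x y → R x y′ → y ≡ y′) → m ≡ n
  counts-bij R CP CQ tot sur inj fun =
    ≤-antisym (counts-≤ R CP CQ tot inj) (counts-≤ (λ y x → R x y) CQ CP sur fun)

  counts-image : (f : A → B) → Counts P n →
                 (∀ {x} → P x → Q (f x)) →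
                 (∀ {x x′} → P x → P x′ → f x ≡ f x′ → x ≡ x′) →
                 (∀ {y} → Q y → ∃[ x ] (P x × f x ≡ y)) → Counts Q n
  counts-image {P = P} {Q = Q} f C to inj sur = counts (map f (list C)) (map-unique (unique C) (sound C))
    (λ y∈ → let x , x∈ , eq = ∈-map⁻ f y∈ in subst Q (sym eq) (to (sound C x∈)))
    (λ Qy → let x , Px , eq = sur Qy in subst (_∈ _) eq (∈-map⁺ f (complete C Px)))
    (trans (length-map f (list C)) (len C))
    where
    map-unique : ∀ {xs} → Unique xs → (∀ {x} → x ∈ xs → P x) → Unique (map f xs)
    map-unique [] _ = []
    map-unique {x ∷ xs} (x∉ ∷ u) s =
      All.tabulate (λ y∈ fx≡y → let x′ , x′∈ , eq = ∈-map⁻ f y∈ in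
        All.lookup x∉ x′∈ (inj (s (here refl)) (s (there x′∈)) (trans fx≡y eq)))
      ∷ map-unique u (s ∘ there)

  counts-unique : Counts P m → Counts P n → m ≡ n
  counts-unique C D = counts-bij _≡_ C D (λ p → _ , p , refl) (λ p → _ , p , refl)
    (λ _ _ p q → trans p (sym q)) (λ _ _ p q → trans (sym p) q)

  counts-⇔ : (∀ {x} → P x → Q x) → (∀ {x} → Q x → P x) → Counts P n → Counts Q n
  counts-⇔ to from (counts l u s c e) = counts l u (to ∘ s) (c ∘ from) e

  counts-≡ : m ≡ n → Counts P m → Counts P n
  counts-≡ refl C = C

  counts-⊎ : Counts P m → Counts Q n → (∀ {x} → P x → ¬ Q x) → Counts (λ x → P x ⊎ Q x) (m + n)
  counts-⊎ C D dis = counts (list C ++ list D)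
    (Unique.++⁺ (unique C) (unique D) (λ (p , q) → dis (sound C p) (sound D q)))
    (λ x∈ → [ inj₁ ∘ sound C , inj₂ ∘ sound D ]′ (∈-++⁻ (list C) x∈))
    [ ∈-++⁺ˡ ∘ complete C , ∈-++⁺ʳ (list C) ∘ complete D ]′
    (trans (length-++ (list C)) (cong₂ _+_ (len C) (len D)))

  length-cartesianProduct : ∀ (xs : List A) (ys : List B) → length (cartesianProduct xs ys) ≡ length xs * length ys
  length-cartesianProduct [] ys = refl
  length-cartesianProduct (x ∷ xs) ys =
    trans (length-++ (map (x ,_) ys)) (cong₂ _+_ (length-map (x ,_) ys) (length-cartesianProduct xs ys))

  counts-× : Counts P m → Counts Q n → Counts (λ (x , y) → P x × Q y) (m * n)
  counts-× C D = counts (cartesianProduct (list C) (list D))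
    (Unique.cartesianProduct⁺ (unique C) (unique D))
    (λ xy∈ → let x∈ , y∈ = ∈-cartesianProduct⁻ (list C) (list D) xy∈ in sound C x∈ , sound D y∈)
    (λ (p , q) → ∈-cartesianProduct⁺ (complete C p) (complete D q))
    (trans (length-cartesianProduct (list C) (list D)) (cong₂ _*_ (len C) (len D)))

  counts-filter : Decidable Q → Counts P n → ∃[ k ] Counts (λ x → P x × Q x) k
  counts-filter Q? C = _ , counts (filter Q? (list C)) (Unique.filter⁺ Q? (unique C))
    (λ x∈ → let x∈C , q = ∈-filter⁻ Q? x∈ in sound C x∈C , q)
    (λ (p , q) → ∈-filter⁺ Q? (complete C p) q) refl

  counts-split : Decidable Q → Counts P n →
                 ∃[ k ] ∃[ l ] (Counts (λ x → P x × Q x) k × Counts (λ x → P x × ¬ Q x) l × n ≡ k + l)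
  counts-split Q? C =
    let k , CQ = counts-filter Q? C
        l , C¬Q = counts-filter (¬? ∘ Q?) C
    in k , l , CQ , C¬Q , counts-unique C
         (counts-⇔ [ proj₁ , proj₁ ]′
           (λ {x} p → case-dec (Q? x) p)
           (counts-⊎ CQ C¬Q (λ (_ , q) (_ , ¬q) → ¬q q)))
    where
    case-dec : ∀ {X Y : Set} → Dec Y → X → (X × Y) ⊎ (X × ¬ Y)
    case-dec (yes y) x = inj₁ (x , y)
    case-dec (no ¬y) x = inj₂ (x , ¬y)

  counts-∅ : (∀ {x} → ¬ P x) → Counts P 0
  counts-∅ ¬p = counts [] [] (λ ()) (⊥-elim ∘ ¬p) refl

-- Quaternions with integer coordinates

module Quaternion where
  open import Data.Integer using (ℤ; NonZero; +_; -_; _+_; _*_; _-_)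
  open import Data.Integer.Properties
  open ≡

  -- These are the Lipschitz quaternions. Their order is not Euclidean: division by m fails when all
  -- four remainders are ±m/2. That case is settled by a divisibility argument inside `descent`, so
  -- half-integral coordinates never appear.
  record ℍ : Set where
    constructor quat
    field
      re i j k : ℤ

  infixl 7 _·_
  infixl 6 _⊕_

  quat-≡ : ∀ {a b c d a′ b′ c′ d′} → a ≡ a′ → b ≡ b′ → c ≡ c′ → d ≡ d′ → quat a b c d ≡ quat a′ b′ c′ d′
  quat-≡ refl refl refl refl = refl

  opaque
    _·_ : ℍ → ℍ → ℍ
    quat a b c d · quat a′ b′ c′ d′ = quat
      (a * a′ - b * b′ - c * c′ - d * d′)
      (a * b′ + b * a′ + c * d′ - d * c′)
      (a * c′ + c * a′ + d * b′ - b * d′)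
      (a * d′ + d * a′ + b * c′ - c * b′)

    _⊕_ : ℍ → ℍ → ℍ
    quat a b c d ⊕ quat a′ b′ c′ d′ = quat (a + a′) (b + b′) (c + c′) (d + d′)

    conj : ℍ → ℍ
    conj (quat a b c d) = quat a (- b) (- c) (- d)

    norm : ℍ → ℤ
    norm (quat a b c d) = a * a + b * b + c * c + d * d

    scale : ℤ → ℍ → ℍ
    scale s (quat a b c d) = quat (s * a) (s * b) (s * c) (s * d)

    real : ℤ → ℍ
    real s = quat s (+ 0) (+ 0) (+ 0)

    inner : ℍ → ℍ → ℤ
    inner (quat a b c d) (quat a′ b′ c′ d′) = a * a′ + b * b′ + c * c′ + d * d′

  opaque
    unfolding _·_

    ·-assoc : ∀ x y z → x · y · z ≡ x · (y · z)
    ·-assoc (quat a b c d) (quat e f g h) (quat l m n o) = quat-≡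
      (p₁ a b c d e f g h l m n o) (p₂ a b c d e f g h l m n o)
      (p₃ a b c d e f g h l m n o) (p₄ a b c d e f g h l m n o)
      where
      p₁ : ∀ a b c d e f g h l m n o →
           (a * e - b * f - c * g - d * h) * l - (a * f + b * e + c * h - d * g) * m
             - (a * g + c * e + d * f - b * h) * n - (a * h + d * e + b * g - c * f) * o
           ≡ a * (e * l - f * m - g * n - h * o) - b * (e * m + f * l + g * o - h * n)
             - c * (e * n + g * l + h * m - f * o) - d * (e * o + h * l + f * n - g * m)
      p₁ = solve-∀
      p₂ : ∀ a b c d e f g h l m n o →
           (a * e - b * f - c * g - d * h) * m + (a * f + b * e + c * h - d * g) * l
             + (a * g + c * e + d * f - b * h) * o - (a * h + d * e + b * g - c * f) * n
           ≡ a * (e * m + f * l + g * o - h * n) + b * (e * l - f * m - g * n - h * o)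
             + c * (e * o + h * l + f * n - g * m) - d * (e * n + g * l + h * m - f * o)
      p₂ = solve-∀
      p₃ : ∀ a b c d e f g h l m n o →
           (a * e - b * f - c * g - d * h) * n + (a * g + c * e + d * f - b * h) * l
             + (a * h + d * e + b * g - c * f) * m - (a * f + b * e + c * h - d * g) * o
           ≡ a * (e * n + g * l + h * m - f * o) + c * (e * l - f * m - g * n - h * o)
             + d * (e * m + f * l + g * o - h * n) - b * (e * o + h * l + f * n - g * m)
      p₃ = solve-∀
      p₄ : ∀ a b c d e f g h l m n o →
           (a * e - b * f - c * g - d * h) * o + (a * h + d * e + b * g - c * f) * l
             + (a * f + b * e + c * h - d * g) * n - (a * g + c * e + d * f - b * h) * m
           ≡ a * (e * o + h * l + f * n - g * m) + d * (e * l - f * m - g * n - h * o)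
             + b * (e * n + g * l + h * m - f * o) - c * (e * m + f * l + g * o - h * n)
      p₄ = solve-∀

    conj-conj : ∀ x → conj (conj x) ≡ x
    conj-conj (quat a b c d) = quat-≡ refl (neg-involutive b) (neg-involutive c) (neg-involutive d)

    conj-· : ∀ x y → conj (x · y) ≡ conj y · conj x
    conj-· (quat a b c d) (quat e f g h) = quat-≡
      (p₁ a b c d e f g h) (p₂ a b c d e f g h) (p₂ a c d b e g h f) (p₂ a d b c e h f g)
      where
      p₁ : ∀ a b c d e f g h →
           a * e - b * f - c * g - d * h ≡ e * a - - f * - b - - g * - c - - h * - d
      p₁ = solve-∀
      p₂ : ∀ a b c d e f g h → - (a * f + b * e + c * h - d * g) ≡ e * - b + - f * a + - g * - d - - h * - c
      p₂ = solve-∀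

    norm-· : ∀ x y → norm (x · y) ≡ norm x * norm y
    norm-· (quat a b c d) (quat e f g h) = lemma a b c d e f g h
      where
      lemma : ∀ a b c d e f g h →
              (a * e - b * f - c * g - d * h) * (a * e - b * f - c * g - d * h)
              + (a * f + b * e + c * h - d * g) * (a * f + b * e + c * h - d * g)
              + (a * g + c * e + d * f - b * h) * (a * g + c * e + d * f - b * h)
              + (a * h + d * e + b * g - c * f) * (a * h + d * e + b * g - c * f)
              ≡ (a * a + b * b + c * c + d * d) * (e * e + f * f + g * g + h * h)
      lemma = solve-∀

    norm-conj : ∀ x → norm (conj x) ≡ norm x
    norm-conj (quat a b c d) = lemma a b c d
      where
      lemma : ∀ a b c d → a * a + - b * - b + - c * - c + - d * - d ≡ a * a + b * b + c * c + d * d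
      lemma = solve-∀

    norm-scale : ∀ s x → norm (scale s x) ≡ s * s * norm x
    norm-scale s (quat a b c d) = lemma s a b c d
      where
      lemma : ∀ s a b c d → s * a * (s * a) + s * b * (s * b) + s * c * (s * c) + s * d * (s * d)
                            ≡ s * s * (a * a + b * b + c * c + d * d)
      lemma = solve-∀

    norm-⊕ : ∀ x y → norm (x ⊕ y) ≡ norm x + + 2 * inner x y + norm y
    norm-⊕ (quat a b c d) (quat e f g h) = lemma a b c d e f g h
      where
      lemma : ∀ a b c d e f g h →
              (a + e) * (a + e) + (b + f) * (b + f) + (c + g) * (c + g) + (d + h) * (d + h)
              ≡ a * a + b * b + c * c + d * d + + 2 * (a * e + b * f + c * g + d * h)
                + (e * e + f * f + g * g + h * h)
      lemma = solve-∀

    -- Polarisation of x x̄ = N(x). It produces a scalar in the middle of a product, which is how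
    -- `annihilate` removes a factor that has no inverse modulo p.
    ·-polar : ∀ x y → x · conj y ⊕ y · conj x ≡ real (+ 2 * inner x y)
    ·-polar (quat a b c d) (quat e f g h) = quat-≡
      (p₁ a b c d e f g h) (p₂ a b c d e f g h) (p₂ a c d b e g h f) (p₂ a d b c e h f g)
      where
      p₁ : ∀ a b c d e f g h →
           a * e - b * - f - c * - g - d * - h + (e * a - f * - b - g * - c - h * - d)
           ≡ + 2 * (a * e + b * f + c * g + d * h)
      p₁ = solve-∀
      p₂ : ∀ a b c d e f g h →
           a * - f + b * e + c * - h - d * - g + (e * - b + f * a + g * - d - h * - c) ≡ + 0
      p₂ = solve-∀

    ·-distribˡ : ∀ x y z → x · (y ⊕ z) ≡ x · y ⊕ x · z
    ·-distribˡ (quat a b c d) (quat e f g h) (quat l m n o) = quat-≡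
      (p₁ a b c d e f g h l m n o) (p₂ a b c d e f g h l m n o)
      (p₂ a c d b e g h f l n o m) (p₂ a d b c e h f g l o m n)
      where
      p₁ : ∀ a b c d e f g h l m n o →
           a * (e + l) - b * (f + m) - c * (g + n) - d * (h + o)
           ≡ a * e - b * f - c * g - d * h + (a * l - b * m - c * n - d * o)
      p₁ = solve-∀
      p₂ : ∀ a b c d e f g h l m n o →
           a * (f + m) + b * (e + l) + c * (h + o) - d * (g + n)
           ≡ a * f + b * e + c * h - d * g + (a * m + b * l + c * o - d * n)
      p₂ = solve-∀

    ⊕-conj : ∀ x y → conj (x ⊕ y) ≡ conj x ⊕ conj y
    ⊕-conj (quat a b c d) (quat e f g h) =
      quat-≡ refl (neg-distrib-+ b f) (neg-distrib-+ c g) (neg-distrib-+ d h)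

    real-· : ∀ s x → real s · x ≡ scale s x
    real-· s (quat a b c d) = quat-≡ (p₁ s a b c d) (p₂ s a b c d) (p₂ s a c d b) (p₂ s a d b c)
      where
      p₁ : ∀ s a b c d → s * a - + 0 * b - + 0 * c - + 0 * d ≡ s * a
      p₁ = solve-∀
      p₂ : ∀ s a b c d → s * b + + 0 * a + + 0 * d - + 0 * c ≡ s * b
      p₂ = solve-∀

  ·-distribʳ : ∀ z x y → (x ⊕ y) · z ≡ x · z ⊕ y · z
  ·-distribʳ z x y = begin
    (x ⊕ y) · z ≡⟨ sym (conj-conj _) ⟩
    conj (conj ((x ⊕ y) · z)) ≡⟨ cong conj (trans (conj-· (x ⊕ y) z) (cong (conj z ·_) (⊕-conj x y))) ⟩
    conj (conj z · (conj x ⊕ conj y)) ≡⟨ cong conj (·-distribˡ (conj z) (conj x) (conj y)) ⟩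
    conj (conj z · conj x ⊕ conj z · conj y) ≡⟨ cong conj (cong₂ _⊕_ (sym (conj-· x z)) (sym (conj-· y z))) ⟩
    conj (conj (x · z) ⊕ conj (y · z)) ≡⟨ cong conj (sym (⊕-conj _ _)) ⟩
    conj (conj (x · z ⊕ y · z)) ≡⟨ conj-conj _ ⟩
    x · z ⊕ y · z ∎
    where open ≡-Reasoning

  opaque
    unfolding _·_

    conj-real : ∀ s → conj (real s) ≡ real s
    conj-real s = refl

    scale-scale : ∀ s t x → scale s (scale t x) ≡ scale (s * t) x
    scale-scale s t (quat a b c d) =
      quat-≡ (sym (*-assoc s t a)) (sym (*-assoc s t b)) (sym (*-assoc s t c)) (sym (*-assoc s t d))

    scale-⊕ : ∀ s x y → scale s (x ⊕ y) ≡ scale s x ⊕ scale s y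
    scale-⊕ s (quat a b c d) (quat e f g h) =
      quat-≡ (*-distribˡ-+ s a e) (*-distribˡ-+ s b f) (*-distribˡ-+ s c g) (*-distribˡ-+ s d h)

    scale-conj : ∀ s x → conj (scale s x) ≡ scale s (conj x)
    scale-conj s (quat a b c d) =
      quat-≡ refl (neg-distribʳ-* s b) (neg-distribʳ-* s c) (neg-distribʳ-* s d)

    scale-injective : ∀ s .{{_ : NonZero s}} {x y} → scale s x ≡ scale s y → x ≡ y
    scale-injective s {quat a b c d} {quat e f g h} eq = quat-≡
      (*-cancelˡ-≡ s a e (cong ℍ.re eq)) (*-cancelˡ-≡ s b f (cong ℍ.i eq))
      (*-cancelˡ-≡ s c g (cong ℍ.j eq)) (*-cancelˡ-≡ s d h (cong ℍ.k eq))

    ·-conj : ∀ x → x · conj x ≡ real (norm x)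
    ·-conj (quat a b c d) = quat-≡ (p₁ a b c d) (p₂ a b c d) (p₂ a c d b) (p₂ a d b c)
      where
      p₁ : ∀ a b c d → a * a - b * - b - c * - c - d * - d ≡ a * a + b * b + c * c + d * d
      p₁ = solve-∀
      p₂ : ∀ a b c d → a * - b + b * a + c * - d - d * - c ≡ + 0
      p₂ = solve-∀

  ·-real : ∀ s x → x · real s ≡ scale s x
  ·-real s x = begin
    x · real s ≡⟨ sym (conj-conj _) ⟩
    conj (conj (x · real s)) ≡⟨ cong conj (trans (conj-· x (real s)) (trans (cong (_· conj x) (conj-real s)) (real-· s (conj x)))) ⟩
    conj (scale s (conj x)) ≡⟨ trans (scale-conj s (conj x)) (cong (scale s) (conj-conj x)) ⟩
    scale s x ∎
    where
    open ≡-Reasoning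

  scale-·ˡ : ∀ s x y → scale s x · y ≡ scale s (x · y)
  scale-·ˡ s x y = begin
    scale s x · y ≡⟨ cong (_· y) (sym (real-· s x)) ⟩
    real s · x · y ≡⟨ ·-assoc (real s) x y ⟩
    real s · (x · y) ≡⟨ real-· s (x · y) ⟩
    scale s (x · y) ∎
    where open ≡-Reasoning

  scale-·ʳ : ∀ s x y → x · scale s y ≡ scale s (x · y)
  scale-·ʳ s x y = begin
    x · scale s y ≡⟨ cong (x ·_) (sym (·-real s y)) ⟩
    x · (y · real s) ≡⟨ sym (·-assoc x y (real s)) ⟩
    x · y · real s ≡⟨ ·-real s (x · y) ⟩
    scale s (x · y) ∎
    where open ≡-Reasoning

  conj-·-self : ∀ x → conj x · x ≡ real (norm x)
  conj-·-self x = begin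
    conj x · x ≡⟨ cong (conj x ·_) (sym (conj-conj x)) ⟩
    conj x · conj (conj x) ≡⟨ ·-conj (conj x) ⟩
    real (norm (conj x)) ≡⟨ cong real (norm-conj x) ⟩
    real (norm x) ∎
    where open ≡-Reasoning

  Imaginary : ℍ → Set
  Imaginary x = ℍ.re x ≡ + 0

  opaque
    unfolding _·_

    -- The equation v̄ = -v can be carried through products, which the vanishing of the real part
    -- cannot; with the converse below it shows that q v q̄ is again imaginary.
    conj-imaginary : ∀ {v} → Imaginary v → conj v ≡ scale (- (+ 1)) v
    conj-imaginary {quat _ b c d} refl = quat-≡ refl (p b) (p c) (p d)
      where
      p : ∀ b → - b ≡ - (+ 1) * b
      p = solve-∀

    imaginary-conj : ∀ {v} → conj v ≡ scale (- (+ 1)) v → Imaginary v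
    imaginary-conj {quat a _ _ _} eq = *-cancelˡ-≡ (+ 2) a (+ 0) (begin
      + 2 * a ≡⟨ p a ⟩
      a - - (+ 1) * a ≡⟨ cong (λ z → a - z) (sym (cong ℍ.re eq)) ⟩
      a - a ≡⟨ +-inverseʳ a ⟩
      + 2 * + 0 ∎)
      where
      open ≡-Reasoning
      p : ∀ a → + 2 * a ≡ a - - (+ 1) * a
      p = solve-∀

-- Quaternions modulo an integer, and zero divisors modulo p

module ModularQuaternion where
  open Quaternion
  open import Data.Integer using (ℤ; +_; -_; _+_; _*_; _-_; NonZero) renaming (∣_∣ to abs)
  open import Data.Integer.Divisibility.Signed
  open import Data.Integer.Properties
  open ≡

  -- For an odd prime m this is vanishing in the quaternion algebra over 𝔽ₘ, a 2 × 2 matrix algebra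
  -- in which the norm is the determinant. Nonzero elements of norm 0 are matrices of rank 1, and
  -- the lemmas on products below are statements about their kernels and images.
  Divides : ℤ → ℍ → Set
  Divides m x = ∃[ y ] x ≡ scale m y

  opaque
    unfolding _·_

    scale-comm : ∀ s t x → scale s (scale t x) ≡ scale t (scale s x)
    scale-comm s t x = trans (scale-scale s t x)
      (trans (cong (λ z → scale z x) (*-comm s t)) (sym (scale-scale t s x)))

    divides-components : ∀ {m a b c d} → m ∣ a → m ∣ b → m ∣ c → m ∣ d → Divides m (quat a b c d)
    divides-components {m} (divides a ea) (divides b eb) (divides c ec) (divides d ed) =
      quat a b c d , quat-≡ (trans ea (*-comm a m)) (trans eb (*-comm b m))
                            (trans ec (*-comm c m)) (trans ed (*-comm d m))

    components-divides : ∀ {m a b c d} → Divides m (quat a b c d) → m ∣ a × m ∣ b × m ∣ c × m ∣ d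
    components-divides {m} (quat a b c d , refl) =
      divides a (*-comm m a) , divides b (*-comm m b) , divides c (*-comm m c) , divides d (*-comm m d)

    divides? : ∀ m x → Dec (Divides m x)
    divides? m x@(quat a b c d) =
      map′ (λ (p , q , r , s) → divides-components p q r s) components-divides
        ((m ∣? a) ×-dec (m ∣? b) ×-dec (m ∣? c) ×-dec (m ∣? d))

    divides-real : ∀ {m s} → m ∣ s → Divides m (real s)
    divides-real {m} m∣s = divides-components m∣s m∣0 m∣0 m∣0
      where
      m∣0 : m ∣ + 0
      m∣0 = divides (+ 0) refl

    divides-re : ∀ {m x} → Divides m x → m ∣ ℍ.re x
    divides-re {x = quat _ _ _ _} d = proj₁ (components-divides d)

  module _ {m : ℤ} where

    divides-·ʳ : ∀ {x} y → Divides m x → Divides m (x · y)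
    divides-·ʳ y (x , refl) = x · y , scale-·ˡ m x y

    divides-·ˡ : ∀ {x} y → Divides m x → Divides m (y · x)
    divides-·ˡ y (x , refl) = y · x , scale-·ʳ m y x

    divides-⊕ : ∀ {x y} → Divides m x → Divides m y → Divides m (x ⊕ y)
    divides-⊕ (x , refl) (y , refl) = x ⊕ y , sym (scale-⊕ m x y)

    divides-scale : ∀ s {x} → Divides m x → Divides m (scale s x)
    divides-scale s (x , refl) = scale s x , scale-comm s m x

    divides-conj : ∀ {x} → Divides m x → Divides m (conj x)
    divides-conj (x , refl) = conj x , scale-conj m x

    divides-norm : ∀ {x} → Divides m x → m * m ∣ norm x
    divides-norm (x , refl) = divides (norm x) (trans (norm-scale m x) (*-comm (m * m) (norm x)))

    imaginary-divides : ∀ {v x} → Imaginary v → Divides m (v · x) → Divides m (conj v · x)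
    imaginary-divides {v} {x} iv d = subst (Divides m)
      (sym (trans (cong (_· x) (conj-imaginary iv)) (scale-·ˡ _ v x))) (divides-scale (- (+ 1)) d)

    -- w x ≡ 0 gives x̄ w ≡ 0 because w̄ = −w.
    divides-flip : ∀ {w x} → Imaginary w → Divides m (w · x) → Divides m (conj x · w)
    divides-flip {w} {x} iw d = subst (Divides m)
      (trans (conj-· (conj w) x) (cong (conj x ·_) (conj-conj w)))
      (divides-conj (imaginary-divides iw d))

  imaginary-square : ∀ {v} → Imaginary v → v · v ≡ real (- norm v)
  imaginary-square {v} iv = begin
    v · v ≡⟨ cong (v ·_) (sym (conj-conj v)) ⟩
    v · conj (conj v) ≡⟨ cong (λ z → v · conj z) (conj-imaginary iv) ⟩
    v · conj (scale (- (+ 1)) v) ≡⟨ cong (v ·_) (scale-conj _ v) ⟩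
    v · scale (- (+ 1)) (conj v) ≡⟨ scale-·ʳ _ v (conj v) ⟩
    scale (- (+ 1)) (v · conj v) ≡⟨ cong (scale _) (·-conj v) ⟩
    scale (- (+ 1)) (real (norm v)) ≡⟨ scale-real (norm v) ⟩
    real (- norm v) ∎
    where
    open ≡-Reasoning
    opaque
      unfolding _·_
      scale-real : ∀ n → scale (- (+ 1)) (real n) ≡ real (- n)
      scale-real n = quat-≡ (-1*i≡-i n) refl refl refl

  module ModPrime (p : ℕ) (p-prime : Prime p) (p≢2 : p ≢ 2) where

    P : ℤ
    P = + p

    instance
      p-nonZero : ℕ.NonZero p
      p-nonZero = prime⇒nonZero p-prime

      P-nonZero : NonZero P
      P-nonZero = p-nonZero

    prime-∣-* : ∀ a b → P ∣ a * b → P ∣ a ⊎ P ∣ b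
    prime-∣-* a b d with euclidsLemma (abs a) (abs b) p-prime (subst (p ℕ.∣_) (abs-* a b) (∣⇒∣ᵤ d))
    ... | inj₁ x = inj₁ (∣ᵤ⇒∣ x)
    ... | inj₂ y = inj₂ (∣ᵤ⇒∣ y)

    P∤2 : ¬ P ∣ + 2
    P∤2 d = small p (ℕ.∣⇒≤ (∣⇒∣ᵤ d)) p-prime p≢2
      where
      small : ∀ p → p ℕ.≤ 2 → Prime p → ¬ p ≢ 2
      small 0 _ p-prime _ = ¬prime[0] p-prime
      small 1 _ p-prime _ = ¬prime[1] p-prime
      small 2 _ _ ne = ne refl
      small (suc (suc (suc _))) (ℕ.s≤s (ℕ.s≤s ()))

    ∣-cancelˡ : ∀ {c a} → ¬ P ∣ c → P ∣ c * a → P ∣ a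
    ∣-cancelˡ {c} {a} ¬c d with prime-∣-* c a d
    ... | inj₁ x = ⊥-elim (¬c x)
    ... | inj₂ y = y

    opaque
      unfolding _·_

      divides-cancel : ∀ {c x} → ¬ P ∣ c → Divides P (scale c x) → Divides P x
      divides-cancel {c} {quat _ _ _ _} ¬c d =
        let a , b , e , f = components-divides d
        in divides-components (∣-cancelˡ ¬c a) (∣-cancelˡ ¬c b) (∣-cancelˡ ¬c e) (∣-cancelˡ ¬c f)

      -- The polar form is nondegenerate modulo p since p is odd: a basis vector along a coordinate
      -- of x that p does not divide serves as y.
      nonzero-pairing : ∀ {x} → ¬ Divides P x → ∃[ y ] ¬ P ∣ + 2 * inner x y
      nonzero-pairing {quat a b c d} ¬d
        with P ∣? a | P ∣? b | P ∣? c | P ∣? d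
      ... | yes p | yes q | yes r | yes s = ⊥-elim (¬d (divides-components p q r s))
      ... | no ¬a | _ | _ | _ = quat (+ 1) (+ 0) (+ 0) (+ 0) ,
        λ z → ¬a (∣-cancelˡ P∤2 (subst (λ t → P ∣ + 2 * t) (lemma a b c d) z))
        where
        lemma : ∀ a b c d → a * + 1 + b * + 0 + c * + 0 + d * + 0 ≡ a
        lemma = solve-∀
      ... | yes _ | no ¬b | _ | _ = quat (+ 0) (+ 1) (+ 0) (+ 0) ,
        λ z → ¬b (∣-cancelˡ P∤2 (subst (λ t → P ∣ + 2 * t) (lemma a b c d) z))
        where
        lemma : ∀ a b c d → a * + 0 + b * + 1 + c * + 0 + d * + 0 ≡ b
        lemma = solve-∀
      ... | yes _ | yes _ | no ¬c | _ = quat (+ 0) (+ 0) (+ 1) (+ 0) ,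
        λ z → ¬c (∣-cancelˡ P∤2 (subst (λ t → P ∣ + 2 * t) (lemma a b c d) z))
        where
        lemma : ∀ a b c d → a * + 0 + b * + 0 + c * + 1 + d * + 0 ≡ c
        lemma = solve-∀
      ... | yes _ | yes _ | yes _ | no ¬d′ = quat (+ 0) (+ 0) (+ 0) (+ 1) ,
        λ z → ¬d′ (∣-cancelˡ P∤2 (subst (λ t → P ∣ + 2 * t) (lemma a b c d) z))
        where
        lemma : ∀ a b c d → a * + 0 + b * + 0 + c * + 0 + d * + 1 ≡ d
        lemma = solve-∀

    -- Choosing y with 2⟨t,y⟩ ≢ 0, one has 2⟨t,y⟩ a b = (a t)(ȳ b) + (a y)(t̄ b).
    annihilate : ∀ t {a b} → ¬ Divides P t → Divides P (a · t) → Divides P (conj t · b) → Divides P (a · b)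
    annihilate t {a} {b} ¬t at tb = divides-cancel ¬c (subst (Divides P) eq
      (divides-⊕ (divides-·ʳ (conj y · b) at) (divides-·ˡ (a · y) tb)))
      where
      open ≡-Reasoning
      y = proj₁ (nonzero-pairing ¬t)
      ¬c = proj₂ (nonzero-pairing ¬t)
      inside : ∀ r s → a · r · (s · b) ≡ a · (r · s) · b
      inside r s = trans (sym (·-assoc (a · r) s b)) (cong (_· b) (·-assoc a r s))
      eq : a · t · (conj y · b) ⊕ a · y · (conj t · b) ≡ scale (+ 2 * inner t y) (a · b)
      eq = begin
        a · t · (conj y · b) ⊕ a · y · (conj t · b) ≡⟨ cong₂ _⊕_ (inside t (conj y)) (inside y (conj t)) ⟩
        a · (t · conj y) · b ⊕ a · (y · conj t) · b ≡⟨ sym (·-distribʳ b _ _) ⟩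
        (a · (t · conj y) ⊕ a · (y · conj t)) · b ≡⟨ cong (_· b) (sym (·-distribˡ a _ _)) ⟩
        a · (t · conj y ⊕ y · conj t) · b ≡⟨ cong (λ z → a · z · b) (·-polar t y) ⟩
        a · real (+ 2 * inner t y) · b ≡⟨ cong (_· b) (·-real _ a) ⟩
        scale (+ 2 * inner t y) a · b ≡⟨ scale-·ˡ _ a b ⟩
        scale (+ 2 * inner t y) (a · b) ∎

-- Descent to quaternions of norm p in a right ideal

module Descent where
  open Quaternion
  open ModularQuaternion
  open import Data.Integer using (+_; -[1+_]; -_; _+_; _*_; _-_; _⊖_; NonZero; _/ℕ_; _%ℕ_) renaming (∣_∣ to abs)
  open import Data.Integer.DivMod using (a≡a%ℕn+[a/ℕn]*n; n%ℕd<d)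
  open import Data.Integer.Divisibility.Signed
  open import Data.Integer.Properties
  open ≡

  square-abs : ∀ i → i * i ≡ + (abs i ℕ.* abs i)
  square-abs (+ n) = sym (pos-* n n)
  square-abs -[1+ n ] = refl

  balanced : ∀ m .{{_ : ℕ.NonZero m}} a → ∃[ r ] ∃[ z ] (a ≡ r + + m * z × 2 ℕ.* abs r ℕ.≤ m)
  balanced m a with 2 ℕ.* (a %ℕ m) ℕ.≤? m
  ... | yes le = + (a %ℕ m) , a /ℕ m ,
    trans (a≡a%ℕn+[a/ℕn]*n a m) (cong (_+_ (+ (a %ℕ m))) (*-comm (a /ℕ m) (+ m))) , le
  ... | no ¬le = (a %ℕ m) ⊖ m , a /ℕ m + + 1 ,
    trans (a≡a%ℕn+[a/ℕn]*n a m)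
      (trans (lemma (+ (a %ℕ m)) (a /ℕ m) (+ m))
             (cong (_+ + m * (a /ℕ m + + 1)) (m-n≡m⊖n (a %ℕ m) m))) ,
    subst (λ t → 2 ℕ.* t ℕ.≤ m) (sym (∣⊖∣-≤ (ℕ.<⇒≤ r<m))) bound
    where
    open ℕ.≤-Reasoning
    lemma : ∀ r q m → r + q * m ≡ (r - m) + m * (q + + 1)
    lemma = solve-∀
    r<m = n%ℕd<d a m
    r = a %ℕ m
    bound : 2 ℕ.* (m ℕ.∸ r) ℕ.≤ m
    bound = begin
      2 ℕ.* (m ℕ.∸ r) ≡⟨ ℕ.*-distribˡ-∸ 2 m r ⟩
      2 ℕ.* m ℕ.∸ 2 ℕ.* r ≤⟨ ℕ.∸-monoʳ-≤ (2 ℕ.* m) (ℕ.<⇒≤ (ℕ.≰⇒> ¬le)) ⟩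
      2 ℕ.* m ℕ.∸ m ≡⟨ cong (λ t → m ℕ.+ t ℕ.∸ m) (ℕ.+-identityʳ m) ⟩
      m ℕ.+ m ℕ.∸ m ≡⟨ ℕ.m+n∸n≡m m m ⟩
      m ∎

  normℕ : ℍ → ℕ
  normℕ (quat a b c d) = abs a ℕ.* abs a ℕ.+ abs b ℕ.* abs b ℕ.+ abs c ℕ.* abs c ℕ.+ abs d ℕ.* abs d

  Small : ℕ → ℍ → Set
  Small m (quat a b c d) = (2 ℕ.* abs a ℕ.≤ m × 2 ℕ.* abs b ℕ.≤ m) × (2 ℕ.* abs c ℕ.≤ m × 2 ℕ.* abs d ℕ.≤ m)

  -- The only case in which a remainder modulo m has norm m² and the descent does not progress. For
  -- m = 0 the same formula says that all coordinates vanish, so both degenerate cases of the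
  -- descent share one treatment.
  Extremal : ℕ → ℍ → Set
  Extremal m (quat a b c d) = (2 ℕ.* abs a ≡ m × 2 ℕ.* abs b ≡ m) × (2 ℕ.* abs c ≡ m × 2 ℕ.* abs d ≡ m)

  square-< : ∀ {a m} → a ℕ.< m → a ℕ.* a ℕ.< m ℕ.* m
  square-< a<m = ℕ.*-mono-< a<m a<m

  square-≤ : ∀ {a m} → a ℕ.≤ m → a ℕ.* a ℕ.≤ m ℕ.* m
  square-≤ a≤m = ℕ.*-mono-≤ a≤m a≤m

  private
    double² : ∀ a b c d → (2 ℕ.* a) ℕ.* (2 ℕ.* a) ℕ.+ (2 ℕ.* b) ℕ.* (2 ℕ.* b)
                          ℕ.+ ((2 ℕ.* c) ℕ.* (2 ℕ.* c) ℕ.+ (2 ℕ.* d) ℕ.* (2 ℕ.* d))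
                          ≡ 4 ℕ.* (a ℕ.* a ℕ.+ b ℕ.* b ℕ.+ c ℕ.* c ℕ.+ d ℕ.* d)
    double² = solve 4 (λ a b c d → (con 2 :* a) :* (con 2 :* a) :+ (con 2 :* b) :* (con 2 :* b)
                          :+ ((con 2 :* c) :* (con 2 :* c) :+ (con 2 :* d) :* (con 2 :* d))
                          := con 4 :* (a :* a :+ b :* b :+ c :* c :+ d :* d)) refl
      where open ℕ.+-*-Solver

    four² : ∀ n → n ℕ.+ n ℕ.+ (n ℕ.+ n) ≡ 4 ℕ.* n
    four² = solve 1 (λ n → n :+ n :+ (n :+ n) := con 4 :* n) refl
      where open ℕ.+-*-Solver

  small-norm : ∀ {m} x → Small m x → normℕ x ℕ.≤ m ℕ.* m
  small-norm {m} (quat a b c d) ((p , q) , (r , s)) = ℕ.*-cancelˡ-≤ 4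
    (subst₂ ℕ._≤_ (double² (abs a) (abs b) (abs c) (abs d)) (four² (m ℕ.* m))
      (ℕ.+-mono-≤ (ℕ.+-mono-≤ (square-≤ p) (square-≤ q)) (ℕ.+-mono-≤ (square-≤ r) (square-≤ s))))

  +-tight : ∀ {a b m n} → a ℕ.≤ m → b ℕ.≤ n → a ℕ.+ b ≡ m ℕ.+ n → a ≡ m × b ≡ n
  +-tight {a} {b} {m} {n} a≤m b≤n eq with ℕ.m≤n⇒m<n∨m≡n a≤m
  ... | inj₁ a<m = ⊥-elim (ℕ.<-irrefl eq (ℕ.+-mono-<-≤ a<m b≤n))
  ... | inj₂ refl = refl , ℕ.+-cancelˡ-≡ a b n eq

  square-tight : ∀ {a m} → a ℕ.≤ m → a ℕ.* a ≡ m ℕ.* m → a ≡ m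
  square-tight a≤m eq with ℕ.m≤n⇒m<n∨m≡n a≤m
  ... | inj₁ a<m = ⊥-elim (ℕ.<-irrefl eq (square-< a<m))
  ... | inj₂ a≡m = a≡m

  small-extremal : ∀ {m} x → Small m x → normℕ x ≡ m ℕ.* m → Extremal m x
  small-extremal {m} (quat a b c d) ((p , q) , (r , s)) eq
    with sum≡ ← trans (double² (abs a) (abs b) (abs c) (abs d)) (trans (cong (4 ℕ.*_) eq) (sym (four² (m ℕ.* m))))
    with ab , cd ← +-tight (ℕ.+-mono-≤ (square-≤ p) (square-≤ q)) (ℕ.+-mono-≤ (square-≤ r) (square-≤ s)) sum≡
    with a² , b² ← +-tight (square-≤ p) (square-≤ q) ab | c² , d² ← +-tight (square-≤ r) (square-≤ s) cd
    = (square-tight p a² , square-tight q b²) , (square-tight r c² , square-tight s d²)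

  extremal-zero : ∀ x → normℕ x ≡ 0 → Extremal 0 x
  extremal-zero (quat a b c d) eq =
    (root (abs a) p , root (abs b) q) , (root (abs c) r , root (abs d) s)
    where
    root : ∀ n → n ℕ.* n ≡ 0 → 2 ℕ.* n ≡ 0
    root zero _ = refl
    root (suc _) ()
    A B C D : ℕ
    A = abs a ℕ.* abs a
    B = abs b ℕ.* abs b
    C = abs c ℕ.* abs c
    D = abs d ℕ.* abs d
    abc : A ℕ.+ B ℕ.+ C ≡ 0
    abc = ℕ.m+n≡0⇒m≡0 (A ℕ.+ B ℕ.+ C) eq
    ab : A ℕ.+ B ≡ 0
    ab = ℕ.m+n≡0⇒m≡0 (A ℕ.+ B) abc
    p : A ≡ 0
    p = ℕ.m+n≡0⇒m≡0 A ab
    q : B ≡ 0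
    q = ℕ.m+n≡0⇒n≡0 A ab
    r : C ≡ 0
    r = ℕ.m+n≡0⇒n≡0 (A ℕ.+ B) abc
    s : D ≡ 0
    s = ℕ.m+n≡0⇒n≡0 (A ℕ.+ B ℕ.+ C) eq

  extremal-∣ : ∀ {k m} a → k ℕ.∣ m → 2 ℕ.* abs a ≡ m → + k ∣ + 2 * a
  extremal-∣ {k} a k∣m eq = ∣ᵤ⇒∣ (subst (k ℕ.∣_) (trans (sym eq) (sym (abs-* (+ 2) a))) k∣m)

  opaque
    unfolding _·_

    norm-normℕ : ∀ x → norm x ≡ + normℕ x
    norm-normℕ (quat a b c d) = begin
      a * a + b * b + c * c + d * d ≡⟨ cong₂ _+_ (cong₂ _+_ (cong₂ _+_ (square-abs a) (square-abs b)) (square-abs c)) (square-abs d) ⟩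
      + A + + B + + C + + D ≡⟨ cong (λ t → t + + C + + D) (sym (pos-+ A B)) ⟩
      + (A ℕ.+ B) + + C + + D ≡⟨ cong (_+ + D) (sym (pos-+ (A ℕ.+ B) C)) ⟩
      + (A ℕ.+ B ℕ.+ C) + + D ≡⟨ sym (pos-+ (A ℕ.+ B ℕ.+ C) D) ⟩
      + (A ℕ.+ B ℕ.+ C ℕ.+ D) ∎
      where
      open ≡-Reasoning
      A B C D : ℕ
      A = abs a ℕ.* abs a
      B = abs b ℕ.* abs b
      C = abs c ℕ.* abs c
      D = abs d ℕ.* abs d

    balanced-quat : ∀ m .{{_ : ℕ.NonZero m}} x → ∃[ r ] ∃[ z ] (x ≡ r ⊕ scale (+ m) z × Small m r)
    balanced-quat m (quat a b c d)
      with a′ , a″ , ea , la ← balanced m a | b′ , b″ , eb , lb ← balanced m b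
         | c′ , c″ , ec , lc ← balanced m c | d′ , d″ , ed , ld ← balanced m d
      = quat a′ b′ c′ d′ , quat a″ b″ c″ d″ , quat-≡ ea eb ec ed , (la , lb) , (lc , ld)

    inner-scaleʳ : ∀ s x y → inner x (scale s y) ≡ s * inner x y
    inner-scaleʳ s (quat a b c d) (quat e f g h) = lemma s a b c d e f g h
      where
      lemma : ∀ s a b c d e f g h → a * (s * e) + b * (s * f) + c * (s * g) + d * (s * h)
                                    ≡ s * (a * e + b * f + c * g + d * h)
      lemma = solve-∀

    extremal-inner : ∀ {k m} x z → k ℕ.∣ m → Extremal m x → + k ∣ + 2 * inner x z
    extremal-inner {k} (quat a b c d) (quat e f g h) k∣m ((p , q) , (r , s)) =
      subst (+ k ∣_) (lemma a b c d e f g h)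
        (∣m∣n⇒∣m+n (∣m∣n⇒∣m+n (∣m∣n⇒∣m+n (∣m⇒∣m*n e (extremal-∣ a k∣m p)) (∣m⇒∣m*n f (extremal-∣ b k∣m q)))
          (∣m⇒∣m*n g (extremal-∣ c k∣m r))) (∣m⇒∣m*n h (extremal-∣ d k∣m s)))
      where
      lemma : ∀ a b c d e f g h → + 2 * a * e + + 2 * b * f + + 2 * c * g + + 2 * d * h
                                  ≡ + 2 * (a * e + b * f + c * g + d * h)
      lemma = solve-∀

    divides-⊕-cancelʳ : ∀ {m x y} → Divides m (x ⊕ y) → Divides m y → Divides m x
    divides-⊕-cancelʳ {m} {quat a b c d} {quat e f g h} xy y =
      let p , q , r , s = components-divides {m} xy
          p′ , q′ , r′ , s′ = components-divides {m} y
      in divides-components {m} (∣m+n∣n⇒∣m p p′) (∣m+n∣n⇒∣m q q′) (∣m+n∣n⇒∣m r r′) (∣m+n∣n⇒∣m s s′)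

    scale-real : ∀ s t → scale s (real t) ≡ real (s * t)
    scale-real s t = quat-≡ refl (*-zeroʳ s) (*-zeroʳ s) (*-zeroʳ s)

  norm-balanced : ∀ m r z → norm (r ⊕ scale (+ m) z) ≡ norm r + + m * (+ 2 * inner r z + + m * norm z)
  norm-balanced m r z = begin
    norm (r ⊕ scale M z) ≡⟨ norm-⊕ r (scale M z) ⟩
    norm r + + 2 * inner r (scale M z) + norm (scale M z) ≡⟨ cong₂ (λ s t → norm r + + 2 * s + t) (inner-scaleʳ M r z) (norm-scale M z) ⟩
    norm r + + 2 * (M * inner r z) + M * M * norm z ≡⟨ lemma (norm r) (inner r z) (norm z) M ⟩
    norm r + M * (+ 2 * inner r z + M * norm z) ∎
    where
    open ≡-Reasoning
    M = + m
    lemma : ∀ n i k M → n + + 2 * (M * i) + M * M * k ≡ n + M * (+ 2 * i + M * k)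
    lemma = solve-∀

  residue-∣ : ∀ m r z → + m ∣ norm (r ⊕ scale (+ m) z) → m ℕ.∣ normℕ r
  residue-∣ m r z d = ∣⇒∣ᵤ (subst (+ m ∣_) (norm-normℕ r)
    (∣m+n∣n⇒∣m {m = norm r} (subst (+ m ∣_) (norm-balanced m r z) d)
      (∣m⇒∣m*n (+ 2 * inner r z + + m * norm z) (∣-refl {+ m}))))

  module _ (p : ℕ) (p-prime : Prime p) (p≢2 : p ≢ 2) where
    open ModPrime p p-prime p≢2

    P∤small : ∀ {m} .{{_ : ℕ.NonZero m}} → m ℕ.< p → ¬ P ∣ + m
    P∤small m<p d = ℕ.<⇒≱ m<p (ℕ.∣⇒≤ (∣⇒∣ᵤ d))

    -- Lagrange's descent, carried out inside the right ideal {x : u x ≡ 0 mod p}.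
    descent : ∀ u m → Acc ℕ._<_ m → .{{_ : ℕ.NonZero m}} → m ℕ.< p →
              ∀ x → norm x ≡ + m * P → Divides P (u · x) →
              ∃[ q ] (norm q ≡ P × Divides P (u · q))
    descent u m (acc rec) m<p x nx ux
      with r , z , refl , small ← balanced-quat m x
      with ℕ.divides m′ eq ← residue-∣ m r z (subst (+ m ∣_) (sym nx) (∣m⇒∣m*n P (∣-refl {+ m})))
      = go
      where
      M = + m
      norm-r : norm r ≡ + m′ * M
      norm-r = trans (norm-normℕ r) (trans (cong +_ eq) (pos-* m′ m))

      P≡ : P ≡ + m′ + (+ 2 * inner r z + M * norm z)
      P≡ = *-cancelˡ-≡ M P _ (begin
        M * P ≡⟨ sym nx ⟩
        norm (r ⊕ scale M z) ≡⟨ norm-balanced m r z ⟩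
        norm r + M * (+ 2 * inner r z + M * norm z) ≡⟨ cong (_+ M * (+ 2 * inner r z + M * norm z)) (trans norm-r (*-comm (+ m′) M)) ⟩
        M * + m′ + M * (+ 2 * inner r z + M * norm z) ≡⟨ sym (*-distribˡ-+ M _ _) ⟩
        M * (+ m′ + (+ 2 * inner r z + M * norm z)) ∎)
        where open ≡-Reasoning

      -- In both degenerate cases m divides m′ and 2⟨r, z⟩, hence by `P≡` also p. As m < p this
      -- forces m = 1, so x itself has norm p.
      unit : m ℕ.∣ m′ → + m ∣ + 2 * inner r z → ∃[ q ] (norm q ≡ P × Divides P (u · q))
      unit d e with prime⇒irreducible p-prime (∣⇒∣ᵤ (subst (M ∣_) (sym P≡) 
          (∣m∣n⇒∣m+n {m = + m′} (∣ᵤ⇒∣ d) (∣m∣n⇒∣m+n {m = + 2 * inner r z} e (∣m⇒∣m*n (norm z) (∣-refl {M}))))))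
      ... | inj₁ m≡1 = r ⊕ scale M z , trans nx (trans (cong (λ t → + t * P) m≡1) (*-identityˡ P)) , ux
      ... | inj₂ m≡p = ⊥-elim (ℕ.<-irrefl m≡p m<p)

      -- This is x r̄ / m for x = r + m z, because r r̄ = m′ m. Its norm is (m p)(m′ m)/m² = m′ p,
      -- and multiplying x on the right keeps it in the right ideal.
      y = real (+ m′) ⊕ z · conj r

      scale-y : scale M y ≡ (r ⊕ scale M z) · conj r
      scale-y = begin
        scale M (real (+ m′) ⊕ z · conj r) ≡⟨ scale-⊕ M _ _ ⟩
        scale M (real (+ m′)) ⊕ scale M (z · conj r) ≡⟨ cong₂ _⊕_ (trans (scale-real M (+ m′)) (cong real (trans (*-comm M (+ m′)) (sym norm-r)))) (sym (scale-·ˡ M z (conj r))) ⟩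
        real (norm r) ⊕ scale M z · conj r ≡⟨ cong (_⊕ scale M z · conj r) (sym (·-conj r)) ⟩
        r · conj r ⊕ scale M z · conj r ≡⟨ sym (·-distribʳ (conj r) r (scale M z)) ⟩
        (r ⊕ scale M z) · conj r ∎
        where open ≡-Reasoning

      norm-y : norm y ≡ + m′ * P
      norm-y = *-cancelˡ-≡ (M * M) _ _ {{i*j≢0 M M}} (begin
        M * M * norm y ≡⟨ sym (norm-scale M y) ⟩
        norm (scale M y) ≡⟨ cong norm scale-y ⟩
        norm ((r ⊕ scale M z) · conj r) ≡⟨ norm-· _ _ ⟩
        norm (r ⊕ scale M z) * norm (conj r) ≡⟨ cong₂ _*_ nx (trans (norm-conj r) norm-r) ⟩
        M * P * (+ m′ * M) ≡⟨ lemma M P (+ m′) ⟩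
        M * M * (+ m′ * P) ∎)
        where
        open ≡-Reasoning
        lemma : ∀ M P m′ → M * P * (m′ * M) ≡ M * M * (m′ * P)
        lemma = solve-∀

      uy : Divides P (u · y)
      uy = divides-cancel (P∤small m<p) (subst (Divides P) (begin
        u · (r ⊕ scale M z) · conj r ≡⟨ ·-assoc u _ _ ⟩
        u · ((r ⊕ scale M z) · conj r) ≡⟨ cong (u ·_) (sym scale-y) ⟩
        u · scale M y ≡⟨ scale-·ʳ M u y ⟩
        scale M (u · y) ∎) (divides-·ʳ (conj r) ux))
        where open ≡-Reasoning

      m′≤m : m′ ℕ.≤ m
      m′≤m = ℕ.*-cancelʳ-≤ m′ m m (subst (ℕ._≤ m ℕ.* m) eq (small-norm r small))

      go : ∃[ q ] (norm q ≡ P × Divides P (u · q))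
      go with m′ ℕ.≟ 0 | ℕ.m≤n⇒m<n∨m≡n m′≤m
      ... | yes refl | _ = unit (m ℕ.∣0) (extremal-inner r z (m ℕ.∣0) (extremal-zero r eq))
      ... | no _ | inj₂ refl = unit ℕ.∣-refl (extremal-inner r z ℕ.∣-refl (small-extremal r small eq))
      ... | no ≢0 | inj₁ m′<m = descent u m′ (rec m′<m) {{ℕ.≢-nonZero ≢0}} (ℕ.<-trans m′<m m<p) y norm-y uy

    -- Since u² = -N(u) ≡ 0, u lies in the right ideal that it defines. Reducing its coordinates
    -- modulo p gives a nonzero element of norm m p with 0 < m < p, from which the descent starts; m
    -- = p would make every doubled coordinate ±p and thus u ≡ 0.
    right-divisor : ∀ u → Imaginary u → ¬ Divides P u → P ∣ norm u →
                    ∃[ q ] (norm q ≡ P × Divides P (u · q))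
    right-divisor u iu ¬du P∣u
      with r , z , u≡ , small ← balanced-quat p u
      with ℕ.divides m eq ← residue-∣ p r z (subst (P ∣_) (cong norm u≡) P∣u)
      = descent u m (<-wellFounded m) {{ℕ.≢-nonZero m≢0}} m<p r
          (trans (norm-normℕ r) (trans (cong +_ eq) (pos-* m p))) ur
      where
      ur : Divides P (u · r)
      ur = divides-⊕-cancelʳ
        (subst (Divides P) (trans (sym (imaginary-square iu)) (trans (cong (u ·_) u≡) (·-distribˡ u r (scale P z))))
          (divides-real (∣m⇒∣-m P∣u)))
        (divides-·ˡ u (z , refl))

      extremal⇒divides : ∀ {n} → p ℕ.∣ n → Extremal n r → Divides P r
      extremal⇒divides p∣n e = opaque-components r p∣n e
        where
        opaque
          unfolding _·_
          opaque-components : ∀ {n} r → p ℕ.∣ n → Extremal n r → Divides P r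
          opaque-components (quat a b c d) p∣n ((e , f) , (g , h)) = divides-components {P}
            (∣-cancelˡ P∤2 (extremal-∣ a p∣n e)) (∣-cancelˡ P∤2 (extremal-∣ b p∣n f))
            (∣-cancelˡ P∤2 (extremal-∣ c p∣n g)) (∣-cancelˡ P∤2 (extremal-∣ d p∣n h))

      ¬dr : ¬ Divides P r
      ¬dr dr = ¬du (subst (Divides P) (sym u≡) (divides-⊕ dr (z , refl)))

      m≢0 : m ≢ 0
      m≢0 refl = ¬dr (extremal⇒divides (p ℕ.∣0) (extremal-zero r eq))

      m<p : m ℕ.< p
      m<p with ℕ.m≤n⇒m<n∨m≡n (ℕ.*-cancelʳ-≤ m p p (subst (ℕ._≤ p ℕ.* p) eq (small-norm r small)))
      ... | inj₁ lt = lt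
      ... | inj₂ refl = ⊥-elim (¬dr (extremal⇒divides ℕ.∣-refl (small-extremal r small eq)))

-- An isotropic vector and linear equations modulo p

module Conic where
  open Quaternion
  open ModularQuaternion
  open Descent
  open import Data.Fin as Fin using (toℕ; fromℕ<)
  open import Data.Fin.Properties using (toℕ<n; toℕ-fromℕ<; pigeonhole)
  open import Data.Integer using (ℤ; +_; -_; _+_; _*_; _-_; _/ℕ_; _%ℕ_) renaming (∣_∣ to abs)
  open import Data.Integer.DivMod using (a≡a%ℕn+[a/ℕn]*n; n%ℕd<d)
  open import Data.Integer.Divisibility.Signed
  open import Data.Integer.Properties
  open ≡

  module _ (p : ℕ) (p-prime : Prime p) (p≢2 : p ≢ 2) where
    open ModPrime p p-prime p≢2

    ∣-small : ∀ {a} → a ℕ.< p → p ℕ.∣ a → a ≡ 0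
    ∣-small {zero} _ _ = refl
    ∣-small {suc a} a<p p∣a = ⊥-elim (ℕ.<⇒≱ a<p (ℕ.∣⇒≤ p∣a))

    ∣-diff : ∀ {a b} → a ℕ.≤ b → b ℕ.< p → P ∣ + a - + b → a ≡ b
    ∣-diff {a} {b} a≤b b<p d = ℕ.≤-antisym a≤b (ℕ.m∸n≡0⇒m≤n
      (∣-small (ℕ.≤-<-trans (ℕ.m∸n≤m b a) b<p)
        (subst (p ℕ.∣_) (trans (cong abs (m-n≡m⊖n a b)) (∣⊖∣-≤ a≤b)) (∣⇒∣ᵤ d))))

    neg-diff : ∀ a b → - (a - b) ≡ b - a
    neg-diff = solve-∀

    residue-unique : ∀ {a b} → a ℕ.< p → b ℕ.< p → P ∣ + a - + b → a ≡ b
    residue-unique {a} {b} a<p b<p d with ℕ.≤-total a b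
    ... | inj₁ a≤b = ∣-diff a≤b b<p d
    ... | inj₂ b≤a = sym (∣-diff b≤a a<p (subst (P ∣_) (neg-diff (+ a) (+ b)) (∣m⇒∣-m d)))

    residue-≡ : ∀ a b → a %ℕ p ≡ b %ℕ p → P ∣ a - b
    residue-≡ a b eq = divides (a /ℕ p - b /ℕ p) (begin
      a - b ≡⟨ cong₂ _-_ (a≡a%ℕn+[a/ℕn]*n a p) (a≡a%ℕn+[a/ℕn]*n b p) ⟩
      (+ (a %ℕ p) + a /ℕ p * P) - (+ (b %ℕ p) + b /ℕ p * P) ≡⟨ cong (λ t → (+ t + a /ℕ p * P) - (+ (b %ℕ p) + b /ℕ p * P)) eq ⟩
      (+ (b %ℕ p) + a /ℕ p * P) - (+ (b %ℕ p) + b /ℕ p * P) ≡⟨ lemma (+ (b %ℕ p)) (a /ℕ p) (b /ℕ p) P ⟩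
      (a /ℕ p - b /ℕ p) * P ∎)
      where
      open ≡-Reasoning
      lemma : ∀ r x y P → (r + x * P) - (r + y * P) ≡ (x - y) * P
      lemma = solve-∀

    half : ℕ
    half = p ℕ./ 2

    2∤p : ¬ 2 ℕ.∣ p
    2∤p d with prime⇒irreducible p-prime d
    ... | inj₂ 2≡p = p≢2 (sym 2≡p)

    p≡1+2half : p ≡ suc (half ℕ.* 2)
    p≡1+2half with p ℕ.% 2 in eq | ℕ.m%n<n p 2
    ... | 0 | _ = ⊥-elim (2∤p (ℕ.m%n≡0⇒n∣m p 2 eq))
    ... | 1 | _ = trans (ℕ.m≡m%n+[m/n]*n p 2) (cong (ℕ._+ half ℕ.* 2) eq)
    ... | suc (suc _) | ℕ.s≤s (ℕ.s≤s ())

    sum<p : ∀ {a b} → a ℕ.≤ half → b ℕ.≤ half → a ℕ.+ b ℕ.< p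
    sum<p {a} {b} a≤h b≤h = begin-strict
      a ℕ.+ b ≤⟨ ℕ.+-mono-≤ a≤h b≤h ⟩
      half ℕ.+ half ≡⟨ cong (half ℕ.+_) (sym (ℕ.+-identityʳ half)) ⟩
      2 ℕ.* half ≡⟨ ℕ.*-comm 2 half ⟩
      half ℕ.* 2 <⟨ ℕ.n<1+n _ ⟩
      suc (half ℕ.* 2) ≡⟨ sym p≡1+2half ⟩
      p ∎
      where open ℕ.≤-Reasoning

    squares-distinct : ∀ {a b} → a ℕ.< b → b ℕ.≤ half → ¬ P ∣ + a * + a - + b * + b
    squares-distinct {a} {b} a<b b≤h d
      with prime-∣-* (+ a - + b) (+ a + + b) (subst (P ∣_) (lemma (+ a) (+ b)) d)
      where
      lemma : ∀ a b → a * a - b * b ≡ (a - b) * (a + b)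
      lemma = solve-∀
    ... | inj₁ x = ℕ.<-irrefl (∣-diff (ℕ.<⇒≤ a<b) (ℕ.≤-<-trans (ℕ.m≤n+m b b) (sum<p b≤h b≤h)) x) a<b
    ... | inj₂ y = ℕ.<⇒≢ (ℕ.≤-<-trans ℕ.z≤n a<b) (sym (ℕ.m+n≡0⇒n≡0 a
      (∣-small (sum<p (ℕ.≤-trans (ℕ.<⇒≤ a<b) b≤h) b≤h) (∣⇒∣ᵤ (subst (P ∣_) (sym (pos-+ a b)) y)))))

    -- The residues of k² (k ≤ h) and of −1 − k² (k ≤ h) number p + 1, so two of them collide.
    candidate : ℕ → ℤ
    candidate k with k ℕ.≤? half
    ... | yes _ = + k * + k
    ... | no _ = - (+ 1) - + (k ℕ.∸ suc half) * + (k ℕ.∸ suc half)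

    ≤half : ∀ {k} → k ℕ.≤ p → k ℕ.∸ suc half ℕ.≤ half
    ≤half {k} k≤p = begin
      k ℕ.∸ suc half ≤⟨ ℕ.∸-monoˡ-≤ (suc half) k≤p ⟩
      p ℕ.∸ suc half ≡⟨ cong (ℕ._∸ suc half) p≡1+2half ⟩
      half ℕ.* 2 ℕ.∸ half ≡⟨ cong (ℕ._∸ half) (trans (ℕ.*-comm half 2) (cong (half ℕ.+_) (ℕ.+-identityʳ half))) ⟩
      half ℕ.+ half ℕ.∸ half ≡⟨ ℕ.m+n∸n≡m half half ⟩
      half ∎
      where open ℕ.≤-Reasoning

    -- Within each of the two families of candidates the residues are distinct, so a collision pairs
    -- some a² with some -1 - b².
    collision : ∀ {i j} → i ℕ.< j → j ℕ.≤ p → P ∣ candidate i - candidate j →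
                ∃[ s ] ∃[ t ] P ∣ + 1 + s * s + t * t
    collision {i} {j} i<j j≤p d with i ℕ.≤? half | j ℕ.≤? half
    ... | yes _ | yes j≤h = ⊥-elim (squares-distinct i<j j≤h d)
    ... | no i≰h | yes j≤h = ⊥-elim (i≰h (ℕ.≤-trans (ℕ.<⇒≤ i<j) j≤h))
    ... | yes _ | no _ = + i , + (j ℕ.∸ suc half) , subst (P ∣_) (lemma (+ i) (+ (j ℕ.∸ suc half))) d
      where
      lemma : ∀ a b → a * a - (- (+ 1) - b * b) ≡ + 1 + a * a + b * b
      lemma = solve-∀
    ... | no i≰h | no j≰h = ⊥-elim (squares-distinct (ℕ.∸-monoˡ-< i<j (ℕ.≰⇒> i≰h)) (≤half j≤p)
            (subst (P ∣_) (lemma (+ (i ℕ.∸ suc half)) (+ (j ℕ.∸ suc half))) (∣m⇒∣-m d)))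
      where
      lemma : ∀ a b → - ((- (+ 1) - a * a) - (- (+ 1) - b * b)) ≡ a * a - b * b
      lemma = solve-∀

    isotropic : ∃[ s ] ∃[ t ] P ∣ + 1 + s * s + t * t
    isotropic
      with i , j , i<j , eq ← pigeonhole (ℕ.n<1+n p) (λ k → fromℕ< (n%ℕd<d (candidate (toℕ k)) p))
      = collision i<j (ℕ.≤-pred (toℕ<n j)) (residue-≡ (candidate (toℕ i)) (candidate (toℕ j))
          (trans (sym (toℕ-fromℕ< (n%ℕd<d (candidate (toℕ i)) p)))
            (trans (cong toℕ eq) (toℕ-fromℕ< (n%ℕd<d (candidate (toℕ j)) p)))))

    inverse : ∀ b → ¬ P ∣ b → ∃[ y ] P ∣ y * b - + 1
    inverse b ¬d = go (Coprime.coprime-Bézout (Coprime.prime⇒coprime p-prime {{ℕ.≢-nonZero r≢0}} (n%ℕd<d b p)))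
      where
      r = b %ℕ p
      b≡ : b ≡ + r + b /ℕ p * P
      b≡ = a≡a%ℕn+[a/ℕn]*n b p
      r≢0 : r ≢ 0
      r≢0 r≡0 = ¬d (divides (b /ℕ p) (trans b≡ (trans (cong (λ t → + t + b /ℕ p * P) r≡0) (+-identityˡ (b /ℕ p * P)))))
      lift : ∀ {x y} → 1 ℕ.+ y ℕ.* r ≡ x ℕ.* p → + 1 + + y * + r ≡ + x * P
      lift {x} {y} eq = begin
        + 1 + + y * + r ≡⟨ cong (_+_ (+ 1)) (sym (pos-* y r)) ⟩
        + 1 + + (y ℕ.* r) ≡⟨ cong +_ eq ⟩
        + (x ℕ.* p) ≡⟨ pos-* x p ⟩
        + x * P ∎
        where open ≡-Reasoning
      go : Bézout.Identity 1 p r → ∃[ y ] P ∣ y * b - + 1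
      go (Bézout.+- x y eq) = - (+ y) , divides (- (+ x) - + y * (b /ℕ p)) (begin
        - (+ y) * b - + 1 ≡⟨ cong (λ t → - (+ y) * t - + 1) b≡ ⟩
        - (+ y) * (+ r + b /ℕ p * P) - + 1 ≡⟨ lemma (+ y) (+ r) (b /ℕ p) P ⟩
        - (+ 1 + + y * + r) - + y * (b /ℕ p) * P ≡⟨ cong (λ t → - t - + y * (b /ℕ p) * P) (lift {x} {y} eq) ⟩
        - (+ x * P) - + y * (b /ℕ p) * P ≡⟨ lemma′ (+ x) (+ y) (b /ℕ p) P ⟩
        (- (+ x) - + y * (b /ℕ p)) * P ∎)
        where
        open ≡-Reasoning
        lemma : ∀ y r k P → - y * (r + k * P) - + 1 ≡ - (+ 1 + y * r) - y * k * P
        lemma = solve-∀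
        lemma′ : ∀ x y k P → - (x * P) - y * k * P ≡ (- x - y * k) * P
        lemma′ = solve-∀
      go (Bézout.-+ x y eq) = + y , divides (+ x + + y * (b /ℕ p)) (begin
        + y * b - + 1 ≡⟨ cong (λ t → + y * t - + 1) b≡ ⟩
        + y * (+ r + b /ℕ p * P) - + 1 ≡⟨ lemma (+ y) (+ r) (b /ℕ p) P ⟩
        + y * + r - + 1 + + y * (b /ℕ p) * P ≡⟨ cong (λ t → t - + 1 + + y * (b /ℕ p) * P) (trans (sym (pos-* y r)) (trans (cong +_ (sym eq)) (cong (_+_ (+ 1)) (pos-* x p)))) ⟩
        (+ 1 + + x * P) - + 1 + + y * (b /ℕ p) * P ≡⟨ lemma′ (+ x) (+ y) (b /ℕ p) P ⟩
        (+ x + + y * (b /ℕ p)) * P ∎)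
        where
        open ≡-Reasoning
        lemma : ∀ y r k P → y * (r + k * P) - + 1 ≡ y * r - + 1 + y * k * P
        lemma = solve-∀
        lemma′ : ∀ x y k P → (+ 1 + x * P) - + 1 + y * k * P ≡ (x + y * k) * P
        lemma′ = solve-∀

    -- Supplies the parameter m with γ + m β ≡ 0 that places an isotropic vector on the conic in
    -- `point-parallel`.
    linear-root : ∀ b c → ¬ P ∣ b → ∃[ m ] (m ℕ.< p × P ∣ c + + m * b)
    linear-root b c ¬d = n , n%ℕd<d (- c * y) p ,
      subst (P ∣_) (sym eq) (∣m∣n⇒∣m-n (∣m⇒∣-m (∣n⇒∣m*n c d)) (∣n⇒∣m*n (((- c * y) /ℕ p) * b) (∣-refl {P})))
      where
      open ≡-Reasoning
      y = proj₁ (inverse b ¬d)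
      d = proj₂ (inverse b ¬d)
      n = (- c * y) %ℕ p
      lemma : ∀ c y b r k P → r + k * P ≡ - c * y → c + r * b ≡ - (c * (y * b - + 1)) - k * b * P
      lemma c y b r k P e = begin
        c + r * b ≡⟨ l₁ c b r k P ⟩
        c + (r + k * P) * b - k * b * P ≡⟨ cong (λ t → c + t * b - k * b * P) e ⟩
        c + - c * y * b - k * b * P ≡⟨ l₂ c y b k P ⟩
        - (c * (y * b - + 1)) - k * b * P ∎
        where
        l₁ : ∀ c b r k P → c + r * b ≡ c + (r + k * P) * b - k * b * P
        l₁ = solve-∀
        l₂ : ∀ c y b k P → c + - c * y * b - k * b * P ≡ - (c * (y * b - + 1)) - k * b * P
        l₂ = solve-∀
      eq : c + + n * b ≡ - (c * (y * b - + 1)) - ((- c * y) /ℕ p) * b * P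
      eq = lemma c y b (+ n) ((- c * y) /ℕ p) P (sym (a≡a%ℕn+[a/ℕn]*n (- c * y) p))

-- The p + 1 points of the conic and their quaternions of norm p

module ConicPoint where
  open Quaternion
  open ModularQuaternion
  open Descent
  open Conic
  open import Data.Fin as Fin using (Fin; zero; suc; toℕ; fromℕ<)
  open import Data.Fin.Properties using (toℕ<n; toℕ-injective; toℕ-fromℕ<)
  open import Data.Integer using (ℤ; +_; -_; _+_; _*_; _-_)
  open import Data.Integer.Divisibility.Signed
  open import Data.Integer.Properties
  open ≡

  module ConicPoints (p : ℕ) (p-prime : Prime p) (p≢2 : p ≢ 2)
                (s t : ℤ) (P∣E : + p ∣ + 1 + s * s + t * t) where
    open ModPrime p p-prime p≢2

    E : ℤ
    E = + 1 + s * s + t * t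

    curve : ℤ → ℤ → ℤ → ℍ
    curve s t m = quat (+ 0) (m * m + + 1) (m * m * s - s - + 2 * m * t) (m * m * t - t + + 2 * m * s)

    -- The points of the conic x² + y² + z² = 0 over 𝔽ₚ: with e = (1, s, t), f = (1, −s, −t) and
    -- g = (0, −t, s), they are e and m² e + f + 2m g.
    point : Fin (suc p) → ℍ
    point zero = quat (+ 0) (+ 1) s t
    point (suc m) = curve s t (+ toℕ m)

    point-imaginary : ∀ i → Imaginary (point i)
    point-imaginary zero = refl
    point-imaginary (suc m) = refl

    -- The two-square identity (sy + tz)² + (sz - ty)² = (s² + t²)(y² + z²) turns x² - (sy + tz)²
    -- into (sz - ty)², up to multiples of x² + y² + z² and of 1 + s² + t².
    αβ≡γ² : ∀ s t x y z → (x - s * y - t * z) * (x + s * y + t * z) - (+ 0 * + 0 + x * x + y * y + z * z)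
            + (y * y + z * z) * (+ 1 + s * s + t * t) ≡ (s * z - t * y) * (s * z - t * y)
    αβ≡γ² = solve-∀

    half-y : ∀ s t x y z → + 2 * y ≡ (x - s * y - t * z) * s - (x + s * y + t * z) * s
             + + 2 * t * (s * z - t * y) + + 2 * (+ 1 + s * s + t * t) * y
    half-y = solve-∀

    half-z : ∀ s t x y z → + 2 * z ≡ (x - s * y - t * z) * t - (x + s * y + t * z) * t
             - + 2 * s * (s * z - t * y) + + 2 * (+ 1 + s * s + t * t) * z
    half-z = solve-∀

    opaque
      unfolding _·_

      point-norm : ∀ i → P ∣ norm (point i)
      point-norm zero = P∣E
      point-norm (suc m) = subst (P ∣_) (lemma s t (+ toℕ m)) (∣n⇒∣m*n ((M * M + + 1) * (M * M + + 1)) P∣E)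
        where
        M : ℤ
        M = + toℕ m
        lemma : ∀ s t m → (m * m + + 1) * (m * m + + 1) * (+ 1 + s * s + t * t)
                ≡ + 0 * + 0 + (m * m + + 1) * (m * m + + 1)
                  + (m * m * s - s - + 2 * m * t) * (m * m * s - s - + 2 * m * t)
                  + (m * m * t - t + + 2 * m * s) * (m * m * t - t + + 2 * m * s)
        lemma = solve-∀

      point-nonzero : ∀ i → ¬ Divides P (point i)
      point-nonzero zero d =
        let _ , P∣1 , _ = components-divides {P} d in P∤2 (∣m⇒∣m*n (+ 2) P∣1)
      point-nonzero (suc m) d =
        -- The pairing with e = (1, s, t) does not depend on m modulo p: e is isotropic and
        -- orthogonal to g, which leaves ⟨f, e⟩ = 1 - s² - t² ≡ 2.
        let _ , x , y , z = components-divides {P} d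
        in P∤2 (subst (P ∣_) (lemma s t (+ toℕ m))
             (∣m∣n⇒∣m-n (∣m∣n⇒∣m+n (∣m∣n⇒∣m+n x (∣n⇒∣m*n s y)) (∣n⇒∣m*n t z))
               (∣n⇒∣m*n (+ toℕ m * + toℕ m - + 1) P∣E)))
        where
        lemma : ∀ s t m → m * m + + 1 + s * (m * m * s - s - + 2 * m * t) + t * (m * m * t - t + + 2 * m * s)
                - (m * m - + 1) * (+ 1 + s * s + t * t) ≡ + 2
        lemma = solve-∀

      -- The real part of a product of imaginary quaternions is minus their inner product. Modulo p
      -- that inner product is 2(m - n)² for the points with parameters m and n, and 2 for
      -- `point zero` and any other point; as p is odd, it vanishes only if the points agree.
      point-distinct : ∀ i j → Divides P (point i · point j) → i ≡ j
      point-distinct zero zero d = refl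
      point-distinct zero (suc n) d = ⊥-elim (P∤2 (subst (P ∣_) (lemma s t (+ toℕ n))
        (∣m⇒∣-m (∣m∣n⇒∣m+n (divides-re {P} d) (∣n⇒∣m*n (+ toℕ n * + toℕ n - + 1) P∣E)))))
        where
        lemma : ∀ s t m → - (+ 0 * + 0 - + 1 * (m * m + + 1) - s * (m * m * s - s - + 2 * m * t) - t * (m * m * t - t + + 2 * m * s)
                + (m * m - + 1) * (+ 1 + s * s + t * t)) ≡ + 2
        lemma = solve-∀
      point-distinct (suc m) zero d = ⊥-elim (P∤2 (subst (P ∣_) (lemma s t (+ toℕ m))
        (∣m⇒∣-m (∣m∣n⇒∣m+n (divides-re {P} d) (∣n⇒∣m*n (+ toℕ m * + toℕ m - + 1) P∣E)))))
        where
        lemma : ∀ s t m → - (+ 0 * + 0 - (m * m + + 1) * + 1 - (m * m * s - s - + 2 * m * t) * s - (m * m * t - t + + 2 * m * s) * t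
                + (m * m - + 1) * (+ 1 + s * s + t * t)) ≡ + 2
        lemma = solve-∀
      point-distinct (suc m) (suc n) d = cong suc (toℕ-injective (residue-unique p p-prime p≢2 (toℕ<n m) (toℕ<n n)
        ([ id , id ]′ (prime-∣-* (M - N) (M - N) (∣-cancelˡ P∤2 (subst (P ∣_) (lemma s t M N)
          (∣m⇒∣-m (∣m∣n⇒∣m+n (divides-re {P} d) (∣n⇒∣m*n (M * M * (N * N) - M * M - N * N + + 1 + + 4 * (M * N)) P∣E)))))))))
        where
        M N : ℤ
        M = + toℕ m
        N = + toℕ n
        lemma : ∀ s t m n → - (+ 0 * + 0 - (m * m + + 1) * (n * n + + 1)
                  - (m * m * s - s - + 2 * m * t) * (n * n * s - s - + 2 * n * t)
                  - (m * m * t - t + + 2 * m * s) * (n * n * t - t + + 2 * n * s)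
                  + (m * m * (n * n) - m * m - n * n + + 1 + + 4 * (m * n)) * (+ 1 + s * s + t * t))
                  ≡ + 2 * ((m - n) * (m - n))
        lemma = solve-∀

      -- With β = x + sy + tz, multiplying 2w ≡ α e + β f - 2γ g by β and using α β ≡ γ² and γ ≡ -m
      -- β gives 2β w ≡ β² (m² e + f + 2m g).
      parallel-curve : ∀ x y z m → P ∣ + 0 * + 0 + x * x + y * y + z * z →
                       P ∣ s * z - t * y + m * (x + s * y + t * z) →
                       Divides P (scale (+ 2 * (x + s * y + t * z)) (quat (+ 0) x y z)
                                  ⊕ scale (- ((x + s * y + t * z) * (x + s * y + t * z))) (curve s t m))
      parallel-curve x y z M nw P∣λ = divides-components
          (subst (P ∣_) (l₀ β) (∣n⇒∣m*n (+ 0) P∣E))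
          (subst (P ∣_) (l₁ x (s * y) (t * z) M) P∣κ)
          (subst (P ∣_) (l₂ {y} (half-y s t x y z))
            (∣m∣n⇒∣m+n (∣m∣n⇒∣m+n (∣n⇒∣m*n s P∣κ) (∣n⇒∣m*n (+ 2 * t * β) P∣λ)) (∣n⇒∣m*n (+ 2 * β * y) P∣E)))
          (subst (P ∣_) (l₃ {z} (half-z s t x y z))
            (∣m∣n⇒∣m+n (∣m∣n⇒∣m+n (∣n⇒∣m*n t P∣κ) (∣n⇒∣m*n (- (+ 2 * s * β)) P∣λ)) (∣n⇒∣m*n (+ 2 * β * z) P∣E)))
        where
        α β γ : ℤ
        α = x - s * y - t * z
        β = x + s * y + t * z
        γ = s * z - t * y
        lκ : ∀ a b c m n e → a * b - n + e ≡ c * c → (c - m * b) * (c + m * b) + n - e ≡ a * b - b * m * (b * m)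
        lκ a b c m n e eq = trans (l c m b n e) (trans (cong (λ w → w - m * b * (m * b) + n - e) (sym eq)) (l′ a b m n e))
          where
          l : ∀ c m b n e → (c - m * b) * (c + m * b) + n - e ≡ c * c - m * b * (m * b) + n - e
          l = solve-∀
          l′ : ∀ a b m n e → (a * b - n + e) - m * b * (m * b) + n - e ≡ a * b - b * m * (b * m)
          l′ = solve-∀
        P∣κ : P ∣ α * β - β * M * (β * M)
        P∣κ = subst (P ∣_) (lκ α β γ M _ _ (αβ≡γ² s t x y z))
          (∣m∣n⇒∣m-n (∣m∣n⇒∣m+n (∣n⇒∣m*n (γ - M * β) P∣λ) nw) (∣n⇒∣m*n (y * y + z * z) P∣E))
        l₀ : ∀ b → + 0 * E ≡ + 2 * b * + 0 + - (b * b) * + 0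
        l₀ b = trans (*-zeroˡ E) (l b)
          where
          l : ∀ b → + 0 ≡ + 2 * b * + 0 + - (b * b) * + 0
          l = solve-∀
        l₁ : ∀ x v w m → (x - v - w) * (x + v + w) - (x + v + w) * m * ((x + v + w) * m)
             ≡ + 2 * (x + v + w) * x + - ((x + v + w) * (x + v + w)) * (m * m + + 1)
        l₁ = solve-∀
        l₂ : ∀ {y} → + 2 * y ≡ α * s - β * s + + 2 * t * γ + + 2 * E * y →
             s * (α * β - β * M * (β * M)) + + 2 * t * β * (γ + M * β) + + 2 * β * y * E
             ≡ + 2 * β * y + - (β * β) * (M * M * s - s - + 2 * M * t)
        l₂ {y} = gen s t α β γ M E y
          where
          gen : ∀ s t a b c m e y → + 2 * y ≡ a * s - b * s + + 2 * t * c + + 2 * e * y →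
                s * (a * b - b * m * (b * m)) + + 2 * t * b * (c + m * b) + + 2 * b * y * e
                ≡ + 2 * b * y + - (b * b) * (m * m * s - s - + 2 * m * t)
          gen s t a b c m e y eq = trans (g s t a b c m e y)
            (trans (cong (λ w → b * w + - (b * b) * (m * m * s - s - + 2 * m * t)) (sym eq)) (g′ b y (- (b * b) * (m * m * s - s - + 2 * m * t))))
            where
            g : ∀ s t a b c m e y → s * (a * b - b * m * (b * m)) + + 2 * t * b * (c + m * b) + + 2 * b * y * e
                ≡ b * (a * s - b * s + + 2 * t * c + + 2 * e * y) + - (b * b) * (m * m * s - s - + 2 * m * t)
            g = solve-∀
            g′ : ∀ b y r → b * (+ 2 * y) + r ≡ + 2 * b * y + r
            g′ = solve-∀
        l₃ : ∀ {z} → + 2 * z ≡ α * t - β * t - + 2 * s * γ + + 2 * E * z →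
             t * (α * β - β * M * (β * M)) + - (+ 2 * s * β) * (γ + M * β) + + 2 * β * z * E
             ≡ + 2 * β * z + - (β * β) * (M * M * t - t + + 2 * M * s)
        l₃ {z} = gen s t α β γ M E z
          where
          gen : ∀ s t a b c m e y → + 2 * y ≡ a * t - b * t - + 2 * s * c + + 2 * e * y →
                t * (a * b - b * m * (b * m)) + - (+ 2 * s * b) * (c + m * b) + + 2 * b * y * e
                ≡ + 2 * b * y + - (b * b) * (m * m * t - t + + 2 * m * s)
          gen s t a b c m e y eq = trans (g s t a b c m e y)
            (trans (cong (λ w → b * w + - (b * b) * (m * m * t - t + + 2 * m * s)) (sym eq)) (g′ b y (- (b * b) * (m * m * t - t + + 2 * m * s))))
            where
            g : ∀ s t a b c m e y → t * (a * b - b * m * (b * m)) + - (+ 2 * s * b) * (c + m * b) + + 2 * b * y * e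
                ≡ b * (a * t - b * t - + 2 * s * c + + 2 * e * y) + - (b * b) * (m * m * t - t + + 2 * m * s)
            g = solve-∀
            g′ : ∀ b y r → b * (+ 2 * y) + r ≡ + 2 * b * y + r
            g′ = solve-∀

      -- For isotropic w put α = w·f, β = w·e, γ = w·g, so that 2w ≡ αe + βf − 2γg and αβ ≡ γ².
      point-parallel : ∀ {w} → Imaginary w → P ∣ norm w →
                       ∃[ i ] ∃[ c ] ∃[ d ] (¬ P ∣ c × Divides P (scale c w ⊕ scale d (point i)))
      point-parallel {quat _ x y z} refl nw with P ∣? (x + s * y + t * z)
      -- Here γ² ≡ α β ≡ 0, so 2w ≡ α e and the point is the one without a parameter.
      ... | yes P∣β = zero , + 2 , - α , P∤2 , divides-components
          (subst (P ∣_) (l₀ α) (∣n⇒∣m*n (+ 0) P∣β))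
          (subst (P ∣_) (l₁ s t x y z) P∣β)
          (subst (P ∣_) (l₂ s t x y z) (∣m∣n⇒∣m+n (∣m∣n⇒∣m+n (∣n⇒∣m*n (- s) P∣β) (∣n⇒∣m*n (+ 2 * t) P∣γ)) (∣n⇒∣m*n (+ 2 * y) P∣E)))
          (subst (P ∣_) (l₃ s t x y z) (∣m∣n⇒∣m+n (∣m∣n⇒∣m+n (∣n⇒∣m*n (- t) P∣β) (∣n⇒∣m*n (- (+ 2 * s)) P∣γ)) (∣n⇒∣m*n (+ 2 * z) P∣E)))
        where
        α β γ : ℤ
        α = x - s * y - t * z
        β = x + s * y + t * z
        γ = s * z - t * y
        P∣γ : P ∣ γ
        P∣γ = [ id , id ]′ (prime-∣-* γ γ (subst (P ∣_) (αβ≡γ² s t x y z)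
          (∣m∣n⇒∣m+n (∣m∣n⇒∣m-n (∣n⇒∣m*n α P∣β) nw) (∣n⇒∣m*n (y * y + z * z) P∣E))))
        l₀ : ∀ a → + 0 ≡ + 2 * + 0 + - a * + 0
        l₀ = solve-∀
        l₁ : ∀ s t x y z → x + s * y + t * z ≡ + 2 * x + - (x - s * y - t * z) * + 1
        l₁ = solve-∀
        l₂ : ∀ s t x y z → - s * (x + s * y + t * z) + + 2 * t * (s * z - t * y) + + 2 * y * (+ 1 + s * s + t * t)
               ≡ + 2 * y + - (x - s * y - t * z) * s
        l₂ = solve-∀
        l₃ : ∀ s t x y z → - t * (x + s * y + t * z) + - (+ 2 * s) * (s * z - t * y) + + 2 * z * (+ 1 + s * s + t * t)
               ≡ + 2 * z + - (x - s * y - t * z) * t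
        l₃ = solve-∀
      ... | no P∤β = go (linear-root p p-prime p≢2 (x + s * y + t * z) (s * z - t * y) P∤β)
        where
        go : ∃[ m ] (m ℕ.< p × P ∣ s * z - t * y + + m * (x + s * y + t * z)) →
             ∃[ i ] ∃[ c ] ∃[ d ] (¬ P ∣ c × Divides P (scale c (quat (+ 0) x y z) ⊕ scale d (point i)))
        go (m , m<p , P∣λ) = suc (fromℕ< m<p) , + 2 * (x + s * y + t * z) , - ((x + s * y + t * z) * (x + s * y + t * z)) , (λ d → P∤β (∣-cancelˡ P∤2 d)) ,
          parallel-curve x y z (+ toℕ (fromℕ< m<p)) nw
            (subst (λ n → P ∣ s * z - t * y + + n * (x + s * y + t * z)) (sym (toℕ-fromℕ< m<p)) P∣λ)

    opaque
      -- Modulo p the elements that the point annihilates from the left form a right ideal of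
      -- dimension 2, and the chosen quaternion generates it. The points thus index the classes of
      -- norm p up to units on the right.
      chosen : ∀ i → ∃[ q ] (norm q ≡ P × Divides P (point i · q))
      chosen i = right-divisor p p-prime p≢2 (point i) (point-imaginary i) (point-nonzero i) (point-norm i)

    q : Fin (suc p) → ℍ
    q i = proj₁ (chosen i)

    norm-q : ∀ i → norm (q i) ≡ P
    norm-q i = proj₁ (proj₂ (chosen i))

    point-q : ∀ i → Divides P (point i · q i)
    point-q i = proj₂ (proj₂ (chosen i))

    q-nonzero : ∀ i → ¬ Divides P (q i)
    q-nonzero i d = P∤2 (∣m⇒∣m*n (+ 2) (*-cancelˡ-∣ P {P} {+ 1}
      (subst (P * P ∣_) (trans (norm-q i) (sym (*-identityʳ P))) (divides-norm d))))

    q-exists : ∀ {w} → Imaginary w → P ∣ norm w → ∃[ i ] Divides P (w · q i)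
    q-exists {w} iw nw with i , c , d , P∤c , D ← point-parallel iw nw =
      i , divides-cancel P∤c (divides-⊕-cancelʳ
        (subst (Divides P)
          (trans (·-distribʳ (q i) _ _) (cong₂ _⊕_ (scale-·ˡ c w (q i)) (scale-·ˡ d (point i) (q i))))
          (divides-·ʳ (q i) D))
        (divides-scale d (point-q i)))

    -- If w q ≡ 0, then w is proportional to the conic point of q: removing the factor q by
    -- `annihilate` gives point i · w ≡ 0 and w · point j ≡ 0, and removing w in the same way gives
    -- point i · point j ≡ 0.
    q-unique : ∀ {w i j} → Imaginary w → ¬ Divides P w → Divides P (w · q i) → Divides P (w · q j) → i ≡ j
    q-unique {w} {i} {j} iw ¬dw di dj = point-distinct i j
      (annihilate w ¬dw (toward i di) (imaginary-divides iw (away j dj)))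
      where
      toward : ∀ k → Divides P (w · q k) → Divides P (point k · w)
      toward k d = annihilate (q k) (q-nonzero k) (point-q k) (divides-flip iw d)
      away : ∀ k → Divides P (w · q k) → Divides P (w · point k)
      away k d = annihilate (q k) (q-nonzero k) d (divides-flip (point-imaginary k) (point-q k))

-- The Hecke relation for sums of three squares

module Hecke where
  open Quaternion
  open ModularQuaternion
  open ConicPoint
  open Conic
  open Counting
  open import Data.Fin as Fin using (Fin; suc)
  open import Data.Integer using (ℤ; +_; -_; _+_; _*_; _-_; NonZero)
  open import Data.Integer.Divisibility.Signed
  open import Data.Integer.Properties
  open import Data.List.Properties using (length-tabulate)
  open ≡

  counts-Fin : ∀ n → Counts {Fin n} (λ _ → ⊤) n
  counts-Fin n = counts (allFin n) (Unique.allFin⁺ n) (λ _ → tt) (λ _ → ∈-allFin _) (length-tabulate {n = n} id)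

  -- Vectors of ℤ³ are represented as imaginary quaternions.
  Sphere : ℤ → ℍ → Set
  Sphere n v = Imaginary v × norm v ≡ n

  opaque
    unfolding _·_

    re-scale : ∀ s x → ℍ.re (scale s x) ≡ s * ℍ.re x
    re-scale s (quat _ _ _ _) = refl

  imaginary-scale : ∀ s .{{_ : NonZero s}} {x} → Imaginary (scale s x) → Imaginary x
  imaginary-scale s {x} i = *-cancelˡ-≡ s (ℍ.re x) (+ 0) (trans (sym (re-scale s x)) (trans i (sym (*-zeroʳ s))))

  scale-imaginary : ∀ s {x} → Imaginary x → Imaginary (scale s x)
  scale-imaginary s {x} i = trans (re-scale s x) (trans (cong (s *_) i) (*-zeroʳ s))

  sandwich-imaginary : ∀ x {v} → Imaginary v → Imaginary (x · v · conj x)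
  sandwich-imaginary x {v} iv = imaginary-conj (begin
    conj (x · v · conj x) ≡⟨ conj-· (x · v) (conj x) ⟩
    conj (conj x) · conj (x · v) ≡⟨ cong₂ _·_ (conj-conj x) (conj-· x v) ⟩
    x · (conj v · conj x) ≡⟨ sym (·-assoc x (conj v) (conj x)) ⟩
    x · conj v · conj x ≡⟨ cong (λ z → x · z · conj x) (conj-imaginary iv) ⟩
    x · scale (- (+ 1)) v · conj x ≡⟨ cong (_· conj x) (scale-·ʳ _ x v) ⟩
    scale (- (+ 1)) (x · v) · conj x ≡⟨ scale-·ˡ _ (x · v) (conj x) ⟩
    scale (- (+ 1)) (x · v · conj x) ∎)
    where open ≡-Reasoning

  sandwich-norm : ∀ x v → norm (x · v · conj x) ≡ norm x * norm x * norm v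
  sandwich-norm x v = begin
    norm (x · v · conj x) ≡⟨ norm-· (x · v) (conj x) ⟩
    norm (x · v) * norm (conj x) ≡⟨ cong₂ _*_ (norm-· x v) (norm-conj x) ⟩
    norm x * norm v * norm x ≡⟨ lemma (norm x) (norm v) ⟩
    norm x * norm x * norm v ∎
    where
    open ≡-Reasoning
    lemma : ∀ a b → a * b * a ≡ a * a * b
    lemma = solve-∀

  module Rotation {m : ℤ} .{{_ : NonZero m}} {q : ℍ} (norm-q : norm q ≡ m) where
    open ≡-Reasoning

    conj-·-cancel : ∀ x → conj q · (q · x) ≡ scale m x
    conj-·-cancel x = begin
      conj q · (q · x) ≡⟨ sym (·-assoc (conj q) q x) ⟩
      conj q · q · x ≡⟨ cong (_· x) (trans (conj-·-self q) (cong real norm-q)) ⟩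
      real m · x ≡⟨ real-· m x ⟩
      scale m x ∎

    ·-conj-cancel : ∀ x → q · (conj q · x) ≡ scale m x
    ·-conj-cancel x = begin
      q · (conj q · x) ≡⟨ sym (·-assoc q (conj q) x) ⟩
      q · conj q · x ≡⟨ cong (_· x) (trans (·-conj q) (cong real norm-q)) ⟩
      real m · x ≡⟨ real-· m x ⟩
      scale m x ∎

    ·-·-conj : ∀ x → x · q · conj q ≡ scale m x
    ·-·-conj x = begin
      x · q · conj q ≡⟨ ·-assoc x q (conj q) ⟩
      x · (q · conj q) ≡⟨ cong (x ·_) (trans (·-conj q) (cong real norm-q)) ⟩
      x · real m ≡⟨ ·-real m x ⟩
      scale m x ∎

    ·-conj-· : ∀ x → x · conj q · q ≡ scale m x
    ·-conj-· x = begin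
      x · conj q · q ≡⟨ ·-assoc x (conj q) q ⟩
      x · (conj q · q) ≡⟨ cong (x ·_) (trans (conj-·-self q) (cong real norm-q)) ⟩
      x · real m ≡⟨ ·-real m x ⟩
      scale m x ∎

    ·-cancelˡ : ∀ {x y} → q · x ≡ q · y → x ≡ y
    ·-cancelˡ {x} {y} eq = scale-injective m
      (trans (sym (conj-·-cancel x)) (trans (cong (conj q ·_) eq) (conj-·-cancel y)))

    ·-cancelʳ : ∀ {x y} → x · q ≡ y · q → x ≡ y
    ·-cancelʳ {x} {y} eq = scale-injective m
      (trans (sym (·-·-conj x)) (trans (cong (_· conj q) eq) (·-·-conj y)))

    ·-conj-cancelʳ : ∀ {x y} → x · conj q ≡ y · conj q → x ≡ y
    ·-conj-cancelʳ {x} {y} eq = scale-injective m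
      (trans (sym (·-conj-· x)) (trans (cong (_· q) eq) (·-conj-· y)))

  conj-sandwich-imaginary : ∀ x {v} → Imaginary v → Imaginary (conj x · v · x)
  conj-sandwich-imaginary x {v} iv =
    subst (λ z → Imaginary (conj x · v · z)) (conj-conj x) (sandwich-imaginary (conj x) iv)

  conj-sandwich-norm : ∀ x v → norm (conj x · v · x) ≡ norm x * norm x * norm v
  conj-sandwich-norm x v = trans (cong (λ z → norm (conj x · v · z)) (sym (conj-conj x)))
    (trans (sandwich-norm (conj x) v) (cong (λ t → t * t * norm v) (norm-conj x)))

  imaginary-·-· : ∀ {w} → Imaginary w → ∀ x → w · (w · x) ≡ scale (- norm w) x
  imaginary-·-· {w} iw x = trans (sym (·-assoc w w x))
    (trans (cong (_· x) (imaginary-square iw)) (real-· (- norm w) x))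

  module _ (p : ℕ) (p-prime : Prime p) (p≢2 : p ≢ 2) where
    open ModPrime p p-prime p≢2

    private
      instance
        P²-nonZero : NonZero (P * P)
        P²-nonZero = i*j≢0 P P

    opaque
      conic : ∃[ s ] ∃[ t ] P ∣ + 1 + s * s + t * t
      conic = isotropic p p-prime p≢2

    open ConicPoints p p-prime p≢2 (proj₁ conic) (proj₁ (proj₂ conic)) (proj₂ (proj₂ conic))

    module _ (i : Fin (suc p)) where
      open Rotation (norm-q i) public

    -- Put t = v q. Then v t = -N(v) q ≡ 0 because p ∣ N(v), and t̄ q ≡ 0 is the conjugate of the
    -- assumption q̄ v q ≡ 0. Unless t ≡ 0 already, `annihilate` removes t and leaves v q ≡ 0.
    one-sided : ∀ i {v} → Imaginary v → P ∣ norm v → Divides P (conj (q i) · v · q i) → Divides P (v · q i)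
    one-sided i {v} iv nv d with divides? P (v · q i)
    ... | yes vq = vq
    ... | no ¬vq = annihilate (v · q i) ¬vq
      (subst (Divides P) (sym (imaginary-·-· iv (q i)))
        (subst (Divides P) (real-· (- norm v) (q i)) (divides-·ʳ (q i) (divides-real (∣m⇒∣-m nv)))))
      (subst (Divides P) eq (divides-conj d))
      where
      open ≡-Reasoning
      eq : conj (conj (q i) · v · q i) ≡ conj (v · q i) · q i
      eq = begin
        conj (conj (q i) · v · q i) ≡⟨ cong conj (·-assoc (conj (q i)) v (q i)) ⟩
        conj (conj (q i) · (v · q i)) ≡⟨ conj-· (conj (q i)) (v · q i) ⟩
        conj (v · q i) · conj (conj (q i)) ≡⟨ cong (conj (v · q i) ·_) (conj-conj (q i)) ⟩
        conj (v · q i) · q i ∎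

    -- The rotation v ↦ q v q⁻¹ multiplied by p, which makes it integral.
    rotate : Fin (suc p) → ℍ → ℍ
    rotate i v = q i · v · conj (q i)

    rotate-q : ∀ i v → Divides P (rotate i v · q i)
    rotate-q i v = q i · v , ·-conj-· i (q i · v)

    rotate-sphere : ∀ {n} i {v} → Sphere n v → Sphere (P * P * n) (rotate i v)
    rotate-sphere i {v} (iv , nv) = sandwich-imaginary (q i) iv ,
      trans (sandwich-norm (q i) v) (cong₂ (λ a b → a * a * b) (norm-q i) nv)

    -- The image w of (i, v) satisfies w q ≡ 0 for the quaternion of index i, and a vector that p
    -- does not divide does so for one index only. With the index known, q and q̄ cancel and v is
    -- recovered.
    rotate-injective : ∀ {n i j v v′} → Sphere n v → ¬ Divides P (rotate i v) → rotate i v ≡ rotate j v′ →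
                       (i , v) ≡ (j , v′)
    rotate-injective {i = i} {j} {v} {v′} sv ¬d eq =
      same (q-unique {rotate i v} {i} {j} (proj₁ (rotate-sphere i sv)) ¬d (rotate-q i v)
             (subst (λ w → Divides P (w · q j)) (sym eq) (rotate-q j v′)))
           eq
      where
      same : ∀ {i j v v′} → i ≡ j → rotate i v ≡ rotate j v′ → (i , v) ≡ (j , v′)
      same {i} refl eq = cong (i ,_) (·-cancelˡ i (·-conj-cancelʳ i eq))

    -- The preimage has to be q̄ w q / p², so two factors p must be found. The choice of i gives the
    -- first, w q = p t. Next p w t = w² q = -p² n q shows w t ≡ 0, and removing w between q̄ w̄ ≡ 0
    -- and w t ≡ 0 gives q̄ t ≡ 0, the second.
    rotate-surjective : ∀ {n w} → Sphere (P * P * n) w → ¬ Divides P w →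
                        ∃[ i ] ∃[ v ] (Sphere n v × rotate i v ≡ w)
    rotate-surjective {n} {w} (iw , nw) ¬dw =
      let i , t , wq≡ = q-exists iw (subst (P ∣_) (sym (trans nw (*-assoc P P n))) (∣m⇒∣m*n (P * n) (∣-refl {P})))
          v , q̄t≡ = annihilate (conj w) {conj (q i)} {t}
                      (λ d → ¬dw (subst (Divides P) (conj-conj w) (divides-conj d)))
                      (subst (Divides P) (conj-· w (q i)) (divides-conj (t , wq≡)))
                      (subst (λ z → Divides P (z · t)) (sym (conj-conj w)) (wt i t wq≡))
          q̄wq≡ = trans (·-assoc (conj (q i)) w (q i)) (trans (cong (conj (q i) ·_) wq≡)
                   (trans (scale-·ʳ P (conj (q i)) t) (trans (cong (scale P) q̄t≡) (scale-scale P P v))))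
      in i , v , (imag i v q̄wq≡ , nrm i v q̄wq≡) , rot i v q̄wq≡
      where
      open ≡-Reasoning
      wt : ∀ i t → w · q i ≡ scale P t → Divides P (w · t)
      wt i t wq≡ = scale (- n) (q i) , scale-injective P (scale-injective P (begin
        scale P (scale P (w · t)) ≡⟨ cong (scale P) (sym (scale-·ʳ P w t)) ⟩
        scale P (w · scale P t) ≡⟨ cong (λ z → scale P (w · z)) (sym wq≡) ⟩
        scale P (w · (w · q i)) ≡⟨ cong (scale P) (imaginary-·-· iw (q i)) ⟩
        scale P (scale (- norm w) (q i)) ≡⟨ cong (λ z → scale P (scale (- z) (q i))) nw ⟩
        scale P (scale (- (P * P * n)) (q i)) ≡⟨ cong (λ z → scale P (scale z (q i))) (lemma P n) ⟩
        scale P (scale (P * (P * - n)) (q i)) ≡⟨ cong (scale P) (sym (trans (cong (scale P) (scale-scale P (- n) (q i))) (scale-scale P (P * - n) (q i)))) ⟩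
        scale P (scale P (scale P (scale (- n) (q i)))) ∎))
        where
        lemma : ∀ P n → - (P * P * n) ≡ P * (P * - n)
        lemma = solve-∀
      module _ (i : Fin (suc p)) (v : ℍ) (q̄wq≡ : conj (q i) · w · q i ≡ scale (P * P) v) where
        imag : Imaginary v
        imag = imaginary-scale (P * P) (subst Imaginary q̄wq≡ (conj-sandwich-imaginary (q i) iw))
        nrm : norm v ≡ n
        nrm = *-cancelˡ-≡ (P * P) _ _ (*-cancelˡ-≡ (P * P) _ _ (begin
          P * P * (P * P * norm v) ≡⟨ sym (*-assoc (P * P) (P * P) (norm v)) ⟩
          P * P * (P * P) * norm v ≡⟨ sym (norm-scale (P * P) v) ⟩
          norm (scale (P * P) v) ≡⟨ cong norm (sym q̄wq≡) ⟩
          norm (conj (q i) · w · q i) ≡⟨ conj-sandwich-norm (q i) w ⟩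
          norm (q i) * norm (q i) * norm w ≡⟨ cong₂ (λ a b → a * a * b) (norm-q i) nw ⟩
          P * P * (P * P * n) ∎))
        rot : rotate i v ≡ w
        rot = scale-injective (P * P) (begin
          scale (P * P) (q i · v · conj (q i)) ≡⟨ sym (scale-·ˡ (P * P) (q i · v) (conj (q i))) ⟩
          scale (P * P) (q i · v) · conj (q i) ≡⟨ cong (_· conj (q i)) (sym (scale-·ʳ (P * P) (q i) v)) ⟩
          q i · scale (P * P) v · conj (q i) ≡⟨ cong (λ z → q i · z · conj (q i)) (sym q̄wq≡) ⟩
          q i · (conj (q i) · w · q i) · conj (q i) ≡⟨ cong (λ z → q i · z · conj (q i)) (·-assoc (conj (q i)) w (q i)) ⟩
          q i · (conj (q i) · (w · q i)) · conj (q i) ≡⟨ cong (_· conj (q i)) (·-conj-cancel i (w · q i)) ⟩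
          scale P (w · q i) · conj (q i) ≡⟨ scale-·ˡ P (w · q i) (conj (q i)) ⟩
          scale P (w · q i · conj (q i)) ≡⟨ cong (scale P) (·-·-conj i w) ⟩
          scale P (scale P w) ≡⟨ scale-scale P P w ⟩
          scale (P * P) w ∎)

    -- v′ = q v q̄ / p.
    transport : ∀ {n} i {v} → Sphere n v → Divides P (rotate i v) →
                ∃[ v′ ] (Sphere n v′ × Divides P (conj (q i) · v′ · q i) × q i · v ≡ v′ · q i)
    transport {n} i {v} sv (v′ , eq) = v′ , (imag , nrm) , (v , divides′) , qv
      where
      open ≡-Reasoning
      imag : Imaginary v′
      imag = imaginary-scale P (subst Imaginary eq (proj₁ (rotate-sphere i sv)))
      nrm : norm v′ ≡ n
      nrm = *-cancelˡ-≡ (P * P) _ _ (trans (sym (norm-scale P v′)) (trans (cong norm (sym eq)) (proj₂ (rotate-sphere i sv))))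
      qv : q i · v ≡ v′ · q i
      qv = scale-injective P (trans (sym (·-conj-· i (q i · v))) (trans (cong (_· q i) eq) (scale-·ˡ P v′ (q i))))
      divides′ : conj (q i) · v′ · q i ≡ scale P v
      divides′ = trans (·-assoc (conj (q i)) v′ (q i)) (trans (cong (conj (q i) ·_) (sym qv)) (conj-·-cancel i v))

    transport⁻¹ : ∀ {n} i {v′} → Sphere n v′ → Divides P (conj (q i) · v′ · q i) →
                  ∃[ v ] (Sphere n v × Divides P (rotate i v) × q i · v ≡ v′ · q i)
    transport⁻¹ {n} i {v′} (iv′ , nv′) (v , eq) = v , (imag , nrm) , (v′ , divides′) , qv
      where
      open ≡-Reasoning
      imag : Imaginary v
      imag = imaginary-scale P (subst Imaginary eq (conj-sandwich-imaginary (q i) iv′))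
      nrm : norm v ≡ n
      nrm = *-cancelˡ-≡ (P * P) _ _ (trans (sym (norm-scale P v)) (trans (cong norm (sym eq))
              (trans (conj-sandwich-norm (q i) v′) (cong₂ (λ a b → a * a * b) (norm-q i) nv′))))
      qv : q i · v ≡ v′ · q i
      qv = scale-injective P (begin
        scale P (q i · v) ≡⟨ sym (scale-·ʳ P (q i) v) ⟩
        q i · scale P v ≡⟨ cong (q i ·_) (sym eq) ⟩
        q i · (conj (q i) · v′ · q i) ≡⟨ cong (q i ·_) (·-assoc (conj (q i)) v′ (q i)) ⟩
        q i · (conj (q i) · (v′ · q i)) ≡⟨ ·-conj-cancel i (v′ · q i) ⟩
        scale P (v′ · q i) ∎)
      divides′ : rotate i v ≡ scale P v′
      divides′ = trans (cong (_· conj (q i)) qv) (·-·-conj i v′)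

    -- Expresses the divisible part of one level by the full count of the level below, through v ↦ p
    -- v.
    multiples : ∀ {n r d} → Counts (Sphere n) r →
                  Counts (λ v → Sphere (P * P * n) v × Divides P v) d → d ≡ r
    multiples {n} Cr Cd = sym (counts-unique (counts-image {Q = λ v → Sphere (P * P * n) v × Divides P v} (scale P) Cr
      (λ {v} (iv , nv) → (scale-imaginary P iv , trans (norm-scale P v) (cong (P * P *_) nv)) , v , refl)
      (λ _ _ → scale-injective P)
      (λ { ((iw , nw) , v , refl) → v ,
           (imaginary-scale P iw , *-cancelˡ-≡ (P * P) _ _ (trans (sym (norm-scale P v)) nw)) , refl })) Cd)

    module _ {n : ℤ} {r : ℕ} (Cr : Counts (Sphere n) r) where

      Pairs : Fin (suc p) × ℍ → Set
      Pairs (i , v) = ⊤ × Sphere n v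

      pairs : Counts Pairs (suc p ℕ.* r)
      pairs = counts-× (counts-Fin (suc p)) Cr

      rotated : ∀ {k l} → Counts (λ x → Pairs x × ¬ Divides P (rotate (proj₁ x) (proj₂ x))) k →
                  Counts (λ w → Sphere (P * P * n) w × ¬ Divides P w) l → k ≡ l
      rotated Ck Cl = counts-bij (λ (i , v) w → rotate i v ≡ w) Ck Cl
        (λ {(i , v)} ((_ , sv) , ¬d) → rotate i v , (rotate-sphere i sv , ¬d) , refl)
        (λ {w} (sw , ¬d) → let i , v , sv , eq = rotate-surjective sw ¬d
                           in (i , v) , ((tt , sv) , subst (λ z → ¬ Divides P z) (sym eq) ¬d) , eq)
        (λ {(i , v)} {(j , v′)} ((_ , sv) , ¬d) _ e e′ → rotate-injective {i = i} {j} sv ¬d (trans e (sym e′)))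
        (λ _ _ e e′ → trans (sym e) e′)

      transported : ∀ {k l} → Counts (λ x → Pairs x × Divides P (rotate (proj₁ x) (proj₂ x))) k →
                    Counts (λ x → Pairs x × Divides P (conj (q (proj₁ x)) · proj₂ x · q (proj₁ x))) l → k ≡ l
      transported Ck Cl = counts-bij (λ (i , v) (i′ , v′) → i ≡ i′ × q i · v ≡ v′ · q i) Ck Cl
        (λ {(i , v)} ((_ , sv) , d) → let v′ , sv′ , d′ , e = transport i sv d in (i , v′) , ((tt , sv′) , d′) , refl , e)
        (λ {(i , v′)} ((_ , sv′) , d′) → let v , sv , d , e = transport⁻¹ i sv′ d′ in (i , v) , ((tt , sv) , d) , refl , e)
        (λ { {i , _} _ _ (refl , e) (refl , e′) → cong (i ,_) (·-cancelˡ i (trans e (sym e′))) })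
        (λ { {i , _} _ _ (refl , e) (refl , e′) → cong (i ,_) (·-cancelʳ i (trans (sym e) e′)) })

      -- As p ∣ n, a vector v not divisible by p is isotropic modulo p and has v q ≡ 0 for exactly
      -- one index; `one-sided` reduces p ∣ q̄ v q to this. This is the place where the Legendre
      -- symbol of the general relation disappears.
      fixed : P ∣ n → ∀ {k l} →
              Counts (λ x → (Pairs x × Divides P (conj (q (proj₁ x)) · proj₂ x · q (proj₁ x))) × ¬ Divides P (proj₂ x)) k →
              Counts (λ v → Sphere n v × ¬ Divides P v) l → k ≡ l
      fixed P∣n Ck Cl = counts-bij (λ x v → proj₂ x ≡ v) Ck Cl
        (λ {(i , v)} (((_ , sv) , _) , ¬d) → v , (sv , ¬d) , refl)
        (λ {v} (sv@(iv , nv) , ¬d) → let i , vq = q-exists iv (subst (P ∣_) (sym nv) P∣n)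
          in (i , v) , (((tt , sv) , subst (Divides P) (sym (·-assoc (conj (q i)) v (q i))) (divides-·ˡ (conj (q i)) vq)) , ¬d) , refl)
        (λ { {i , v} {j , _} (((_ , iv , nv) , d) , ¬d) ((_ , d′) , _) refl refl →
             cong (_, v) (q-unique {v} {i} {j} iv ¬d
               (one-sided i iv (subst (P ∣_) (sym nv) P∣n) d) (one-sided j iv (subst (P ∣_) (sym nv) P∣n) d′)) })
        (λ _ _ e e′ → trans (sym e) e′)

      -- The (p + 1) r pairs are split according to whether p divides q v q̄. Those where it does
      -- not correspond to the R - r vectors of norm p²n that p does not divide. The others are
      -- carried by q v = v′ q to the pairs with p ∣ q̄ v′ q: every index occurs with each of the d
      -- multiples of p, and exactly one with each of the r - d remaining v′. Hence (p + 1) r = (R -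
      -- r) + (p + 1) d + (r - d).
      hecke : P ∣ n → ∀ {R d} → Counts (Sphere (P * P * n)) R → Counts (λ v → Sphere n v × Divides P v) d →
              R ℕ.+ p ℕ.* d ≡ suc p ℕ.* r
      hecke P∣n {R} {d} CR Cd =
        let k , l , Ck , Cl , eq₁ = counts-split (λ x → divides? P (rotate (proj₁ x) (proj₂ x))) pairs
            d₂ , l′ , Cd₂ , Cl′ , eq₂ = counts-split (divides? P) CR
            k′ , Ck′ = counts-filter (λ x → divides? P (conj (q (proj₁ x)) · proj₂ x · q (proj₁ x))) pairs
            k₁ , k₂ , Ck₁ , Ck₂ , eq₃ = counts-split (λ x → divides? P (proj₂ x)) Ck′
            d′ , r′ , Cd′ , Cr′ , eq₄ = counts-split (divides? P) Cr
        in combine eq₂ (multiples Cr Cd₂) (rotated Cl Cl′) (transported Ck Ck′) eq₃ (fixed P∣n Ck₂ Cr′)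
             (counts-unique Ck₁ (counts-⇔
               (λ {x} (_ , sv , dv) → ((tt , sv) , divides-·ʳ (q (proj₁ x)) (divides-·ˡ (conj (q (proj₁ x))) dv)) , dv)
               (λ (((_ , sv) , _) , dv) → tt , sv , dv)
               (counts-× (counts-Fin (suc p)) Cd)))
             eq₄ (counts-unique Cd Cd′) eq₁
        where
        lemma : ∀ d r l e → d ℕ.+ r ℕ.+ l ℕ.+ e ≡ d ℕ.+ e ℕ.+ r ℕ.+ l
        lemma = solve 4 (λ d r l e → d :+ r :+ l :+ e := d :+ e :+ r :+ l) refl
          where open ℕ.+-*-Solver
        combine : ∀ {R r d d′ d₂ r′ k k′ k₁ k₂ l l′} → R ≡ d₂ ℕ.+ l′ → d₂ ≡ r → l ≡ l′ → k ≡ k′ → k′ ≡ k₁ ℕ.+ k₂ →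
                  k₂ ≡ r′ → k₁ ≡ suc p ℕ.* d → r ≡ d′ ℕ.+ r′ → d ≡ d′ → suc p ℕ.* r ≡ k ℕ.+ l →
                  R ℕ.+ p ℕ.* d ≡ suc p ℕ.* r
        combine {d = d} {r′ = r′} {l = l} refl refl refl refl refl refl refl refl refl eq =
          trans (lemma d r′ l (p ℕ.* d)) (sym eq)

-- Lattice points on spheres along the odd powers of p

module Spheres where
  open Quaternion
  open ModularQuaternion
  open Descent
  open Counting
  open Hecke
  open import Data.Integer using (ℤ; +_; -[1+_]; -_; _+_; _*_; _-_) renaming (∣_∣ to abs; _≟_ to _≟ℤ_)
  open import Data.Integer.Divisibility.Signed using (_∣_; divides; ∣⇒∣ᵤ; *-cancelˡ-∣)
  open import Data.Integer.Properties using (+-injective; -[1+-injective; pos-*; *-assoc; *-comm)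
  open import Data.List.Properties using (length-upTo)
  open import Data.Nat using (_%_; _/_)
  open import Data.Nat.Divisibility using (∣m⇒∣m*n; ∣m∣n⇒∣m+n; ∣n⇒∣m*n)
  open ≡

  counts-< : ∀ n → Counts (ℕ._< n) n
  counts-< n = counts (upTo n) (Unique.upTo⁺ n) ∈-upTo⁻ ∈-upTo⁺ (length-upTo n)

  counts-box : ∀ b → ∃[ k ] Counts (λ z → abs z ℕ.≤ b) k
  counts-box b = _ , counts-⇔ to from (counts-⊎
      (counts-image {Q = λ z → ∃[ k ] (k ℕ.< suc b × + k ≡ z)} +_ (counts-< (suc b)) (λ {k} lt → k , lt , refl) (λ _ _ → +-injective) id)
      (counts-image {Q = λ z → ∃[ k ] (k ℕ.< b × -[1+ k ] ≡ z)} -[1+_] (counts-< b) (λ {k} lt → k , lt , refl) (λ _ _ → -[1+-injective) id)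
      (λ { (_ , _ , refl) (_ , _ , ()) }))
    where
    to : ∀ {z} → (∃[ k ] (k ℕ.< suc b × + k ≡ z)) ⊎ (∃[ k ] (k ℕ.< b × -[1+ k ] ≡ z)) → abs z ℕ.≤ b
    to (inj₁ (k , lt , refl)) = ℕ.≤-pred lt
    to (inj₂ (k , lt , refl)) = lt
    from : ∀ {z} → abs z ℕ.≤ b → (∃[ k ] (k ℕ.< suc b × + k ≡ z)) ⊎ (∃[ k ] (k ℕ.< b × -[1+ k ] ≡ z))
    from {+ k} le = inj₁ (k , ℕ.s≤s le , refl)
    from { -[1+ k ]} le = inj₂ (k , le , refl)

  -- Serves finiteness only, so the crude bound |b| ≤ b² ≤ N is enough; the real part is absent
  -- because vectors are imaginary.
  Bounded : ℕ → ℍ → Set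
  Bounded b (quat _ x y z) = abs x ℕ.≤ b × abs y ℕ.≤ b × abs z ℕ.≤ b

  square-≥ : ∀ n → n ℕ.≤ n ℕ.* n
  square-≥ zero = ℕ.z≤n
  square-≥ (suc n) = ℕ.m≤m*n (suc n) (suc n)

  normℕ-bounded : ∀ x → Bounded (normℕ x) x
  normℕ-bounded (quat a b c d) =
    ℕ.≤-trans (square-≥ (abs b)) (ℕ.≤-trans (ℕ.m≤n+m B A) (ℕ.≤-trans (ℕ.m≤m+n (A ℕ.+ B) C) (ℕ.m≤m+n (A ℕ.+ B ℕ.+ C) D))) ,
    ℕ.≤-trans (square-≥ (abs c)) (ℕ.≤-trans (ℕ.m≤n+m C (A ℕ.+ B)) (ℕ.m≤m+n (A ℕ.+ B ℕ.+ C) D)) ,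
    ℕ.≤-trans (square-≥ (abs d)) (ℕ.m≤n+m D (A ℕ.+ B ℕ.+ C))
    where
    A B C D : ℕ
    A = abs a ℕ.* abs a
    B = abs b ℕ.* abs b
    C = abs c ℕ.* abs c
    D = abs d ℕ.* abs d

  counts-sphere : ∀ n → ∃[ r ] Counts (Sphere n) r
  counts-sphere n =
    let k , C = counts-box (abs n)
        r , Cr = counts-filter (λ x → norm x ≟ℤ n)
                   (counts-image {Q = λ x → Imaginary x × Bounded (abs n) x}
                     (λ (x , y , z) → quat (+ 0) x y z) (counts-× C (counts-× C C))
                     (λ (p , q , s) → refl , p , q , s)
                     (λ { _ _ refl → refl })
                     (λ { {quat _ x y z} (refl , p , q , s) → (x , y , z) , (p , q , s) , refl }))
    in r , counts-⇔ (λ ((i , _) , e) → i , e) (λ {x} (i , e) → (i , bound x e) , e) Cr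
    where
    bound : ∀ x → norm x ≡ n → Bounded (abs n) x
    bound x e = subst (λ b → Bounded b x) (cong abs (trans (sym (norm-normℕ x)) e)) (normℕ-bounded x)

  -- The sum 1 + p + ⋯ + p^(k-1) in Horner form. The argument k is the number of terms, so the
  -- exponent 2k + 1 of p goes with `geometric p (suc k)`.
  geometric : ℕ → ℕ → ℕ
  geometric p zero = 0
  geometric p (suc k) = suc (p ℕ.* geometric p k)

  geometric-+ : ∀ p m k → geometric p (m ℕ.+ k) ≡ geometric p m ℕ.+ p ℕ.^ m ℕ.* geometric p k
  geometric-+ p zero k = sym (ℕ.+-identityʳ (geometric p k))
  geometric-+ p (suc m) k = cong suc (begin
    p ℕ.* geometric p (m ℕ.+ k) ≡⟨ cong (p ℕ.*_) (geometric-+ p m k) ⟩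
    p ℕ.* (geometric p m ℕ.+ p ℕ.^ m ℕ.* geometric p k) ≡⟨ ℕ.*-distribˡ-+ p _ _ ⟩
    p ℕ.* geometric p m ℕ.+ p ℕ.* (p ℕ.^ m ℕ.* geometric p k) ≡⟨ cong (p ℕ.* geometric p m ℕ.+_) (sym (ℕ.*-assoc p _ _)) ⟩
    p ℕ.* geometric p m ℕ.+ p ℕ.^ suc m ℕ.* geometric p k ∎)
    where open ≡-Reasoning

  geometric-∣ : ∀ {d} p m → d ℕ.∣ geometric p m → ∀ k → d ℕ.∣ geometric p (k ℕ.* m)
  geometric-∣ {d} p m d∣ zero = d ℕ.∣0
  geometric-∣ {d} p m d∣ (suc k) = subst (d ℕ.∣_) (sym (geometric-+ p m (k ℕ.* m)))
    (∣m∣n⇒∣m+n d∣ (∣n⇒∣m*n (p ℕ.^ m) (geometric-∣ p m d∣ k)))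

  module _ {p : ℕ} where
    private
      t = p / 5
      p≡ : ∀ {r} → p % 5 ≡ r → p ≡ r ℕ.+ t ℕ.* 5
      p≡ eq = trans (ℕ.m≡m%n+[m/n]*n p 5) (cong (ℕ._+ t ℕ.* 5) eq)
      open ℕ.+-*-Solver

    -- Five terms, each ≡ 1. With p = 1 + 5t the sum is ((1 + 5t)⁵ - 1)/(5t), and the quotient given
    -- is a fifth of its expansion.
    5∣geometric-5 : p % 5 ≡ 1 → 5 ℕ.∣ geometric p 5
    5∣geometric-5 eq = ℕ.divides (1 ℕ.+ t ℕ.* (10 ℕ.+ t ℕ.* (50 ℕ.+ t ℕ.* (125 ℕ.+ t ℕ.* 125))))
      (trans (cong (λ p → geometric p 5) (p≡ eq))
        (solve 1 (λ t → let p = con 1 :+ t :* con 5; g = λ x → con 1 :+ p :* x in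
          g (g (g (g (g (con 0))))) := (con 1 :+ t :* (con 10 :+ t :* (con 50 :+ t :* (con 125 :+ t :* con 125)))) :* con 5) refl t))

    -- The sum factors as (1 + p)(1 + p²). Modulo 5 the second factor vanishes for p ≡ 2, 3 and the
    -- first for p ≡ 4; the quotients are these factors written in t with one 5 removed.
    5∣geometric-4 : p % 5 ≡ 2 ⊎ p % 5 ≡ 3 ⊎ p % 5 ≡ 4 → 5 ℕ.∣ geometric p 4
    5∣geometric-4 (inj₁ eq) = ℕ.divides ((3 ℕ.+ t ℕ.* 5) ℕ.* (1 ℕ.+ t ℕ.* 4 ℕ.+ t ℕ.* t ℕ.* 5))
      (trans (cong (λ p → geometric p 4) (p≡ eq))
        (solve 1 (λ t → let p = con 2 :+ t :* con 5; g = λ x → con 1 :+ p :* x in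
          g (g (g (g (con 0)))) := (con 3 :+ t :* con 5) :* (con 1 :+ t :* con 4 :+ t :* t :* con 5) :* con 5) refl t))
    5∣geometric-4 (inj₂ (inj₁ eq)) = ℕ.divides ((4 ℕ.+ t ℕ.* 5) ℕ.* (2 ℕ.+ t ℕ.* 6 ℕ.+ t ℕ.* t ℕ.* 5))
      (trans (cong (λ p → geometric p 4) (p≡ eq))
        (solve 1 (λ t → let p = con 3 :+ t :* con 5; g = λ x → con 1 :+ p :* x in
          g (g (g (g (con 0)))) := (con 4 :+ t :* con 5) :* (con 2 :+ t :* con 6 :+ t :* t :* con 5) :* con 5) refl t))
    5∣geometric-4 (inj₂ (inj₂ eq)) = ℕ.divides ((1 ℕ.+ t) ℕ.* (17 ℕ.+ t ℕ.* 40 ℕ.+ t ℕ.* t ℕ.* 25))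
      (trans (cong (λ p → geometric p 4) (p≡ eq))
        (solve 1 (λ t → let p = con 4 :+ t :* con 5; g = λ x → con 1 :+ p :* x in
          g (g (g (g (con 0)))) := (con 1 :+ t) :* (con 17 :+ t :* con 40 :+ t :* t :* con 25) :* con 5) refl t))

  module _ (p : ℕ) (p-prime : Prime p) (p≢2 : p ≢ 2) (N : ℕ) (p∤N : ¬ p ℕ.∣ N) where
    open ModPrime p p-prime p≢2

    level : ℕ → ℤ
    level zero = P * + N
    level (suc k) = P * P * level k

    level-pos : ∀ k → level k ≡ + (p ℕ.^ (1 ℕ.+ 2 ℕ.* k) ℕ.* N)
    level-pos zero = trans (sym (pos-* p N)) (cong (λ x → + (x ℕ.* N)) (sym (ℕ.*-identityʳ p)))
    level-pos (suc k) = begin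
      P * P * level k ≡⟨ cong₂ _*_ (sym (pos-* p p)) (level-pos k) ⟩
      + (p ℕ.* p) * + (p ℕ.^ (1 ℕ.+ 2 ℕ.* k) ℕ.* N) ≡⟨ sym (pos-* (p ℕ.* p) _) ⟩
      + (p ℕ.* p ℕ.* (p ℕ.^ (1 ℕ.+ 2 ℕ.* k) ℕ.* N)) ≡⟨ cong +_ (trans (sym (ℕ.*-assoc (p ℕ.* p) _ N)) (cong (ℕ._* N) (trans (ℕ.*-assoc p p _) (cong (p ℕ.^_) (lemma k))))) ⟩
      + (p ℕ.^ (1 ℕ.+ 2 ℕ.* suc k) ℕ.* N) ∎
      where
      open ≡-Reasoning
      lemma : ∀ k → 3 ℕ.+ 2 ℕ.* k ≡ 1 ℕ.+ 2 ℕ.* suc k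
      lemma = solve 1 (λ k → con 3 :+ con 2 :* k := con 1 :+ con 2 :* (con 1 :+ k)) refl
        where open ℕ.+-*-Solver

    P∣level : ∀ k → P ∣ level k
    P∣level zero = divides (+ N) (*-comm P (+ N))
    P∣level (suc k) = divides (P * level k) (trans (*-assoc P P (level k)) (*-comm P (P * level k)))

    -- Here p ∤ N enters: p² does not divide pN, so the recursion starts without the term r₃(n/p²).
    level-0-primitive : ∀ {v} → ¬ (Sphere (level 0) v × Divides P v)
    level-0-primitive {v} ((_ , nv) , dv) = p∤N (∣⇒∣ᵤ (*-cancelˡ-∣ P (subst (P * P ∣_) nv (divides-norm dv))))

    r₀ : ℕ
    r₀ = proj₁ (counts-sphere (level 0))

    -- The relation is a recursion of order two, r(k+1) = (p + 1) r(k) - p r(k-1), with geometric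
    -- sums as its solution. Carrying the divisible count d along stands in for r(k-1) and gives it
    -- the meaning 0 at the bottom level.
    counts-levels : ∀ k {r d} → Counts (Sphere (level k)) r → Counts (λ v → Sphere (level k) v × Divides P v) d →
                    r ≡ geometric p (suc k) ℕ.* r₀ × d ≡ geometric p k ℕ.* r₀
    counts-levels zero Cr Cd = trans (counts-unique Cr (proj₂ (counts-sphere (level 0))))
        (sym (trans (cong (λ x → suc x ℕ.* r₀) (ℕ.*-zeroʳ p)) (ℕ.+-identityʳ r₀))) ,
      counts-unique Cd (counts-∅ level-0-primitive)
    counts-levels (suc k) {R} {D} CR CD =
      let r , Cr = counts-sphere (level k)
          d , Cd = counts-filter (divides? P) Cr
          r≡ , d≡ = counts-levels k Cr Cd
      in step (hecke p p-prime p≢2 Cr (P∣level k) CR Cd) r≡ d≡ ,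
         trans (multiples p p-prime p≢2 Cr CD) r≡
      where
      open ℕ.+-*-Solver
      lemma : ∀ p g r → suc p ℕ.* (suc (p ℕ.* g) ℕ.* r) ≡ suc (p ℕ.* suc (p ℕ.* g)) ℕ.* r ℕ.+ p ℕ.* (g ℕ.* r)
      lemma = solve 3 (λ p g r → (con 1 :+ p) :* ((con 1 :+ p :* g) :* r)
                := (con 1 :+ p :* (con 1 :+ p :* g)) :* r :+ p :* (g :* r)) refl
      step : ∀ {r d} → R ℕ.+ p ℕ.* d ≡ suc p ℕ.* r → r ≡ geometric p (suc k) ℕ.* r₀ → d ≡ geometric p k ℕ.* r₀ →
             R ≡ geometric p (2 ℕ.+ k) ℕ.* r₀
      step eq refl refl = ℕ.+-cancelʳ-≡ (p ℕ.* (geometric p k ℕ.* r₀)) R _ (trans eq (lemma p (geometric p k) r₀))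

    sphere-divisible : ∀ {d} k {r} → d ℕ.∣ geometric p (suc k) →
                       Counts (Sphere (+ (p ℕ.^ (1 ℕ.+ 2 ℕ.* k) ℕ.* N))) r → d ℕ.∣ r
    sphere-divisible {d} k d∣ Cr = subst (d ℕ.∣_) (sym (proj₁ (counts-levels k Cr′ (proj₂ (counts-filter (divides? P) Cr′)))))
      (∣m⇒∣m*n r₀ d∣)
      where
      Cr′ : Counts (Sphere (level k)) _
      Cr′ = subst (λ n → Counts (Sphere n) _) (sym (level-pos k)) Cr

-- Shanks' finite identity

module Shanks where
  open ≡ using (_≡_)

  tri : ℕ → ℕ
  tri zero = 0
  tri (suc k) = suc k ℕ.+ tri k

  tri-double : ∀ n → tri (n ℕ.+ n) ≡ n ℕ.* suc (n ℕ.+ n)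
  tri-double zero = ≡.refl
  tri-double (suc n) = begin
    tri (suc (n ℕ.+ suc n)) ≡⟨ ≡.cong (λ m → tri (suc m)) (ℕ.+-suc n n) ⟩
    2 ℕ.+ (n ℕ.+ n) ℕ.+ (1 ℕ.+ (n ℕ.+ n) ℕ.+ tri (n ℕ.+ n)) ≡⟨ ≡.cong (λ t → 2 ℕ.+ (n ℕ.+ n) ℕ.+ (1 ℕ.+ (n ℕ.+ n) ℕ.+ t)) (tri-double n) ⟩
    2 ℕ.+ (n ℕ.+ n) ℕ.+ (1 ℕ.+ (n ℕ.+ n) ℕ.+ n ℕ.* (1 ℕ.+ (n ℕ.+ n))) ≡⟨ lemma n ⟩
    suc n ℕ.* suc (suc n ℕ.+ suc n) ∎
    where
    open ≡.≡-Reasoning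
    open ℕ.+-*-Solver
    lemma : ∀ n → 2 ℕ.+ (n ℕ.+ n) ℕ.+ (1 ℕ.+ (n ℕ.+ n) ℕ.+ n ℕ.* (1 ℕ.+ (n ℕ.+ n))) ≡ suc n ℕ.* suc (suc n ℕ.+ suc n)
    lemma = solve 1 (λ n → con 2 :+ (n :+ n) :+ (con 1 :+ (n :+ n) :+ n :* (con 1 :+ (n :+ n)))
              := (con 1 :+ n) :* (con 1 :+ (con 1 :+ n :+ (con 1 :+ n)))) ≡.refl

  exponent-split : ∀ n s → suc (suc n ℕ.+ suc n) ℕ.* s ≡ s ℕ.+ s ℕ.+ suc (n ℕ.+ n) ℕ.* s
  exponent-split = solve 2 (λ n s → (con 1 :+ (con 1 :+ n :+ (con 1 :+ n))) :* s := s :+ s :+ (con 1 :+ (n :+ n)) :* s) ≡.refl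
    where open ℕ.+-*-Solver

  module Identity {c ℓ : Level} (A : CommutativeRing c ℓ) where
    open CommutativeRing A
    open Algebra.Properties.Semiring.Exp semiring
    open Algebra.Properties.Group +-group using () renaming (∙-cancelʳ to +-cancelʳ)
    open Algebra.Solver.Ring.NaturalCoefficients.Default commutativeSemiring using (solve; _:+_; _:*_; _:=_)
    open SetoidReasoning setoid

    sumTo : ℕ → (ℕ → Carrier) → Carrier
    sumTo zero t = 0#
    sumTo (suc m) t = sumTo m t + t m

    sumTo-cong : ∀ m {t u} → (∀ i → t i ≈ u i) → sumTo m t ≈ sumTo m u
    sumTo-cong zero p = refl
    sumTo-cong (suc m) p = +-cong (sumTo-cong m p) (p m)

    -- Q s stands for the product of (1 - x^(2i-1))/(1 - x^(2i)) over 1 ≤ i ≤ s. It enters through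
    -- its recurrence, with the negative terms moved across, so that nothing has to be inverted;
    -- `cancel` says that 1 - x^(k+1) may be cancelled.
    module _ (x : Carrier) (Q : ℕ → Carrier) (Q-zero : Q 0 ≈ 1#)
             (Q-suc : ∀ s → Q (suc s) + x * x ^ (s ℕ.+ s) * Q s ≈ Q s + x * (x * x ^ (s ℕ.+ s)) * Q (suc s))
             (cancel : ∀ k {f g} → f + x ^ suc k * g ≈ g + x ^ suc k * f → f ≈ g) where

      -- (1 − xy) Σ Qₛ x²ˢ yˢ and (1 − y) Σ Qₛ yˢ (s < m) differ by Qₘ (1 − x²ᵐ) yᵐ; all terms are
      -- moved so that no subtraction occurs.
      telescope : ∀ y m →
        let S = sumTo m (λ s → Q s * (x ^ (s ℕ.+ s) * y ^ s))
            T = sumTo m (λ s → Q s * y ^ s)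
        in S + y * T + Q m * (x ^ (m ℕ.+ m) * y ^ m) ≈ T + x * y * S + Q m * y ^ m
      telescope y zero = begin
        0# + y * 0# + Q 0 * (1# * 1#) ≈⟨ +-cong (+-congˡ (zeroʳ y)) (*-congˡ (*-identityˡ 1#)) ⟩
        0# + 0# + Q 0 * 1# ≈⟨ +-congʳ (+-congˡ (zeroʳ (x * y))) ⟨
        0# + x * y * 0# + Q 0 * 1# ∎
      telescope y (suc m) rewrite ℕ.+-suc m m = begin
        S + q * (X * Y) + y * (T + q * Y) + q′ * (x * (x * X) * (y * Y))
            ≈⟨ solve 8 (λ S T q q′ X Y x y → S :+ q :* (X :* Y) :+ y :* (T :+ q :* Y) :+ q′ :* (x :* (x :* X) :* (y :* Y))
               := S :+ y :* T :+ q :* (X :* Y) :+ y :* Y :* (q :+ x :* (x :* X) :* q′))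
               refl S T q q′ X Y x y ⟩
        S + y * T + q * (X * Y) + y * Y * (q + x * (x * X) * q′)
          ≈⟨ +-cong (telescope y m) (*-congˡ (sym (Q-suc m))) ⟩
        T + x * y * S + q * Y + y * Y * (q′ + x * X * q)
            ≈⟨ solve 8 (λ S T q q′ X Y x y → T :+ x :* y :* S :+ q :* Y :+ y :* Y :* (q′ :+ x :* X :* q)
               := T :+ q :* Y :+ x :* y :* (S :+ q :* (X :* Y)) :+ q′ :* (y :* Y))
               refl S T q q′ X Y x y ⟩
        T + q * Y + x * y * (S + q * (X * Y)) + q′ * (y * Y) ∎
        where
        S T q q′ X Y : Carrier
        S = sumTo m (λ s → Q s * (x ^ (s ℕ.+ s) * y ^ s))
        T = sumTo m (λ s → Q s * y ^ s)
        q = Q m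
        q′ = Q (suc m)
        X = x ^ (m ℕ.+ m)
        Y = y ^ m

      -- Passing from n to n + 1 multiplies y = x^(2n+1) by x². This turns the sum T of `telescope`
      -- into the sum S, which is why the induction in `shanks` closes.
      y-power : ∀ n s → (x ^ suc (suc n ℕ.+ suc n)) ^ s ≈ x ^ (s ℕ.+ s) * (x ^ suc (n ℕ.+ n)) ^ s
      y-power n s = begin
        (x ^ suc (suc n ℕ.+ suc n)) ^ s ≈⟨ ^-assocʳ x (suc (suc n ℕ.+ suc n)) s ⟩
        x ^ (suc (suc n ℕ.+ suc n) ℕ.* s) ≈⟨ ^-congʳ x (exponent-split n s) ⟩
        x ^ (s ℕ.+ s ℕ.+ suc (n ℕ.+ n) ℕ.* s) ≈⟨ ^-homo-* x (s ℕ.+ s) (suc (n ℕ.+ n) ℕ.* s) ⟩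
        x ^ (s ℕ.+ s) * x ^ (suc (n ℕ.+ n) ℕ.* s) ≈⟨ *-congˡ (^-assocʳ x (suc (n ℕ.+ n)) s) ⟨
        x ^ (s ℕ.+ s) * (x ^ suc (n ℕ.+ n)) ^ s ∎

      triangular : ℕ → Carrier
      triangular m = sumTo m (λ k → x ^ tri k)

      -- The triangular numbers with indices 2n and 2n + 1 are n(2n + 1) and (n + 1)(2n + 1), so the
      -- two new terms are consecutive powers of y = x^(2n+1).
      triangular-step : ∀ n → let y = x ^ suc (n ℕ.+ n) in
        triangular (suc n ℕ.+ suc n) ≈ triangular (n ℕ.+ n) + y ^ n + y * y ^ n
      triangular-step n rewrite ℕ.+-suc n n = +-cong (+-congˡ y^n)
        (trans (^-homo-* x (suc (n ℕ.+ n)) (tri (n ℕ.+ n))) (*-congˡ y^n))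
        where
        y^n : x ^ tri (n ℕ.+ n) ≈ (x ^ suc (n ℕ.+ n)) ^ n
        y^n = trans (^-congʳ x (≡.trans (tri-double n) (ℕ.*-comm n (suc (n ℕ.+ n)))))
                    (sym (^-assocʳ x (suc (n ℕ.+ n)) n))

      -- Shanks' finite form of Gauss' identity ∏ (1 − x²ʳ)/(1 − x²ʳ⁻¹) = Σ x^(k(k+1)/2).
      shanks : ∀ n → sumTo n (λ s → Q s * (x ^ suc (n ℕ.+ n)) ^ s) ≈ Q n * triangular (n ℕ.+ n)
      shanks zero = sym (zeroʳ (Q 0))
      shanks (suc n) = begin
        sumTo (suc n) (λ s → Q s * (x ^ suc (suc n ℕ.+ suc n)) ^ s) ≈⟨ sumTo-cong (suc n) (λ s → *-congˡ (y-power n s)) ⟩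
        -- The factor cancelled is 1 - xy = 1 - x^(2n+2). The summand y (q B) is added on both sides
        -- so that `telescope` applies without subtraction.
        S ≈⟨ cancel (suc (n ℕ.+ n)) (+-cancelʳ (y * (q * B)) _ _ balance) ⟩
        q′ * (B + y * Y) ≈⟨ *-congˡ (triangular-step n) ⟨
        q′ * triangular (suc n ℕ.+ suc n) ∎
        where
        y Y q q′ B S T : Carrier
        y = x ^ suc (n ℕ.+ n)
        Y = y ^ n
        q = Q n
        q′ = Q (suc n)
        B = triangular (n ℕ.+ n) + Y
        S = sumTo (suc n) (λ s → Q s * (x ^ (s ℕ.+ s) * y ^ s))
        T = sumTo (suc n) (λ s → Q s * y ^ s)
        T≈ : T ≈ q * B
        T≈ = trans (+-congʳ (shanks n)) (sym (distribˡ q _ _))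
        tele : S + y * (q * B) + q′ * (x * y * (y * Y)) ≈ q * B + x * y * S + q′ * (y * Y)
        tele = begin
          S + y * (q * B) + q′ * (x * y * (y * Y)) ≈⟨ +-congʳ (+-congˡ (*-congˡ T≈)) ⟨
          S + y * T + q′ * (x * y * (y * Y)) ≈⟨ +-congˡ (*-congˡ (*-congʳ (^-congʳ x (≡.cong suc (ℕ.+-suc n n))))) ⟨
          S + y * T + q′ * (x ^ (suc n ℕ.+ suc n) * y ^ suc n) ≈⟨ telescope y (suc n) ⟩
          T + x * y * S + q′ * (y * Y) ≈⟨ +-congʳ (+-congʳ T≈) ⟩
          q * B + x * y * S + q′ * (y * Y) ∎
        balance : S + x * y * (q′ * (B + y * Y)) + y * (q * B) ≈ q′ * (B + y * Y) + x * y * S + y * (q * B)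
        balance = begin
          S + x * y * (q′ * (B + y * Y)) + y * (q * B)
            ≈⟨ solve 7 (λ S q q′ B Y x y → S :+ x :* y :* (q′ :* (B :+ y :* Y)) :+ y :* (q :* B)
               := S :+ y :* (q :* B) :+ q′ :* (x :* y :* (y :* Y)) :+ x :* y :* q′ :* B)
               refl S q q′ B Y x y ⟩
          S + y * (q * B) + q′ * (x * y * (y * Y)) + x * y * q′ * B ≈⟨ +-congʳ tele ⟩
          q * B + x * y * S + q′ * (y * Y) + x * y * q′ * B
            ≈⟨ solve 7 (λ S q q′ B Y x y → q :* B :+ x :* y :* S :+ q′ :* (y :* Y) :+ x :* y :* q′ :* B
               := x :* y :* S :+ q′ :* (y :* Y) :+ B :* (q :+ x :* y :* q′))
               refl S q q′ B Y x y ⟩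
          x * y * S + q′ * (y * Y) + B * (q + x * y * q′) ≈⟨ +-congˡ (*-congˡ (sym (Q-suc n))) ⟩
          x * y * S + q′ * (y * Y) + B * (q′ + y * q)
            ≈⟨ solve 7 (λ S q q′ B Y x y → x :* y :* S :+ q′ :* (y :* Y) :+ B :* (q′ :+ y :* q)
               := q′ :* (B :+ y :* Y) :+ x :* y :* S :+ y :* (q :* B))
               refl S q q′ B Y x y ⟩
          q′ * (B + y * Y) + x * y * S + y * (q * B) ∎

-- Formal power series and their sections modulo 5

module PowerSeries where
  open ≡ using (_≡_)

  module Series {c ℓ : Level} (R : CommutativeRing c ℓ) where
    open CommutativeRing R
    open SetoidReasoning setoid

    Series : Set c
    Series = ℕ → Carrier

    tail : Series → Series
    tail f n = f (suc n)

    constant : Carrier → Series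
    constant a zero = a
    constant a (suc n) = 0#

    convolve : Series → Series → Series
    convolve f g zero = f 0 * g 0
    convolve f g (suc n) = f 0 * g (suc n) + convolve (tail f) g n

    -- A coefficient of a product depends only on the coefficients up to the same degree. This
    -- bounded form replaces convergence in the passage from Shanks' identity to Gauss'.
    convolve-cong-≤ : ∀ {f f′ g g′} n → (∀ i → i ℕ.≤ n → f i ≈ f′ i) → (∀ i → i ℕ.≤ n → g i ≈ g′ i) →
                      convolve f g n ≈ convolve f′ g′ n
    convolve-cong-≤ zero p q = *-cong (p 0 ℕ.z≤n) (q 0 ℕ.z≤n)
    convolve-cong-≤ (suc n) p q = +-cong (*-cong (p 0 ℕ.z≤n) (q (suc n) ℕ.≤-refl))
      (convolve-cong-≤ n (λ i i≤n → p (suc i) (ℕ.s≤s i≤n)) (λ i i≤n → q i (ℕ.m≤n⇒m≤1+n i≤n)))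

    convolve-cong : ∀ {f f′ g g′} → (∀ i → f i ≈ f′ i) → (∀ i → g i ≈ g′ i) → ∀ n → convolve f g n ≈ convolve f′ g′ n
    convolve-cong p q n = convolve-cong-≤ n (λ i _ → p i) (λ i _ → q i)

    convolve-scaleˡ : ∀ a f g n → convolve (λ i → a * f i) g n ≈ a * convolve f g n
    convolve-scaleˡ a f g zero = *-assoc a (f 0) (g 0)
    convolve-scaleˡ a f g (suc n) = begin
      a * f 0 * g (suc n) + convolve (λ i → a * tail f i) g n ≈⟨ +-cong (*-assoc a (f 0) (g (suc n))) (convolve-scaleˡ a (tail f) g n) ⟩
      a * (f 0 * g (suc n)) + a * convolve (tail f) g n ≈⟨ distribˡ a _ _ ⟨
      a * (f 0 * g (suc n) + convolve (tail f) g n) ∎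

    +-interchange : ∀ a b c d → a + b + (c + d) ≈ a + c + (b + d)
    +-interchange a b c d = begin
      a + b + (c + d) ≈⟨ +-assoc a b (c + d) ⟩
      a + (b + (c + d)) ≈⟨ +-congˡ (trans (sym (+-assoc b c d)) (trans (+-congʳ (+-comm b c)) (+-assoc c b d))) ⟩
      a + (c + (b + d)) ≈⟨ +-assoc a c (b + d) ⟨
      a + c + (b + d) ∎

    convolve-distribʳ : ∀ h f g n → convolve (λ i → f i + g i) h n ≈ convolve f h n + convolve g h n
    convolve-distribʳ h f g zero = distribʳ (h 0) (f 0) (g 0)
    convolve-distribʳ h f g (suc n) = begin
      (f 0 + g 0) * h (suc n) + convolve (λ i → tail f i + tail g i) h n
        ≈⟨ +-cong (distribʳ (h (suc n)) (f 0) (g 0)) (convolve-distribʳ h (tail f) (tail g) n) ⟩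
      f 0 * h (suc n) + g 0 * h (suc n) + (convolve (tail f) h n + convolve (tail g) h n)
        ≈⟨ +-interchange _ _ _ _ ⟩
      convolve f h (suc n) + convolve g h (suc n) ∎

    convolve-zeroˡ : ∀ f g → (∀ i → f i ≈ 0#) → ∀ n → convolve f g n ≈ 0#
    convolve-zeroˡ f g p zero = trans (*-congʳ (p 0)) (zeroˡ (g 0))
    convolve-zeroˡ f g p (suc n) = trans (+-cong (trans (*-congʳ (p 0)) (zeroˡ (g (suc n))))
      (convolve-zeroˡ (tail f) g (λ i → p (suc i)) n)) (+-identityˡ 0#)

    convolve-constant : ∀ a g n → convolve (constant a) g n ≈ a * g n
    convolve-constant a g zero = refl
    convolve-constant a g (suc n) =
      trans (+-congˡ (convolve-zeroˡ (tail (constant a)) g (λ _ → refl) n)) (+-identityʳ _)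

    convolve-tailʳ : ∀ f g n → convolve f g (suc n) ≈ convolve f (tail g) n + f (suc n) * g 0
    convolve-tailʳ f g zero = refl
    convolve-tailʳ f g (suc n) = trans (+-congˡ (convolve-tailʳ (tail f) g n)) (sym (+-assoc _ _ _))

    convolve-comm : ∀ f g n → convolve f g n ≈ convolve g f n
    convolve-comm f g zero = *-comm (f 0) (g 0)
    convolve-comm f g (suc n) = begin
      f 0 * g (suc n) + convolve (tail f) g n ≈⟨ +-cong (*-comm _ _) (convolve-comm (tail f) g n) ⟩
      g (suc n) * f 0 + convolve g (tail f) n ≈⟨ +-comm _ _ ⟩
      convolve g (tail f) n + g (suc n) * f 0 ≈⟨ convolve-tailʳ g f n ⟨
      convolve g f (suc n) ∎

    convolve-assoc : ∀ f g h n → convolve (convolve f g) h n ≈ convolve f (convolve g h) n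
    convolve-assoc f g h zero = *-assoc (f 0) (g 0) (h 0)
    convolve-assoc f g h (suc n) = begin
      f 0 * g 0 * h (suc n) + convolve (λ i → f 0 * tail g i + convolve (tail f) g i) h n
        ≈⟨ +-cong (*-assoc (f 0) (g 0) (h (suc n))) (convolve-distribʳ h (λ i → f 0 * tail g i) (convolve (tail f) g) n) ⟩
      f 0 * (g 0 * h (suc n)) + (convolve (λ i → f 0 * tail g i) h n + convolve (convolve (tail f) g) h n)
        ≈⟨ +-congˡ (+-cong (convolve-scaleˡ (f 0) (tail g) h n) (convolve-assoc (tail f) g h n)) ⟩
      f 0 * (g 0 * h (suc n)) + (f 0 * convolve (tail g) h n + convolve (tail f) (convolve g h) n)
        ≈⟨ +-assoc _ _ _ ⟨
      f 0 * (g 0 * h (suc n)) + f 0 * convolve (tail g) h n + convolve (tail f) (convolve g h) n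
        ≈⟨ +-congʳ (distribˡ (f 0) _ _) ⟨
      convolve f (convolve g h) (suc n) ∎

    seriesRing : CommutativeRing c ℓ
    seriesRing = record
      { Carrier = Series
      ; _≈_ = λ f g → ∀ n → f n ≈ g n
      ; _+_ = λ f g n → f n + g n
      ; _*_ = convolve
      ; -_ = λ f n → - f n
      ; 0# = λ _ → 0#
      ; 1# = constant 1#
      ; isCommutativeRing = record
        { isRing = record
          { +-isAbelianGroup = Pointwise.isAbelianGroup ℕ +-isAbelianGroup
          ; *-cong = convolve-cong
          ; *-assoc = convolve-assoc
          ; *-identity = (λ f n → trans (convolve-constant 1# f n) (*-identityˡ (f n))) ,
                         (λ f n → trans (convolve-comm f (constant 1#) n) (trans (convolve-constant 1# f n) (*-identityˡ (f n))))
          ; distrib = (λ f g h n → trans (convolve-comm f _ n) (trans (convolve-distribʳ f g h n) (+-cong (convolve-comm g f n) (convolve-comm h f n)))) ,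
                      convolve-distribʳ
          }
        ; *-comm = convolve-comm
        }
      }

    module A = CommutativeRing seriesRing
    open Algebra.Properties.Semiring.Exp A.semiring using () renaming (_^_ to _^ₛ_; ^-congˡ to ^ₛ-congˡ)

    x : Series
    x zero = 0#
    x (suc zero) = 1#
    x (suc (suc n)) = 0#

    x-zero : ∀ f → (x A.* f) 0 ≈ 0#
    x-zero f = zeroˡ (f 0)

    x-suc : ∀ f n → (x A.* f) (suc n) ≈ f n
    x-suc f n = begin
      0# * f (suc n) + convolve (tail x) f n ≈⟨ +-cong (zeroˡ _) (convolve-cong tail-x (λ _ → refl) n) ⟩
      0# + convolve (constant 1#) f n ≈⟨ +-identityˡ _ ⟩
      convolve (constant 1#) f n ≈⟨ A.*-identityˡ f n ⟩
      f n ∎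
      where
      tail-x : ∀ i → tail x i ≈ constant 1# i
      tail-x zero = refl
      tail-x (suc i) = refl

    x^-below : ∀ k f {n} → n ℕ.< k → (x ^ₛ k A.* f) n ≈ 0#
    x^-below (suc k) f {zero} _ = trans (A.*-assoc x (x ^ₛ k) f 0) (x-zero (x ^ₛ k A.* f))
    x^-below (suc k) f {suc n} (ℕ.s≤s n<k) =
      trans (A.*-assoc x (x ^ₛ k) f (suc n)) (trans (x-suc (x ^ₛ k A.* f) n) (x^-below k f n<k))

    x^-above : ∀ k f n → (x ^ₛ k A.* f) (k ℕ.+ n) ≈ f n
    x^-above zero f n = A.*-identityˡ f n
    x^-above (suc k) f n = trans (A.*-assoc x (x ^ₛ k) f (suc (k ℕ.+ n))) (trans (x-suc (x ^ₛ k A.* f) (k ℕ.+ n)) (x^-above k f n))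

    open Algebra.Properties.Group +-group using () renaming (∙-cancelʳ to +-cancelʳ)

    -- The difference f - g equals its own shift by k + 1 places, so its coefficients vanish by
    -- strong induction.
    x^-cancel : ∀ k {f g} → f A.+ x ^ₛ suc k A.* g A.≈ g A.+ x ^ₛ suc k A.* f → f A.≈ g
    x^-cancel k {f} {g} eq = <-rec (λ n → f n ≈ g n) step
      where
      step : ∀ n → (∀ {m} → m ℕ.< n → f m ≈ g m) → f n ≈ g n
      step n ih with n ℕ.<? suc k
      ... | yes n<k = +-cancelʳ 0# (f n) (g n)
        (trans (+-congˡ (sym (x^-below (suc k) g n<k))) (trans (eq n) (+-congˡ (x^-below (suc k) f n<k))))
      ... | no n≮k with m , ≡.refl ← ℕ.m≤n⇒∃[o]m+o≡n (ℕ.≮⇒≥ n≮k) =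
        +-cancelʳ (g m) (f (suc k ℕ.+ m)) (g (suc k ℕ.+ m))
          (trans (+-congˡ (sym (x^-above (suc k) g m)))
            (trans (eq (suc k ℕ.+ m)) (+-congˡ (trans (x^-above (suc k) f m) (ih (ℕ.s≤s (ℕ.m≤n+m m k)))))))

    0<5 : 0 ℕ.< 5
    0<5 = ℕ.m≤m+n 1 4
    1<5 : 1 ℕ.< 5
    1<5 = ℕ.m≤m+n 2 3
    2<5 : 2 ℕ.< 5
    2<5 = ℕ.m≤m+n 3 2
    3<5 : 3 ℕ.< 5
    3<5 = ℕ.m≤m+n 4 1
    4<5 : 4 ℕ.< 5
    4<5 = ℕ.≤-refl

    -- The substitution f(x⁵). Such series act as scalars on sections, which is the content of
    -- `section-spread`.
    spread : Series → Series
    spread f 0 = f 0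
    spread f 1 = 0#
    spread f 2 = 0#
    spread f 3 = 0#
    spread f 4 = 0#
    spread f (suc (suc (suc (suc (suc n))))) = spread (tail f) n

    0*+ : ∀ a {b c} → b ≈ c → 0# * a + b ≈ c
    0*+ a p = trans (+-cong (zeroˡ a) p) (+-identityˡ _)

    convolve-spread : ∀ f g n → (spread f A.* g) (5 ℕ.+ n) ≈ f 0 * g (5 ℕ.+ n) + (spread (tail f) A.* g) n
    convolve-spread f g n = +-congˡ (0*+ _ (0*+ _ (0*+ _ (0*+ _ refl))))

    convolve-spread-< : ∀ f g {n} → n ℕ.< 5 → (spread f A.* g) n ≈ f 0 * g n
    convolve-spread-< f g {0} _ = refl
    convolve-spread-< f g {1} _ = trans (+-congˡ (zeroˡ _)) (+-identityʳ _)
    convolve-spread-< f g {2} _ = trans (+-congˡ (0*+ _ (zeroˡ _))) (+-identityʳ _)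
    convolve-spread-< f g {3} _ = trans (+-congˡ (0*+ _ (0*+ _ (zeroˡ _)))) (+-identityʳ _)
    convolve-spread-< f g {4} _ = trans (+-congˡ (0*+ _ (0*+ _ (0*+ _ (zeroˡ _))))) (+-identityʳ _)
    convolve-spread-< f g {suc (suc (suc (suc (suc _))))} (ℕ.s≤s (ℕ.s≤s (ℕ.s≤s (ℕ.s≤s (ℕ.s≤s ())))))

    section : ℕ → Series → Series
    section k f n = f (n ℕ.* 5 ℕ.+ k)

    section-spread : ∀ {k} → k ℕ.< 5 → ∀ f g → section k (spread f A.* g) A.≈ f A.* section k g
    section-spread k<5 f g zero = convolve-spread-< f g k<5
    section-spread {k} k<5 f g (suc n) = trans (convolve-spread f g (n ℕ.* 5 ℕ.+ k)) (+-congˡ (section-spread k<5 (tail f) g n))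

    weave : (e₀ e₁ e₂ e₃ e₄ : Series) → Series
    weave e₀ e₁ e₂ e₃ e₄ 0 = e₀ 0
    weave e₀ e₁ e₂ e₃ e₄ 1 = e₁ 0
    weave e₀ e₁ e₂ e₃ e₄ 2 = e₂ 0
    weave e₀ e₁ e₂ e₃ e₄ 3 = e₃ 0
    weave e₀ e₁ e₂ e₃ e₄ 4 = e₄ 0
    weave e₀ e₁ e₂ e₃ e₄ (suc (suc (suc (suc (suc n))))) = weave (tail e₀) (tail e₁) (tail e₂) (tail e₃) (tail e₄) n

    weave-section : ∀ f → f A.≈ weave (section 0 f) (section 1 f) (section 2 f) (section 3 f) (section 4 f)
    weave-section f 0 = refl
    weave-section f 1 = refl
    weave-section f 2 = refl
    weave-section f 3 = refl
    weave-section f 4 = refl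
    weave-section f (suc (suc (suc (suc (suc n))))) = weave-section (λ i → f (5 ℕ.+ i)) n

    shift : ℕ → Series → Series
    shift zero f n = f n
    shift (suc k) f zero = 0#
    shift (suc k) f (suc n) = shift k f n

    shift-x : ∀ k f → shift (suc k) f A.≈ x A.* shift k f
    shift-x k f zero = sym (x-zero (shift k f))
    shift-x k f (suc n) = sym (x-suc (shift k f) n)

    shift-spread : ∀ {k} → k ℕ.< 5 → ∀ f n → shift k (spread f) (5 ℕ.+ n) ≈ shift k (spread (tail f)) n
    shift-spread {0} k<5 f n = refl
    shift-spread {1} k<5 f zero = refl
    shift-spread {2} k<5 f zero = refl
    shift-spread {3} k<5 f zero = refl
    shift-spread {4} k<5 f zero = refl
    shift-spread {suc k} k<5 f (suc n) = shift-spread {k} (ℕ.<-trans (ℕ.n<1+n k) k<5) f n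
    shift-spread {suc (suc (suc (suc (suc _))))} (ℕ.s≤s (ℕ.s≤s (ℕ.s≤s (ℕ.s≤s (ℕ.s≤s ()))))) f zero

    weave-shift : ∀ e₀ e₁ e₂ e₃ e₄ → weave e₀ e₁ e₂ e₃ e₄ A.≈
      spread e₀ A.+ (shift 1 (spread e₁) A.+ (shift 2 (spread e₂) A.+ (shift 3 (spread e₃) A.+ shift 4 (spread e₄))))
    weave-shift e₀ e₁ e₂ e₃ e₄ 0 = sym (trans (+-congˡ (0+ (0+ (0+ refl)))) (+-identityʳ _))
      where
      0+ : ∀ {a b} → a ≈ b → 0# + a ≈ b
      0+ p = trans (+-identityˡ _) p
    weave-shift e₀ e₁ e₂ e₃ e₄ 1 = sym (trans (+-identityˡ _) (trans (+-congˡ (trans (+-identityˡ _) (+-identityˡ _))) (+-identityʳ _)))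
    weave-shift e₀ e₁ e₂ e₃ e₄ 2 = sym (trans (+-identityˡ _) (trans (+-identityˡ _) (trans (+-congˡ (+-identityˡ _)) (+-identityʳ _))))
    weave-shift e₀ e₁ e₂ e₃ e₄ 3 = sym (trans (+-identityˡ _) (trans (+-identityˡ _) (trans (+-identityˡ _) (+-identityʳ _))))
    weave-shift e₀ e₁ e₂ e₃ e₄ 4 = sym (trans (+-identityˡ _) (trans (+-identityˡ _) (trans (+-identityˡ _) (+-identityˡ _))))
    weave-shift e₀ e₁ e₂ e₃ e₄ (suc (suc (suc (suc (suc n))))) =
      trans (weave-shift (tail e₀) (tail e₁) (tail e₂) (tail e₃) (tail e₄) n)
        (+-congˡ (+-cong (sym (shift-spread 1<5 e₁ n)) (+-cong (sym (shift-spread 2<5 e₂ n))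
          (+-cong (sym (shift-spread 3<5 e₃ n)) (sym (shift-spread 4<5 e₄ n))))))

    weave-spread : ∀ e₀ e₁ e₂ e₃ e₄ → weave e₀ e₁ e₂ e₃ e₄ A.≈
      spread e₀ A.+ (x A.* spread e₁ A.+ (x A.* (x A.* spread e₂) A.+ (x A.* (x A.* (x A.* spread e₃)) A.+ x A.* (x A.* (x A.* (x A.* spread e₄))))))
    weave-spread e₀ e₁ e₂ e₃ e₄ = A.trans (weave-shift e₀ e₁ e₂ e₃ e₄)
      (A.+-congˡ {spread e₀} (A.+-cong (s₁ e₁) (A.+-cong (s₂ e₂) (A.+-cong (s₃ e₃)
        (A.trans (shift-x 3 (spread e₄)) (A.*-congˡ {x} (s₃ e₄)))))))
      where
      s₁ : ∀ e → shift 1 (spread e) A.≈ x A.* spread e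
      s₁ e = shift-x 0 (spread e)
      s₂ : ∀ e → shift 2 (spread e) A.≈ x A.* (x A.* spread e)
      s₂ e = A.trans (shift-x 1 (spread e)) (A.*-congˡ {x} (s₁ e))
      s₃ : ∀ e → shift 3 (spread e) A.≈ x A.* (x A.* (x A.* spread e))
      s₃ e = A.trans (shift-x 2 (spread e)) (A.*-congˡ {x} (s₂ e))

    section-x-suc : ∀ j h → section (suc j) (x A.* h) A.≈ section j h
    section-x-suc j h n rewrite ℕ.+-suc (n ℕ.* 5) j = x-suc h (n ℕ.* 5 ℕ.+ j)

    section-x-zero : ∀ h → section 0 (x A.* h) A.≈ x A.* section 4 h
    section-x-zero h zero = trans (x-zero h) (sym (x-zero (section 4 h)))
    section-x-zero h (suc n) = begin
      (x A.* h) (5 ℕ.+ (n ℕ.* 5 ℕ.+ 0)) ≈⟨ x-suc h (4 ℕ.+ (n ℕ.* 5 ℕ.+ 0)) ⟩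
      h (4 ℕ.+ (n ℕ.* 5 ℕ.+ 0)) ≡⟨ ≡.cong h (≡.trans (≡.cong (4 ℕ.+_) (ℕ.+-identityʳ (n ℕ.* 5))) (ℕ.+-comm 4 (n ℕ.* 5))) ⟩
      section 4 h n ≈⟨ x-suc (section 4 h) n ⟨
      (x A.* section 4 h) (suc n) ∎

    open Algebra.Solver.Ring.NaturalCoefficients.Default A.commutativeSemiring using (solve; con; _:+_; _:*_; _:=_)

    module _ (f g : Series) where
      private
        f₀ f₁ f₂ f₃ f₄ g₀ g₁ g₂ g₃ g₄ h₀ h₁ h₂ h₃ h₄ : Series
        f₀ = section 0 f
        f₁ = section 1 f
        f₂ = section 2 f
        f₃ = section 3 f
        f₄ = section 4 f
        g₀ = section 0 g
        g₁ = section 1 g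
        g₂ = section 2 g
        g₃ = section 3 g
        g₄ = section 4 g
        -- Horner form of f g for f = Σ xᵏ fₖ(x⁵). Passing a factor x lowers the section index by
        -- one, and from index 0 it wraps to 4 with a new factor x; this yields the carries in the
        -- five product formulas.
        h₄ = spread f₄ A.* g
        h₃ = spread f₃ A.* g A.+ x A.* h₄
        h₂ = spread f₂ A.* g A.+ x A.* h₃
        h₁ = spread f₁ A.* g A.+ x A.* h₂
        h₀ = spread f₀ A.* g A.+ x A.* h₁

        *-horner : f A.* g A.≈ h₀
        *-horner = A.trans (A.*-congʳ {g} (A.trans (weave-section f) (weave-spread f₀ f₁ f₂ f₃ f₄)))
          (solve 7 (λ s₀ s₁ s₂ s₃ s₄ x g →
              (s₀ :+ (x :* s₁ :+ (x :* (x :* s₂) :+ (x :* (x :* (x :* s₃)) :+ x :* (x :* (x :* (x :* s₄))))))) :* g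
              := s₀ :* g :+ x :* (s₁ :* g :+ x :* (s₂ :* g :+ x :* (s₃ :* g :+ x :* (s₄ :* g)))))
            (λ _ → refl) (spread f₀) (spread f₁) (spread f₂) (spread f₃) (spread f₄) x g)

        at : ∀ {k} → k ℕ.< 5 → ∀ s → section k (spread s A.* g) A.≈ s A.* section k g
        at k<5 s = section-spread k<5 s g

        down : ∀ {j} → suc j ℕ.< 5 → ∀ s h {e} → section j h A.≈ e →
               section (suc j) (spread s A.* g A.+ x A.* h) A.≈ s A.* section (suc j) g A.+ e
        down {j} j<5 s h p = A.+-cong (at j<5 s) (A.trans (section-x-suc j h) p)

        wrap : ∀ s h {e} → section 4 h A.≈ e → section 0 (spread s A.* g A.+ x A.* h) A.≈ s A.* section 0 g A.+ x A.* e
        wrap s h p = A.+-cong (at 0<5 s) (A.trans (section-x-zero h) (A.*-congˡ {x} p))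

      section-0-* : section 0 (f A.* g) A.≈ f₀ A.* g₀ A.+ x A.* (f₁ A.* g₄ A.+ (f₂ A.* g₃ A.+ (f₃ A.* g₂ A.+ f₄ A.* g₁)))
      section-0-* = A.trans (λ n → *-horner (n ℕ.* 5 ℕ.+ 0))
        (wrap f₀ h₁ (down 4<5 f₁ h₂ (down 3<5 f₂ h₃ (down 2<5 f₃ h₄ (at 1<5 f₄)))))

      section-1-* : section 1 (f A.* g) A.≈ f₀ A.* g₁ A.+ (f₁ A.* g₀ A.+ x A.* (f₂ A.* g₄ A.+ (f₃ A.* g₃ A.+ f₄ A.* g₂)))
      section-1-* = A.trans (λ n → *-horner (n ℕ.* 5 ℕ.+ 1))
        (down 1<5 f₀ h₁ (wrap f₁ h₂ (down 4<5 f₂ h₃ (down 3<5 f₃ h₄ (at 2<5 f₄)))))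

      section-2-* : section 2 (f A.* g) A.≈ f₀ A.* g₂ A.+ (f₁ A.* g₁ A.+ (f₂ A.* g₀ A.+ x A.* (f₃ A.* g₄ A.+ f₄ A.* g₃)))
      section-2-* = A.trans (λ n → *-horner (n ℕ.* 5 ℕ.+ 2))
        (down 2<5 f₀ h₁ (down 1<5 f₁ h₂ (wrap f₂ h₃ (down 4<5 f₃ h₄ (at 3<5 f₄)))))

      section-3-* : section 3 (f A.* g) A.≈ f₀ A.* g₃ A.+ (f₁ A.* g₂ A.+ (f₂ A.* g₁ A.+ (f₃ A.* g₀ A.+ x A.* (f₄ A.* g₄))))
      section-3-* = A.trans (λ n → *-horner (n ℕ.* 5 ℕ.+ 3))
        (down 3<5 f₀ h₁ (down 2<5 f₁ h₂ (down 1<5 f₂ h₃ (wrap f₃ h₄ (at 4<5 f₄)))))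

      section-4-* : section 4 (f A.* g) A.≈ f₀ A.* g₄ A.+ (f₁ A.* g₃ A.+ (f₂ A.* g₂ A.+ (f₃ A.* g₁ A.+ f₄ A.* g₀)))
      section-4-* = A.trans (λ n → *-horner (n ℕ.* 5 ℕ.+ 4))
        (down 4<5 f₀ h₁ (down 3<5 f₁ h₂ (down 2<5 f₂ h₃ (down 1<5 f₃ h₄ (at 0<5 f₄)))))

    module _ (char-5 : ∀ a → a + a + a + a + a ≈ 0#) (fermat : ∀ a → a * a * a * a * a ≈ a) where
      fifth : Series → Series
      fifth f = f A.* f A.* f A.* f A.* f

      constant-* : ∀ a b → constant a A.* constant b A.≈ constant (a * b)
      constant-* a b zero = refl
      constant-* a b (suc n) = trans (convolve-constant a (constant b) (suc n)) (zeroʳ a)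

      fifth-constant : ∀ a → fifth (constant a) A.≈ constant a
      fifth-constant a = A.trans (step (step (step (constant-* a a)))) (λ { zero → fermat a ; (suc n) → refl })
        where
        step : ∀ {f b} → f A.≈ constant b → f A.* constant a A.≈ constant (b * a)
        step p = A.trans (A.*-congʳ {constant a} p) (constant-* _ a)

      constant-tail : ∀ f → f A.≈ constant (f 0) A.+ x A.* tail f
      constant-tail f zero = sym (trans (+-congˡ (x-zero (tail f))) (+-identityʳ _))
      constant-tail f (suc n) = sym (trans (+-identityˡ _) (x-suc (tail f) n))

      -- Frobenius for the two summands c = f 0 and y = x · tail f: (c + y)⁵ = c⁵ + y⁵ + 5r with r =
      -- cy(c³ + 2c²y + 2cy² + y³). The characteristic removes 5r, and c⁵ = c by Fermat.
      fifth-tail : ∀ f → fifth f A.≈ constant (f 0) A.+ x ^ₛ 5 A.* fifth (tail f)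
      fifth-tail f = A.trans (A.*-cong (A.*-cong (A.*-cong (A.*-cong p p) p) p) p)
        (A.trans (frobenius (constant (f 0)) x (tail f))
          (A.trans (A.+-cong (A.+-congʳ {x ^ₛ 5 A.* fifth (tail f)} (fifth-constant (f 0))) (λ n → char-5 _)) (A.+-identityʳ _)))
        where
        p = constant-tail f
        frobenius : ∀ c x t → let y = x A.* t; r = c A.* y A.* (c A.* c A.* c A.+ y A.* y A.* y A.+ (c A.* c A.* y A.+ c A.* c A.* y) A.+ (c A.* y A.* y A.+ c A.* y A.* y)) in
          fifth (c A.+ x A.* t) A.≈ fifth c A.+ x ^ₛ 5 A.* fifth t A.+ (r A.+ r A.+ r A.+ r A.+ r)
        frobenius = solve 3 (λ c x t → let y = x :* t; r = c :* y :* (c :* c :* c :+ y :* y :* y :+ (c :* c :* y :+ c :* c :* y) :+ (c :* y :* y :+ c :* y :* y)); five = λ f → f :* f :* f :* f :* f in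
          five (c :+ x :* t) := five c :+ x :* (x :* (x :* (x :* (x :* con 1)))) :* five t :+ (r :+ r :+ r :+ r :+ r)) (λ _ → refl)

      fifth-spread : ∀ f → fifth f A.≈ spread f
      fifth-spread f n = go n f
        where
        below : ∀ f {n} → n ℕ.< 5 → fifth f n ≈ constant (f 0) n
        below f {n} n<5 = trans (fifth-tail f n) (trans (+-congˡ (x^-below 5 (fifth (tail f)) n<5)) (+-identityʳ _))
        go : ∀ n f → fifth f n ≈ spread f n
        go 0 f = below f 0<5
        go 1 f = below f 1<5
        go 2 f = below f 2<5
        go 3 f = below f 3<5
        go 4 f = below f 4<5
        go (suc (suc (suc (suc (suc n))))) f = trans (fifth-tail f (5 ℕ.+ n))
          (trans (+-identityˡ _) (trans (x^-above 5 (fifth (tail f)) n) (go n (tail f))))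

-- Coefficients modulo 5

module Modulo5 where
  open PowerSeries
  open import Data.Integer using (ℤ; +_; -_; _+_; _*_; _-_; _/ℕ_; _%ℕ_)
  open import Data.Integer.DivMod using (a≡a%ℕn+[a/ℕn]*n; n%ℕd<d)
  open import Data.Integer.Divisibility.Signed
  open ≡ using (_≡_)

  infix 4 _≡₅_

  record _≡₅_ (a b : ℤ) : Set where
    constructor mod₅
    field 5∣difference : + 5 ∣ a - b

  open _≡₅_ public

  ≡⇒≡₅ : ∀ {a b} → a ≡ b → a ≡₅ b
  ≡⇒≡₅ {a} ≡.refl = mod₅ (divides (+ 0) (ℤ.+-inverseʳ a))

  private
    via : ∀ {a b d} → a - b ≡ d → + 5 ∣ d → a ≡₅ b
    via eq d = mod₅ (≡.subst (+ 5 ∣_) (≡.sym eq) d)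

    sym₅ : ∀ {a b} → a ≡₅ b → b ≡₅ a
    sym₅ {a} {b} (mod₅ d) = via (lemma a b) (∣m⇒∣-m d)
      where
      lemma : ∀ a b → b - a ≡ - (a - b)
      lemma = solve-∀

    trans₅ : ∀ {a b c} → a ≡₅ b → b ≡₅ c → a ≡₅ c
    trans₅ {a} {b} {c} (mod₅ d) (mod₅ e) = via (lemma a b c) (∣m∣n⇒∣m+n d e)
      where
      lemma : ∀ a b c → a - c ≡ (a - b) + (b - c)
      lemma = solve-∀

    +-cong₅ : ∀ {a b c d} → a ≡₅ b → c ≡₅ d → a + c ≡₅ b + d
    +-cong₅ {a} {b} {c} {d} (mod₅ p) (mod₅ q) = via (lemma a b c d) (∣m∣n⇒∣m+n p q)
      where
      lemma : ∀ a b c d → (a + c) - (b + d) ≡ (a - b) + (c - d)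
      lemma = solve-∀

    *-cong₅ : ∀ {a b c d} → a ≡₅ b → c ≡₅ d → a * c ≡₅ b * d
    *-cong₅ {a} {b} {c} {d} (mod₅ p) (mod₅ q) = via (lemma a b c d) (∣m∣n⇒∣m+n (∣m⇒∣m*n c p) (∣n⇒∣m*n b q))
      where
      lemma : ∀ a b c d → a * c - b * d ≡ (a - b) * c + b * (c - d)
      lemma = solve-∀

    neg-cong₅ : ∀ {a b} → a ≡₅ b → - a ≡₅ - b
    neg-cong₅ {a} {b} (mod₅ p) = via (lemma a b) (∣m⇒∣-m p)
      where
      lemma : ∀ a b → - a - - b ≡ - (a - b)
      lemma = solve-∀

  -- Integers with congruence as their equality, so that counts are coefficients as they stand and
  -- no reduction map intervenes.
  ℤ/5 : CommutativeRing 0ℓ 0ℓ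
  ℤ/5 = record
    { Carrier = ℤ ; _≈_ = _≡₅_ ; _+_ = _+_ ; _*_ = _*_ ; -_ = -_ ; 0# = + 0 ; 1# = + 1
    ; isCommutativeRing = record
      { isRing = record
        { +-isAbelianGroup = record
          { isGroup = record
            { isMonoid = record
              { isSemigroup = record
                { isMagma = record
                  { isEquivalence = record { refl = ≡⇒≡₅ ≡.refl ; sym = sym₅ ; trans = trans₅ }
                  ; ∙-cong = +-cong₅ }
                ; assoc = λ a b c → ≡⇒≡₅ (ℤ.+-assoc a b c) }
              ; identity = (λ a → ≡⇒≡₅ (ℤ.+-identityˡ a)) , (λ a → ≡⇒≡₅ (ℤ.+-identityʳ a)) }
            ; inverse = (λ a → ≡⇒≡₅ (ℤ.+-inverseˡ a)) , (λ a → ≡⇒≡₅ (ℤ.+-inverseʳ a))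
            ; ⁻¹-cong = neg-cong₅ }
          ; comm = λ a b → ≡⇒≡₅ (ℤ.+-comm a b) }
        ; *-cong = *-cong₅
        ; *-assoc = λ a b c → ≡⇒≡₅ (ℤ.*-assoc a b c)
        ; *-identity = (λ a → ≡⇒≡₅ (ℤ.*-identityˡ a)) , (λ a → ≡⇒≡₅ (ℤ.*-identityʳ a))
        ; distrib = (λ a b c → ≡⇒≡₅ (ℤ.*-distribˡ-+ a b c)) , (λ a b c → ≡⇒≡₅ (ℤ.*-distribʳ-+ a b c)) }
      ; *-comm = λ a b → ≡⇒≡₅ (ℤ.*-comm a b) } }

  open Series ℤ/5 public

  char-5 : ∀ a → a + a + a + a + a ≡₅ + 0
  char-5 a = via (lemma a) (∣n⇒∣m*n a (∣-refl {+ 5}))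
    where
    lemma : ∀ a → a + a + a + a + a - + 0 ≡ a * + 5
    lemma = solve-∀

  fermat : ∀ a → a * a * a * a * a ≡₅ a
  fermat a = trans₅ (fifth-cong a≡r) (trans₅ (small (a %ℕ 5) (n%ℕd<d a 5)) (sym₅ a≡r))
    where
    fifth-cong : ∀ {a b} → a ≡₅ b → a * a * a * a * a ≡₅ b * b * b * b * b
    fifth-cong p = *-cong₅ (*-cong₅ (*-cong₅ (*-cong₅ p p) p) p) p
    a≡r : a ≡₅ + (a %ℕ 5)
    a≡r = via (≡.trans (≡.cong (_- + (a %ℕ 5)) (a≡a%ℕn+[a/ℕn]*n a 5)) (lemma (+ (a %ℕ 5)) (a /ℕ 5)))
              (∣n⇒∣m*n (a /ℕ 5) (∣-refl {+ 5}))
      where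
      lemma : ∀ r q → (r + q * + 5) - r ≡ q * + 5
      lemma = solve-∀
    small : ∀ r → r ℕ.< 5 → + r * + r * + r * + r * + r ≡₅ + r
    small 0 _ = mod₅ (divides (+ 0) ≡.refl)
    small 1 _ = mod₅ (divides (+ 0) ≡.refl)
    small 2 _ = mod₅ (divides (+ 6) ≡.refl)
    small 3 _ = mod₅ (divides (+ 48) ≡.refl)
    small 4 _ = mod₅ (divides (+ 204) ≡.refl)
    small (suc (suc (suc (suc (suc _))))) (ℕ.s≤s (ℕ.s≤s (ℕ.s≤s (ℕ.s≤s (ℕ.s≤s ())))))

-- Sections of θ⁴ and of the inverse of θ

module Sections where
  open Modulo5
  open A
  open Algebra.Solver.Ring.NaturalCoefficients.Default commutativeSemiring using (solve; con; _:+_; _:*_; _:=_)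

  -- Modulo 5 the exponent z(z+1)/2 is 0, 1, 3, 1, 0 for z ≡ 0, 1, 2, 3, 4. Thus θ = 2α(x⁵) +
  -- 2xβ(x⁵) + x³c(x⁵), where α and β come from one class each of the pairs {0, 4} and {1, 3} that z
  -- ↦ -1 - z interchanges. The last hypothesis writes θ² in the same α, β, c without the
  -- substitution x⁵, and so brings the sections back to θ itself.
  module _ (θ α β c : Series)
           (θ₀ : section 0 θ ≈ α + α) (θ₁ : section 1 θ ≈ β + β) (θ₂ : section 2 θ ≈ 0#)
           (θ₃ : section 3 θ ≈ c) (θ₄ : section 4 θ ≈ 0#)
           (θ² : θ * θ ≈ α * β + α * β + (α * β + α * β) + x * (c * c)) where
    private
      +-zeros : ∀ r → r + r + r + r + r ≈ 0#
      +-zeros r n = char-5 (r n)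

      F₀ : section 0 (θ * θ) ≈ (α + α) * (α + α)
      F₀ = trans (section-0-* θ θ)
        (trans (+-cong (*-cong θ₀ θ₀) (*-congˡ {x} (+-cong (*-cong θ₁ θ₄) (+-cong (*-cong θ₂ θ₃) (+-cong (*-cong θ₃ θ₂) (*-cong θ₄ θ₁))))))
          (solve 4 (λ a b c x → (a :+ a) :* (a :+ a) :+ x :* ((b :+ b) :* con 0 :+ (con 0 :* c :+ (c :* con 0 :+ con 0 :* (b :+ b))))
            := (a :+ a) :* (a :+ a)) refl α β c x))

      F₁ : section 1 (θ * θ) ≈ (α + α) * (β + β) + ((β + β) * (α + α) + x * (c * c))
      F₁ = trans (section-1-* θ θ)
        (trans (+-cong (*-cong θ₀ θ₁) (+-cong (*-cong θ₁ θ₀) (*-congˡ {x} (+-cong (*-cong θ₂ θ₄) (+-cong (*-cong θ₃ θ₃) (*-cong θ₄ θ₂))))))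
          (solve 4 (λ a b c x → (a :+ a) :* (b :+ b) :+ ((b :+ b) :* (a :+ a) :+ x :* (con 0 :* con 0 :+ (c :* c :+ con 0 :* con 0)))
            := (a :+ a) :* (b :+ b) :+ ((b :+ b) :* (a :+ a) :+ x :* (c :* c))) refl α β c x))

      F₂ : section 2 (θ * θ) ≈ (β + β) * (β + β)
      F₂ = trans (section-2-* θ θ)
        (trans (+-cong (*-cong θ₀ θ₂) (+-cong (*-cong θ₁ θ₁) (+-cong (*-cong θ₂ θ₀) (*-congˡ {x} (+-cong (*-cong θ₃ θ₄) (*-cong θ₄ θ₃))))))
          (solve 4 (λ a b c x → (a :+ a) :* con 0 :+ ((b :+ b) :* (b :+ b) :+ (con 0 :* (a :+ a) :+ x :* (c :* con 0 :+ con 0 :* c)))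
            := (b :+ b) :* (b :+ b)) refl α β c x))

      F₃ : section 3 (θ * θ) ≈ (α + α) * c + c * (α + α)
      F₃ = trans (section-3-* θ θ)
        (trans (+-cong (*-cong θ₀ θ₃) (+-cong (*-cong θ₁ θ₂) (+-cong (*-cong θ₂ θ₁) (+-cong (*-cong θ₃ θ₀) (*-congˡ {x} (*-cong θ₄ θ₄))))))
          (solve 4 (λ a b c x → (a :+ a) :* c :+ ((b :+ b) :* con 0 :+ (con 0 :* (b :+ b) :+ (c :* (a :+ a) :+ x :* (con 0 :* con 0))))
            := (a :+ a) :* c :+ c :* (a :+ a)) refl α β c x))

      F₄ : section 4 (θ * θ) ≈ (β + β) * c + c * (β + β)
      F₄ = trans (section-4-* θ θ)
        (trans (+-cong (*-cong θ₀ θ₄) (+-cong (*-cong θ₁ θ₃) (+-cong (*-cong θ₂ θ₂) (+-cong (*-cong θ₃ θ₁) (*-cong θ₄ θ₀)))))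
          (solve 4 (λ a b c x → (a :+ a) :* con 0 :+ ((b :+ b) :* c :+ (con 0 :* con 0 :+ (c :* (b :+ b) :+ con 0 :* (a :+ a))))
            := (b :+ b) :* c :+ c :* (b :+ b)) refl α β c x))

    -- The relevant part of θ⁴ is 96α²β² + 48xαβc² + x²c⁴, which is ≡ (4αβ + xc²)² (mod 5).
    section-2-fourth-power : section 2 (θ * θ * (θ * θ)) ≈ θ * θ * (θ * θ)
    section-2-fourth-power = trans (section-2-* (θ * θ) (θ * θ))
      (trans (+-cong (*-cong F₀ F₂) (+-cong (*-cong F₁ F₁) (+-cong (*-cong F₂ F₀) (*-congˡ {x} (+-cong (*-cong F₃ F₄) (*-cong F₄ F₃))))))
        (trans (expand α β c x)
          (trans (+-congˡ {square} (+-zeros r))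
            (trans (+-identityʳ square) (sym (*-cong θ² θ²))))))
      where
      p₄ w square r : Series
      p₄ = α * β + α * β + (α * β + α * β)
      r = p₄ * p₄ + x * ((p₄ + p₄) * (c * c))
      w = α * β + α * β + (α * β + α * β) + x * (c * c)
      square = w * w
      expand : ∀ α β c x →
        let a = α + α; b = β + β; p = α * β; p₂ = p + p; p₄ = p₂ + p₂; p₈ = p₄ + p₄; w = p₂ + p₂ + x * (c * c)
            r = p₄ * p₄ + x * (p₈ * (c * c)) in
        a * a * (b * b) + ((a * b + (b * a + x * (c * c))) * (a * b + (b * a + x * (c * c)))
          + (b * b * (a * a) + x * ((a * c + c * a) * (b * c + c * b) + (b * c + c * b) * (a * c + c * a))))
        ≈ w * w + (r + r + r + r + r)
      expand = solve 4 (λ α β c x →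
        let a = α :+ α; b = β :+ β; p = α :* β; p₂ = p :+ p; p₄ = p₂ :+ p₂; p₈ = p₄ :+ p₄; w = p₂ :+ p₂ :+ x :* (c :* c)
            r = p₄ :* p₄ :+ x :* (p₈ :* (c :* c)) in
        a :* a :* (b :* b) :+ ((a :* b :+ (b :* a :+ x :* (c :* c))) :* (a :* b :+ (b :* a :+ x :* (c :* c)))
          :+ (b :* b :* (a :* a) :+ x :* ((a :* c :+ c :* a) :* (b :* c :+ c :* b) :+ (b :* c :+ c :* b) :* (a :* c :+ c :* a))))
        := w :* w :+ (r :+ r :+ r :+ r :+ r)) refl

    -- With Qθ = 2 and θ⁵ ≡ θ(x⁵) one has Q θ(x⁵) ≡ 2θ⁴; comparing exponents ≡ 2 (mod 5) gives Q₂θ ≡ 2θ⁴.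
    section-2-inverse : ∀ Q → Q * θ ≈ 1# + 1# → section 2 Q ≈ θ * (θ * θ) + θ * (θ * θ)
    section-2-inverse Q Qθ = begin
      u ≈⟨ +-identityʳ u ⟨
      -- Halving modulo 5: since 6u ≡ u, the equation 2u ≡ 2t gives u ≡ 3(2u) ≡ 3(2t) ≡ t.
      u + 0# ≈⟨ +-congˡ {u} (+-zeros u) ⟨
      u + (u + u + u + u + u) ≈⟨ solve 1 (λ u → u :+ (u :+ u :+ u :+ u :+ u) := u :+ u :+ (u :+ u) :+ (u :+ u)) refl u ⟩
      u + u + (u + u) + (u + u) ≈⟨ +-cong (+-cong twice twice) twice ⟩
      t + t + (t + t) + (t + t) ≈⟨ solve 1 (λ u → u :+ (u :+ u :+ u :+ u :+ u) := u :+ u :+ (u :+ u) :+ (u :+ u)) refl t ⟨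
      t + (t + t + t + t + t) ≈⟨ +-congˡ {t} (+-zeros t) ⟩
      t + 0# ≈⟨ +-identityʳ t ⟩
      t ∎
      where
      open SetoidReasoning setoid
      u t θ⁴ : Series
      u = section 2 Q
      t = θ * (θ * θ) + θ * (θ * θ)
      θ⁴ = θ * θ * (θ * θ)

      Qθ⁵ : spread θ * Q ≈ θ⁴ + θ⁴
      Qθ⁵ = begin
        spread θ * Q ≈⟨ *-congʳ {Q} (fifth-spread char-5 fermat θ) ⟨
        fifth char-5 fermat θ * Q ≈⟨ solve 2 (λ t q → t :* t :* t :* t :* t :* q := q :* t :* (t :* t :* (t :* t))) refl θ Q ⟩
        Q * θ * θ⁴ ≈⟨ *-congʳ {θ⁴} Qθ ⟩
        (1# + 1#) * θ⁴ ≈⟨ solve 1 (λ f → (con 1 :+ con 1) :* f := f :+ f) refl θ⁴ ⟩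
        θ⁴ + θ⁴ ∎

      θu : θ * u ≈ θ⁴ + θ⁴
      θu = begin
        θ * u ≈⟨ section-spread 2<5 θ Q ⟨
        section 2 (spread θ * Q) ≈⟨ (λ n → Qθ⁵ (n ℕ.* 5 ℕ.+ 2)) ⟩
        section 2 (θ⁴ + θ⁴) ≈⟨ +-cong section-2-fourth-power section-2-fourth-power ⟩
        θ⁴ + θ⁴ ∎

      -- The factor θ of θu ≡ 2θ⁴ is removed by multiplying with Q, since Qθ = 2; the price is a
      -- factor 2 on both sides.
      twice : u + u ≈ t + t
      twice = begin
        u + u ≈⟨ solve 1 (λ f → (con 1 :+ con 1) :* f := f :+ f) refl u ⟨
        (1# + 1#) * u ≈⟨ *-congʳ {u} Qθ ⟨
        Q * θ * u ≈⟨ *-assoc Q θ u ⟩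
        Q * (θ * u) ≈⟨ *-congˡ {Q} θu ⟩
        Q * (θ⁴ + θ⁴) ≈⟨ solve 2 (λ t q → q :* (t :* t :* (t :* t) :+ t :* t :* (t :* t)) := q :* t :* (t :* (t :* t) :+ t :* (t :* t))) refl θ Q ⟩
        Q * θ * t ≈⟨ *-congʳ {t} Qθ ⟩
        (1# + 1#) * t ≈⟨ solve 1 (λ f → (con 1 :+ con 1) :* f := f :+ f) refl t ⟩
        t + t ∎

-- Triangular numbers with integer index, modulo 5

module Triangular where
  open Quaternion
  open Counting
  open Shanks using (tri)
  open Modulo5
  open import Data.Integer using (ℤ; +_; -[1+_]; -_; _+_; _*_; _-_; _/ℕ_; _%ℕ_)
  open import Data.Integer.DivMod using (a≡a%ℕn+[a/ℕn]*n; n%ℕd<d)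
  open import Data.Integer.Divisibility.Signed
  open ≡

  private
    variable
      X Y : Set

  Convolved : (ℕ → X → Set) → (ℕ → Y → Set) → ℕ → X × Y → Set
  Convolved P Q n (a , b) = ∃[ i ] ∃[ j ] (i ℕ.+ j ≡ n × P i a × Q j b)

  -- The hypothesis on P makes the index i a function of a, so the products belonging to different i
  -- are disjoint and their counts add up to the coefficient of the Cauchy product.
  counts-convolve : ∀ {P : ℕ → X → Set} {Q : ℕ → Y → Set} {f g : ℕ → ℕ} →
    (∀ i → Counts (P i) (f i)) → (∀ j → Counts (Q j) (g j)) → (∀ {i i′ a} → P i a → P i′ a → i ≡ i′) →
    ∀ n → ∃[ c ] (Counts (Convolved P Q n) c
                  × + c ≡ convolve (+_ ∘ f) (+_ ∘ g) n)
  counts-convolve {f = f} {g} CP CQ dis zero = f 0 ℕ.* g 0 ,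
    counts-⇔ (λ (p , q) → 0 , 0 , refl , p , q) (λ { (zero , zero , refl , p , q) → p , q }) (counts-× (CP 0) (CQ 0)) ,
    ℤ.pos-* (f 0) (g 0)
  counts-convolve {P = P} {Q} {f} {g} CP CQ dis (suc n)
    with c , C , eq ← counts-convolve {P = P ∘ suc} {Q} {f ∘ suc} {g} (CP ∘ suc) CQ (λ p p′ → ℕ.suc-injective (dis p p′)) n
    = f 0 ℕ.* g (suc n) ℕ.+ c ,
      counts-⇔
        [ (λ (p , q) → 0 , suc n , refl , p , q) , (λ (i , j , e , p , q) → suc i , j , cong suc e , p , q) ]′
        (λ { (zero , j , refl , p , q) → inj₁ (p , q) ; (suc i , j , refl , p , q) → inj₂ (i , j , refl , p , q) })
        (counts-⊎ (counts-× (CP 0) (CQ (suc n))) C (λ { (p , _) (i , _ , _ , p′ , _) → ℕ.0≢1+n (dis p p′) })) ,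
      trans (ℤ.pos-+ (f 0 ℕ.* g (suc n)) c) (cong₂ _+_ (ℤ.pos-* (f 0) (g (suc n))) eq)

  -- This is z(z + 1)/2: the constructor `-[1+_]` applied to k is -1 - k, the mirror image of k
  -- under the symmetry of this quadratic.
  T : ℤ → ℕ
  T (+ k) = tri k
  T -[1+ k ] = tri k

  double-tri : ∀ k → + 2 * + tri k ≡ + k * (+ k + + 1)
  double-tri zero = refl
  double-tri (suc k) = begin
    + 2 * + (suc k ℕ.+ tri k) ≡⟨ cong (+ 2 *_) (ℤ.pos-+ (suc k) (tri k)) ⟩
    + 2 * (+ suc k + + tri k) ≡⟨ ℤ.*-distribˡ-+ (+ 2) (+ suc k) (+ tri k) ⟩
    + 2 * + suc k + + 2 * + tri k ≡⟨ cong₂ (λ a b → + 2 * a + b) (ℤ.pos-+ 1 k) (double-tri k) ⟩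
    + 2 * (+ 1 + + k) + + k * (+ k + + 1) ≡⟨ lemma (+ k) ⟩
    (+ 1 + + k) * (+ 1 + + k + + 1) ≡⟨ cong (λ a → a * (a + + 1)) (sym (ℤ.pos-+ 1 k)) ⟩
    + suc k * (+ suc k + + 1) ∎
    where
    open ≡-Reasoning
    lemma : ∀ k → + 2 * (+ 1 + k) + k * (k + + 1) ≡ (+ 1 + k) * (+ 1 + k + + 1)
    lemma = solve-∀

  double-T : ∀ z → + 2 * + T z ≡ z * (z + + 1)
  double-T (+ k) = double-tri k
  double-T -[1+ k ] = trans (double-tri k) (trans (lemma (+ k)) (cong (λ a → a * (a + + 1)) (sym (ℤ.neg-suc k))))
    where
    lemma : ∀ k → k * (k + + 1) ≡ (- (+ 1) + - k) * (- (+ 1) + - k + + 1)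
    lemma = solve-∀

  T-unique : ∀ {a b} → + 2 * + a ≡ + 2 * + b → a ≡ b
  T-unique eq = ℤ.+-injective (ℤ.*-cancelˡ-≡ (+ 2) _ _ eq)

  reflect : ℤ → ℤ
  reflect z = - (+ 1) - z

  T-reflect : ∀ z → T (reflect z) ≡ T z
  T-reflect z = T-unique (trans (double-T (reflect z)) (trans (lemma z) (sym (double-T z))))
    where
    lemma : ∀ z → (- (+ 1) - z) * (- (+ 1) - z + + 1) ≡ z * (z + + 1)
    lemma = solve-∀

  -- In X = 2x + 1 and Y = 2y + 1 this is X + iY ↦ (1 + 2i)(X − iY), which multiplies the norm
  -- 8(T x + T y) + 2 by 5.
  T-dilate : ∀ x y → T (x + + 2 * y + + 1) ℕ.+ T (+ 2 * x - y) ≡ (T x ℕ.+ T y) ℕ.* 5 ℕ.+ 1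
  T-dilate x y = T-unique (begin
    + 2 * + (T x′ ℕ.+ T y′) ≡⟨ double-sum x′ y′ ⟩
    x′ * (x′ + + 1) + y′ * (y′ + + 1) ≡⟨ lemma x y ⟩
    (x * (x + + 1) + y * (y + + 1)) * + 5 + + 2 ≡⟨ cong (λ s → s * + 5 + + 2) (sym (double-sum x y)) ⟩
    + 2 * + (T x ℕ.+ T y) * + 5 + + 2 ≡⟨ lemma′ (+ (T x ℕ.+ T y)) ⟩
    + 2 * (+ (T x ℕ.+ T y) * + 5 + + 1) ≡⟨ cong (λ s → + 2 * (s + + 1)) (sym (ℤ.pos-* (T x ℕ.+ T y) 5)) ⟩
    + 2 * (+ ((T x ℕ.+ T y) ℕ.* 5) + + 1) ≡⟨ cong (+ 2 *_) (sym (ℤ.pos-+ ((T x ℕ.+ T y) ℕ.* 5) 1)) ⟩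
    + 2 * + ((T x ℕ.+ T y) ℕ.* 5 ℕ.+ 1) ∎)
    where
    open ≡-Reasoning
    x′ y′ : ℤ
    x′ = x + + 2 * y + + 1
    y′ = + 2 * x - y
    double-sum : ∀ a b → + 2 * + (T a ℕ.+ T b) ≡ a * (a + + 1) + b * (b + + 1)
    double-sum a b = trans (cong (+ 2 *_) (ℤ.pos-+ (T a) (T b)))
      (trans (ℤ.*-distribˡ-+ (+ 2) (+ T a) (+ T b)) (cong₂ _+_ (double-T a) (double-T b)))
    lemma : ∀ x y → (x + + 2 * y + + 1) * (x + + 2 * y + + 1 + + 1) + (+ 2 * x - y) * (+ 2 * x - y + + 1)
            ≡ (x * (x + + 1) + y * (y + + 1)) * + 5 + + 2
    lemma = solve-∀
    lemma′ : ∀ s → + 2 * s * + 5 + + 2 ≡ + 2 * (s * + 5 + + 1)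
    lemma′ = solve-∀

  Res : ℕ → ℤ → Set
  Res r z = ∃[ v ] z ≡ v * + 5 + + r

  residue-cases : ∀ z → Res 0 z ⊎ Res 1 z ⊎ Res 2 z ⊎ Res 3 z ⊎ Res 4 z
  residue-cases z = go (z %ℕ 5) (n%ℕd<d z 5) (trans (a≡a%ℕn+[a/ℕn]*n z 5) (ℤ.+-comm (+ (z %ℕ 5)) (z /ℕ 5 * + 5)))
    where
    go : ∀ r → r ℕ.< 5 → z ≡ z /ℕ 5 * + 5 + + r → Res 0 z ⊎ Res 1 z ⊎ Res 2 z ⊎ Res 3 z ⊎ Res 4 z
    go 0 _ eq = inj₁ (z /ℕ 5 , eq)
    go 1 _ eq = inj₂ (inj₁ (z /ℕ 5 , eq))
    go 2 _ eq = inj₂ (inj₂ (inj₁ (z /ℕ 5 , eq)))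
    go 3 _ eq = inj₂ (inj₂ (inj₂ (inj₁ (z /ℕ 5 , eq))))
    go 4 _ eq = inj₂ (inj₂ (inj₂ (inj₂ (z /ℕ 5 , eq))))
    go (suc (suc (suc (suc (suc _))))) (ℕ.s≤s (ℕ.s≤s (ℕ.s≤s (ℕ.s≤s (ℕ.s≤s ()))))) _

  residue-distinct : ∀ {z} r s → Res r z → Res s z → {False (+ 5 ∣? (+ r - + s))} → ⊥
  residue-distinct {z} r s (v , p) (w , q) {ne} = toWitnessFalse ne (divides (w - v) (begin
    + r - + s ≡⟨ l₁ v (+ r) (+ s) ⟩
    (v * + 5 + + r) - v * + 5 - + s ≡⟨ cong (λ t → t - v * + 5 - + s) (trans (sym p) q) ⟩
    (w * + 5 + + s) - v * + 5 - + s ≡⟨ l₂ v w (+ s) ⟩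
    (w - v) * + 5 ∎))
    where
    open ≡-Reasoning
    l₁ : ∀ v r s → r - s ≡ (v * + 5 + r) - v * + 5 - s
    l₁ = solve-∀
    l₂ : ∀ v w s → (w * + 5 + s) - v * + 5 - s ≡ (w - v) * + 5
    l₂ = solve-∀

  -- From 2 T z = z(z + 1), a residue k of T z and a residue r of z must satisfy 2k ≡ r(r + 1)
  -- modulo 5. For concrete r and k the implicit argument refutes this by computation.
  T-residue : ∀ {z} r k {n} → Res r z → T z ≡ n ℕ.* 5 ℕ.+ k → {False (+ 5 ∣? (+ 2 * + k - + r * (+ r + + 1)))} → ⊥
  T-residue {z} r k {n} (v , refl) eq {ne} = toWitnessFalse ne (divides (v * (v * + 5 + + 2 * + r + + 1) - + 2 * + n) (begin
    + 2 * + k - R ≡⟨ l₁ (+ k) (+ n) R ⟩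
    + 2 * (+ n * + 5 + + k) - + 2 * + n * + 5 - R ≡⟨ cong (λ t → + 2 * t - + 2 * + n * + 5 - R) (sym (trans (cong +_ eq) (trans (ℤ.pos-+ (n ℕ.* 5) k) (cong (_+ + k) (ℤ.pos-* n 5))))) ⟩
    + 2 * + T z - + 2 * + n * + 5 - R ≡⟨ cong (λ t → t - + 2 * + n * + 5 - R) (double-T z) ⟩
    z * (z + + 1) - + 2 * + n * + 5 - R ≡⟨ l₂ v (+ n) (+ r) ⟩
    (v * (v * + 5 + + 2 * + r + + 1) - + 2 * + n) * + 5 ∎))
    where
    open ≡-Reasoning
    R : ℤ
    R = + r * (+ r + + 1)
    l₁ : ∀ k n R → + 2 * k - R ≡ + 2 * (n * + 5 + k) - + 2 * n * + 5 - R
    l₁ = solve-∀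
    l₂ : ∀ v n r → (v * + 5 + r) * (v * + 5 + r + + 1) - + 2 * n * + 5 - r * (r + + 1)
         ≡ (v * (v * + 5 + + 2 * r + + 1) - + 2 * n) * + 5
    l₂ = solve-∀

  ℕ-cases : ∀ n → ∃[ i ] (n ≡ i ℕ.* 5 ℕ.+ 0 ⊎ n ≡ i ℕ.* 5 ℕ.+ 1 ⊎ n ≡ i ℕ.* 5 ℕ.+ 2 ⊎ n ≡ i ℕ.* 5 ℕ.+ 3 ⊎ n ≡ i ℕ.* 5 ℕ.+ 4)
  ℕ-cases n = n ℕ./ 5 , go (n ℕ.% 5) (ℕ.m%n<n n 5) (trans (ℕ.m≡m%n+[m/n]*n n 5) (ℕ.+-comm (n ℕ.% 5) (n ℕ./ 5 ℕ.* 5)))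
    where
    i = n ℕ./ 5
    go : ∀ r → r ℕ.< 5 → n ≡ i ℕ.* 5 ℕ.+ r →
         n ≡ i ℕ.* 5 ℕ.+ 0 ⊎ n ≡ i ℕ.* 5 ℕ.+ 1 ⊎ n ≡ i ℕ.* 5 ℕ.+ 2 ⊎ n ≡ i ℕ.* 5 ℕ.+ 3 ⊎ n ≡ i ℕ.* 5 ℕ.+ 4
    go 0 _ eq = inj₁ eq
    go 1 _ eq = inj₂ (inj₁ eq)
    go 2 _ eq = inj₂ (inj₂ (inj₁ eq))
    go 3 _ eq = inj₂ (inj₂ (inj₂ (inj₁ eq)))
    go 4 _ eq = inj₂ (inj₂ (inj₂ (inj₂ eq)))
    go (suc (suc (suc (suc (suc _))))) (ℕ.s≤s (ℕ.s≤s (ℕ.s≤s (ℕ.s≤s (ℕ.s≤s ()))))) _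

  T-Res-0 : ∀ {z} → Res 0 z → ∃[ i ] T z ≡ i ℕ.* 5 ℕ.+ 0
  T-Res-0 {z} ρ with ℕ-cases (T z)
  ... | i , inj₁ e = i , e
  ... | i , inj₂ (inj₁ e) = ⊥-elim (T-residue 0 1 {i} ρ e)
  ... | i , inj₂ (inj₂ (inj₁ e)) = ⊥-elim (T-residue 0 2 {i} ρ e)
  ... | i , inj₂ (inj₂ (inj₂ (inj₁ e))) = ⊥-elim (T-residue 0 3 {i} ρ e)
  ... | i , inj₂ (inj₂ (inj₂ (inj₂ e))) = ⊥-elim (T-residue 0 4 {i} ρ e)

  T-Res-1 : ∀ {z} → Res 1 z → ∃[ i ] T z ≡ i ℕ.* 5 ℕ.+ 1
  T-Res-1 {z} ρ with ℕ-cases (T z)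
  ... | i , inj₂ (inj₁ e) = i , e
  ... | i , inj₁ e = ⊥-elim (T-residue 1 0 {i} ρ e)
  ... | i , inj₂ (inj₂ (inj₁ e)) = ⊥-elim (T-residue 1 2 {i} ρ e)
  ... | i , inj₂ (inj₂ (inj₂ (inj₁ e))) = ⊥-elim (T-residue 1 3 {i} ρ e)
  ... | i , inj₂ (inj₂ (inj₂ (inj₂ e))) = ⊥-elim (T-residue 1 4 {i} ρ e)

  T-Res-2 : ∀ {z} → Res 2 z → ∃[ i ] T z ≡ i ℕ.* 5 ℕ.+ 3
  T-Res-2 {z} ρ with ℕ-cases (T z)
  ... | i , inj₂ (inj₂ (inj₂ (inj₁ e))) = i , e
  ... | i , inj₁ e = ⊥-elim (T-residue 2 0 {i} ρ e)
  ... | i , inj₂ (inj₁ e) = ⊥-elim (T-residue 2 1 {i} ρ e)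
  ... | i , inj₂ (inj₂ (inj₁ e)) = ⊥-elim (T-residue 2 2 {i} ρ e)
  ... | i , inj₂ (inj₂ (inj₂ (inj₂ e))) = ⊥-elim (T-residue 2 4 {i} ρ e)

  T-3⇒Res-2 : ∀ {z i} → T z ≡ i ℕ.* 5 ℕ.+ 3 → Res 2 z
  T-3⇒Res-2 {z} {i} e with residue-cases z
  ... | inj₂ (inj₂ (inj₁ ρ)) = ρ
  ... | inj₁ ρ = ⊥-elim (T-residue 0 3 {i} ρ e)
  ... | inj₂ (inj₁ ρ) = ⊥-elim (T-residue 1 3 {i} ρ e)
  ... | inj₂ (inj₂ (inj₂ (inj₁ ρ))) = ⊥-elim (T-residue 3 3 {i} ρ e)
  ... | inj₂ (inj₂ (inj₂ (inj₂ ρ))) = ⊥-elim (T-residue 4 3 {i} ρ e)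

  T-≢2 : ∀ {z i} → ¬ T z ≡ i ℕ.* 5 ℕ.+ 2
  T-≢2 {z} {i} e with residue-cases z
  ... | inj₁ ρ = T-residue 0 2 {i} ρ e
  ... | inj₂ (inj₁ ρ) = T-residue 1 2 {i} ρ e
  ... | inj₂ (inj₂ (inj₁ ρ)) = T-residue 2 2 {i} ρ e
  ... | inj₂ (inj₂ (inj₂ (inj₁ ρ))) = T-residue 3 2 {i} ρ e
  ... | inj₂ (inj₂ (inj₂ (inj₂ ρ))) = T-residue 4 2 {i} ρ e

  T-≢4 : ∀ {z i} → ¬ T z ≡ i ℕ.* 5 ℕ.+ 4
  T-≢4 {z} {i} e with residue-cases z
  ... | inj₁ ρ = T-residue 0 4 {i} ρ e
  ... | inj₂ (inj₁ ρ) = T-residue 1 4 {i} ρ e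
  ... | inj₂ (inj₂ (inj₁ ρ)) = T-residue 2 4 {i} ρ e
  ... | inj₂ (inj₂ (inj₂ (inj₁ ρ))) = T-residue 3 4 {i} ρ e
  ... | inj₂ (inj₂ (inj₂ (inj₂ ρ))) = T-residue 4 4 {i} ρ e

-- The theta series, its sections and its powers

module ThetaSeries where
  open Quaternion
  open Counting
  open Shanks using (tri)
  open Modulo5
  open Triangular
  open import Data.Integer using (ℤ; +_; -[1+_]; -_; _+_; _*_; _-_)
  open import Data.Integer.Divisibility.Signed
  open ≡

  open CommutativeRing ℤ/5 using () renaming (trans to trans₅; sym to sym₅; +-cong to +-cong₅; reflexive to reflexive₅)

  δ : ℕ → ℕ → ℕ
  δ k n with k ℕ.≟ n
  ... | yes _ = 1
  ... | no _ = 0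

  occurrences : ℕ → ℕ → ℕ
  occurrences zero n = 0
  occurrences (suc m) n = occurrences m n ℕ.+ δ (tri m) n

  counts-δ : ∀ m n → Counts (λ k → k ≡ m × tri k ≡ n) (δ (tri m) n)
  counts-δ m n with tri m ℕ.≟ n
  ... | yes eq = counts (m ∷ []) ([] ∷ []) (λ { (here refl) → refl , eq }) (λ { (refl , _) → here refl }) refl
  ... | no ¬eq = counts-∅ (λ { (refl , eq) → ¬eq eq })

  counts-occurrences : ∀ m n → Counts (λ k → k ℕ.< m × tri k ≡ n) (occurrences m n)
  counts-occurrences zero n = counts-∅ (λ ())
  counts-occurrences (suc m) n = counts-⇔
    [ (λ (lt , e) → ℕ.m≤n⇒m≤1+n lt , e) , (λ { (refl , e) → ℕ.≤-refl , e }) ]′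
    (λ (lt , e) → [ (λ l → inj₁ (l , e)) , (λ l → inj₂ (l , e)) ]′ (ℕ.m≤n⇒m<n∨m≡n (ℕ.≤-pred lt)))
    (counts-⊎ (counts-occurrences m n) (counts-δ m n) (λ { (lt , _) (refl , _) → ℕ.<-irrefl refl lt }))

  ≤-tri : ∀ k → k ℕ.≤ tri k
  ≤-tri zero = ℕ.z≤n
  ≤-tri (suc k) = ℕ.m≤m+n (suc k) (tri k)

  occurrences-stable : ∀ {m n} → n ℕ.< m → occurrences m n ≡ occurrences (suc n) n
  occurrences-stable {m} {n} n<m = counts-unique (counts-occurrences m n)
    (counts-⇔ (λ (_ , e) → ℕ.≤-<-trans (subst (_ ℕ.≤_) e (≤-tri _)) n<m , e)
              (λ (_ , e) → ℕ.s≤s (subst (_ ℕ.≤_) e (≤-tri _)) , e)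
              (counts-occurrences (suc n) n))

  -- Each k counts twice, as the integers k and -1 - k. The search may stop at k ≤ n because k ≤
  -- `tri k`.
  t : ℕ → ℕ
  t n = occurrences (suc n) n ℕ.+ occurrences (suc n) n

  counts-T : ∀ n → Counts (λ z → T z ≡ n) (t n)
  counts-T n = counts-⇔ [ (λ { (k , e , refl) → e }) , (λ { (k , e , refl) → e }) ]′
    (λ { {+ k} e → inj₁ (k , e , refl) ; { -[1+ k ]} e → inj₂ (k , e , refl) })
    (counts-⊎
      (counts-image {Q = λ z → ∃[ k ] (tri k ≡ n × + k ≡ z)} +_ tris (λ {k} e → k , e , refl) (λ _ _ → ℤ.+-injective) id)
      (counts-image {Q = λ z → ∃[ k ] (tri k ≡ n × -[1+ k ] ≡ z)} -[1+_] tris (λ {k} e → k , e , refl) (λ _ _ → ℤ.-[1+-injective) id)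
      (λ { (_ , _ , refl) (_ , _ , ()) }))
    where
    tris : Counts (λ k → tri k ≡ n) (occurrences (suc n) n)
    tris = counts-⇔ proj₂ (λ e → ℕ.s≤s (subst (_ ℕ.≤_) e (≤-tri _)) , e) (counts-occurrences (suc n) n)

  θ : Series
  θ n = + t n

  Res? : ∀ r z → Dec (Res r z)
  Res? r z = map′ (λ (divides v e) → v , trans (l₁ z (+ r)) (cong (_+ + r) e))
                  (λ (v , e) → divides v (trans (cong (_- + r) e) (l₂ (v * + 5) (+ r)))) (+ 5 ∣? (z - + r))
    where
    l₁ : ∀ z r → z ≡ (z - r) + r
    l₁ = solve-∀
    l₂ : ∀ w r → (w + r) - r ≡ w
    l₂ = solve-∀

  InClass : ℕ → ℕ → ℕ → ℤ → Set
  InClass k r n z = T z ≡ n ℕ.* 5 ℕ.+ k × Res r z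

  counts-class : ∀ k r n → ∃[ c ] Counts (InClass k r n) c
  counts-class k r n = counts-filter (Res? r) (counts-T (n ℕ.* 5 ℕ.+ k))

  class : ℕ → ℕ → Series
  class k r n = + proj₁ (counts-class k r n)

  reflect-reflect : ∀ z → reflect (reflect z) ≡ z
  reflect-reflect = lemma
    where
    lemma : ∀ z → - (+ 1) - (- (+ 1) - z) ≡ z
    lemma = solve-∀

  -- From -1 - (5v + r) = 5(-1 - v) + (4 - r): the reflection swaps the classes 0 and 4, swaps 1 and
  -- 3, and fixes 2.
  Res-reflect : ∀ {r s z} → + r + + s ≡ + 4 → Res r z → Res s (reflect z)
  Res-reflect {r} {s} eq (v , refl) = reflect v , trans (l v (+ r) (+ s))
      (trans (cong (λ q → (- (+ 1) - v) * + 5 + + s + (+ 4 - q)) eq) (l′ ((- (+ 1) - v) * + 5) (+ s)))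
    where
    l : ∀ v r s → - (+ 1) - (v * + 5 + r) ≡ (- (+ 1) - v) * + 5 + s + (+ 4 - (r + s))
    l = solve-∀
    l′ : ∀ w s → w + s + (+ 4 - + 4) ≡ w + s
    l′ = solve-∀

  counts-reflect : ∀ {k r s n c} → + r + + s ≡ + 4 → Counts (InClass k r n) c → Counts (InClass k s n) c
  counts-reflect {k} {r} {s} {n} eq C = counts-image {Q = InClass k s n} reflect C
    (λ {z} (e , ρ) → trans (T-reflect z) e , Res-reflect {r} {s} eq ρ)
    (λ {z} {z′} _ _ e → trans (sym (reflect-reflect z)) (trans (cong reflect e) (reflect-reflect z′)))
    (λ {z} (e , ρ) → reflect z , (trans (T-reflect z) e , Res-reflect {s} {r} (trans (ℤ.+-comm (+ s) (+ r)) eq) ρ) , reflect-reflect z)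

  α β : Series
  α = class 0 0
  β = class 1 1

  θ₀ : section 0 θ A.≈ α A.+ α
  θ₀ n = reflexive₅ (cong +_ (counts-unique (counts-T (n ℕ.* 5 ℕ.+ 0))
    (counts-⇔ [ proj₁ , proj₁ ]′ cases
      (counts-⊎ C (counts-reflect {0} {0} {4} {n} refl C) (λ (_ , ρ) (_ , ρ′) → residue-distinct 0 4 ρ ρ′)))))
    where
    C : Counts (InClass 0 0 n) (proj₁ (counts-class 0 0 n))
    C = proj₂ (counts-class 0 0 n)
    cases : ∀ {z} → T z ≡ n ℕ.* 5 ℕ.+ 0 → InClass 0 0 n z ⊎ InClass 0 4 n z
    cases {z} e with residue-cases z
    ... | inj₁ ρ = inj₁ (e , ρ)
    ... | inj₂ (inj₁ ρ) = ⊥-elim (T-residue 1 0 {n} ρ e)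
    ... | inj₂ (inj₂ (inj₁ ρ)) = ⊥-elim (T-residue 2 0 {n} ρ e)
    ... | inj₂ (inj₂ (inj₂ (inj₁ ρ))) = ⊥-elim (T-residue 3 0 {n} ρ e)
    ... | inj₂ (inj₂ (inj₂ (inj₂ ρ))) = inj₂ (e , ρ)

  θ₁ : section 1 θ A.≈ β A.+ β
  θ₁ n = reflexive₅ (cong +_ (counts-unique (counts-T (n ℕ.* 5 ℕ.+ 1))
    (counts-⇔ [ proj₁ , proj₁ ]′ cases
      (counts-⊎ C (counts-reflect {1} {1} {3} {n} refl C) (λ (_ , ρ) (_ , ρ′) → residue-distinct 1 3 ρ ρ′)))))
    where
    C : Counts (InClass 1 1 n) (proj₁ (counts-class 1 1 n))
    C = proj₂ (counts-class 1 1 n)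
    cases : ∀ {z} → T z ≡ n ℕ.* 5 ℕ.+ 1 → InClass 1 1 n z ⊎ InClass 1 3 n z
    cases {z} e with residue-cases z
    ... | inj₁ ρ = ⊥-elim (T-residue 0 1 {n} ρ e)
    ... | inj₂ (inj₁ ρ) = inj₁ (e , ρ)
    ... | inj₂ (inj₂ (inj₁ ρ)) = ⊥-elim (T-residue 2 1 {n} ρ e)
    ... | inj₂ (inj₂ (inj₂ (inj₁ ρ))) = inj₂ (e , ρ)
    ... | inj₂ (inj₂ (inj₂ (inj₂ ρ))) = ⊥-elim (T-residue 4 1 {n} ρ e)

  θ₂ : section 2 θ A.≈ A.0#
  θ₂ n = reflexive₅ (cong +_ (counts-unique (counts-T (n ℕ.* 5 ℕ.+ 2)) (counts-∅ (λ {z} → T-≢2 {z} {n}))))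

  θ₄ : section 4 θ A.≈ A.0#
  θ₄ n = reflexive₅ (cong +_ (counts-unique (counts-T (n ℕ.* 5 ℕ.+ 4)) (counts-∅ (λ {z} → T-≢4 {z} {n}))))

  PairSum : ℕ → ℤ × ℤ → Set
  PairSum n (y , z) = T y ℕ.+ T z ≡ n

  counts-pairs : ∀ n → ∃[ c ] (Counts (PairSum n) c × + c ≡ (θ A.* θ) n)
  counts-pairs n =
    let c , C , e = counts-convolve {P = λ i y → T y ≡ i} {λ j z → T z ≡ j} counts-T counts-T (λ p q → trans (sym p) q) n
    in c , counts-⇔ (λ { (i , j , s , refl , refl) → s }) (λ { {y , z} s → T y , T z , s , refl , refl }) C , e

  Dilated : ℕ → ℕ → ℕ → ℤ × ℤ → Set
  Dilated r s n (y , z) = (Res r y × Res s z) × T y ℕ.+ T z ≡ n ℕ.* 5 ℕ.+ 1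

  regroup : ∀ i j → i ℕ.* 5 ℕ.+ 0 ℕ.+ (j ℕ.* 5 ℕ.+ 1) ≡ (i ℕ.+ j) ℕ.* 5 ℕ.+ 1
  regroup = ℕ.+-*-Solver.solve 2 (λ i j → i :* con 5 :+ con 0 :+ (j :* con 5 :+ con 1) := (i :+ j) :* con 5 :+ con 1) refl
    where open ℕ.+-*-Solver

  regroup′ : ∀ i j → i ℕ.* 5 ℕ.+ 3 ℕ.+ (j ℕ.* 5 ℕ.+ 3) ≡ suc (i ℕ.+ j) ℕ.* 5 ℕ.+ 1
  regroup′ = ℕ.+-*-Solver.solve 2 (λ i j → i :* con 5 :+ con 3 :+ (j :* con 5 :+ con 3) := (con 1 :+ (i :+ j)) :* con 5 :+ con 1) refl
    where open ℕ.+-*-Solver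

  *5+1-injective : ∀ {i j} → i ℕ.* 5 ℕ.+ 1 ≡ j ℕ.* 5 ℕ.+ 1 → i ≡ j
  *5+1-injective {i} {j} e = ℕ.*-cancelʳ-≡ i j 5 (ℕ.+-cancelʳ-≡ 1 (i ℕ.* 5) (j ℕ.* 5) e)

  *5+-injective : ∀ {i j k} → i ℕ.* 5 ℕ.+ k ≡ j ℕ.* 5 ℕ.+ k → i ≡ j
  *5+-injective {i} {j} {k} e = ℕ.*-cancelʳ-≡ i j 5 (ℕ.+-cancelʳ-≡ k (i ℕ.* 5) (j ℕ.* 5) e)

  counts-αβ : ∀ n → ∃[ c ] (Counts (Dilated 0 1 n) c × + c ≡ (α A.* β) n)
  counts-αβ n =
    let c , C , e = counts-convolve (proj₂ ∘ counts-class 0 0) (proj₂ ∘ counts-class 1 1)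
                      (λ (p , _) (q , _) → *5+-injective {k = 0} (trans (sym p) q)) n
    in c , counts-⇔ to from C , e
    where
    to : ∀ {yz} → Convolved (InClass 0 0) (InClass 1 1) n yz → Dilated 0 1 n yz
    to {y , z} (i , j , s , (e , ρ) , (e′ , ρ′)) =
      (ρ , ρ′) , trans (cong₂ ℕ._+_ e e′) (trans (regroup i j) (cong (λ m → m ℕ.* 5 ℕ.+ 1) s))
    from : ∀ {yz} → Dilated 0 1 n yz → Convolved (InClass 0 0) (InClass 1 1) n yz
    from {y , z} ((ρ , ρ′) , s) =
      let i , e = T-Res-0 ρ
          j , e′ = T-Res-1 ρ′
      in i , j , *5+1-injective (trans (sym (regroup i j)) (trans (sym (cong₂ ℕ._+_ e e′)) s)) , (e , ρ) , (e′ , ρ′)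

  -- Both T y and T z are 3 modulo 5, and 3 + 3 = 5 + 1; the carry is the factor x. It also leaves
  -- nothing at degree 0.
  counts-cc : ∀ n → ∃[ c ] (Counts (Dilated 2 2 n) c × + c ≡₅ (x A.* (section 3 θ A.* section 3 θ)) n)
  counts-cc zero = 0 , counts-∅ none , sym₅ (x-zero (section 3 θ A.* section 3 θ))
    where
    none : ∀ {yz} → ¬ Dilated 2 2 0 yz
    none {y , z} ((ρ , ρ′) , s) =
      let i , e = T-Res-2 ρ
          j , e′ = T-Res-2 ρ′
      in ℕ.0≢1+n (*5+1-injective {0} {suc (i ℕ.+ j)} (trans (sym s) (trans (cong₂ ℕ._+_ e e′) (regroup′ i j))))
  counts-cc (suc n) =
    let c , C , e = counts-convolve {P = λ i y → T y ≡ i ℕ.* 5 ℕ.+ 3} {λ i y → T y ≡ i ℕ.* 5 ℕ.+ 3}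
                      (λ i → counts-T (i ℕ.* 5 ℕ.+ 3)) (λ i → counts-T (i ℕ.* 5 ℕ.+ 3))
                      (λ p q → *5+-injective {k = 3} (trans (sym p) q)) n
    in c , counts-⇔ to from C , trans₅ (reflexive₅ e) (sym₅ (x-suc (section 3 θ A.* section 3 θ) n))
    where
    to : ∀ {yz} → Convolved (λ i y → T y ≡ i ℕ.* 5 ℕ.+ 3) (λ i y → T y ≡ i ℕ.* 5 ℕ.+ 3) n yz → Dilated 2 2 (suc n) yz
    to {y , z} (i , j , s , e , e′) =
      (T-3⇒Res-2 {i = i} e , T-3⇒Res-2 {i = j} e′) , trans (cong₂ ℕ._+_ e e′) (trans (regroup′ i j) (cong (λ m → suc m ℕ.* 5 ℕ.+ 1) s))
    from : ∀ {yz} → Dilated 2 2 (suc n) yz → Convolved (λ i y → T y ≡ i ℕ.* 5 ℕ.+ 3) (λ i y → T y ≡ i ℕ.* 5 ℕ.+ 3) n yz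
    from {y , z} ((ρ , ρ′) , s) =
      let i , e = T-Res-2 ρ
          j , e′ = T-Res-2 ρ′
      in i , j , ℕ.suc-injective (*5+1-injective {suc (i ℕ.+ j)} {suc n} (trans (sym (regroup′ i j)) (trans (sym (cong₂ ℕ._+_ e e′)) s))) , e , e′

  dilate : ℤ × ℤ → ℤ × ℤ
  dilate (x , y) = x + + 2 * y + + 1 , + 2 * x - y

  -- The image of `dilate`. In odd coordinates X = 2x′ + 1 and Y = 2y′ + 1 it is Y ≡ 2X modulo 5,
  -- the divisibility of X + iY by 1 + 2i.
  Dilation : ℤ × ℤ → Set
  Dilation (x′ , y′) = ∃[ w ] y′ ≡ + 2 * x′ - + 2 + w * + 5

  dilate-image : ∀ x y → Dilation (dilate (x , y))
  dilate-image x y = - y , lemma x y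
    where
    lemma : ∀ x y → + 2 * x - y ≡ + 2 * (x + + 2 * y + + 1) - + 2 + - y * + 5
    lemma = solve-∀

  dilate-surjective : ∀ {p} → Dilation p → ∃[ q ] dilate q ≡ p
  dilate-surjective {x′ , _} (w , refl) = (x′ + + 2 * w - + 1 , - w) , cong₂ _,_ (l₁ x′ w) (l₂ x′ w)
    where
    l₁ : ∀ x w → x + + 2 * w - + 1 + + 2 * - w + + 1 ≡ x
    l₁ = solve-∀
    l₂ : ∀ x w → + 2 * (x + + 2 * w - + 1) - - w ≡ + 2 * x - + 2 + w * + 5
    l₂ = solve-∀

  dilate-injective : ∀ {p q} → dilate p ≡ dilate q → p ≡ q
  dilate-injective {x , y} {x₂ , y₂} eq = cong₂ _,_
    (ℤ.*-cancelˡ-≡ (+ 5) x x₂ (trans (l₁ x y) (trans (cong₂ (λ a b → a + + 2 * b - + 1) e₁ e₂) (sym (l₁ x₂ y₂)))))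
    (ℤ.*-cancelˡ-≡ (+ 5) y y₂ (trans (l₂ x y) (trans (cong₂ (λ a b → + 2 * a - b - + 2) e₁ e₂) (sym (l₂ x₂ y₂)))))
    where
    e₁ = cong proj₁ eq
    e₂ = cong proj₂ eq
    l₁ : ∀ x y → + 5 * x ≡ x + + 2 * y + + 1 + + 2 * (+ 2 * x - y) - + 1
    l₁ = solve-∀
    l₂ : ∀ x y → + 5 * y ≡ + 2 * (x + + 2 * y + + 1) - (+ 2 * x - y) - + 2
    l₂ = solve-∀

  Part : ℕ → ℕ → ℤ × ℤ → Set
  Part n r p = PairSum n p × Res r (proj₁ (dilate p))

  Tsum : ℤ × ℤ → ℕ
  Tsum (y , z) = T y ℕ.+ T z

  -- On the image of `dilate` the residue r of the first coordinate fixes that of the second. N is a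
  -- symmetry of T y + T z, composed of swaps and reflections, that moves this pair of residues to
  -- (a, b), and M undoes it; so N after `dilate` is a bijection from sums n to sums 5n + 1 in the
  -- class (a, b).
  part-count : ∀ {n k l} r a b (N M : ℤ × ℤ → ℤ × ℤ) → (∀ p → M (N p) ≡ p) → (∀ p → N (M p) ≡ p) →
    (∀ p → Tsum (N p) ≡ Tsum p) →
    (∀ {x′ y′} → Res r x′ → Dilation (x′ , y′) → Res a (proj₁ (N (x′ , y′))) × Res b (proj₂ (N (x′ , y′)))) →
    (∀ {y z} → Res a y → Res b z → Res r (proj₁ (M (y , z))) × Dilation (M (y , z))) →
    Counts (Part n r) k → Counts (Dilated a b n) l → k ≡ l
  part-count {n} r a b N M MN NM TN to from Ck Cl = counts-bij (λ p q → N (dilate p) ≡ q) Ck Cl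
    (λ {(y , z)} (s , ρ) → N (dilate (y , z)) ,
      (to ρ (dilate-image y z) , trans (TN (dilate (y , z))) (trans (T-dilate y z) (cong (λ m → m ℕ.* 5 ℕ.+ 1) s))) , refl)
    (λ {(y , z)} ((ρ , σ) , s) →
      let ρ′ , δ′ = from ρ σ
          (y₂ , z₂) , e = dilate-surjective δ′
          N-e = trans (cong N e) (NM (y , z))
      in (y₂ , z₂) ,
         (*5+1-injective (trans (sym (T-dilate y₂ z₂)) (trans (sym (TN (dilate (y₂ , z₂)))) (trans (cong Tsum N-e) s))) ,
          subst (λ p → Res r (proj₁ p)) (sym e) ρ′) , N-e)
    (λ {p} {p′} _ _ e e′ → dilate-injective (trans (sym (MN (dilate p))) (trans (cong M (trans e (sym e′))) (MN (dilate p′)))))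
    (λ _ _ e e′ → trans (sym e) e′)

  private
    r₁ : ℤ × ℤ → ℤ × ℤ
    r₁ (y , z) = reflect y , z
    r₂ : ℤ × ℤ → ℤ × ℤ
    r₂ (y , z) = y , reflect z
    sw : ℤ × ℤ → ℤ × ℤ
    sw (y , z) = z , y
    rsw : ℤ × ℤ → ℤ × ℤ
    rsw (y , z) = reflect z , reflect y

  part-0 : ∀ {n k l} → Counts (Part n 0) k → Counts (Dilated 0 1 n) l → k ≡ l
  part-0 = part-count 0 0 1 r₂ r₂ (λ (y , z) → cong (y ,_) (reflect-reflect z)) (λ (y , z) → cong (y ,_) (reflect-reflect z))
    (λ (y , z) → cong (T y ℕ.+_) (T-reflect z))
    (λ { ρ@(v , refl) (w , refl) → ρ , reflect (+ 2 * v + w) + + 1 , l₁ v w })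
    (λ { ρ@(v , refl) (w , refl) → ρ , - (+ 2 * v) - w , l₂ v w })
    where
    l₁ : ∀ v w → - (+ 1) - (+ 2 * (v * + 5 + + 0) - + 2 + w * + 5) ≡ (- (+ 1) - (+ 2 * v + w) + + 1) * + 5 + + 1
    l₁ = solve-∀
    l₂ : ∀ v w → - (+ 1) - (w * + 5 + + 1) ≡ + 2 * (v * + 5 + + 0) - + 2 + (- (+ 2 * v) - w) * + 5
    l₂ = solve-∀

  part-1 : ∀ {n k l} → Counts (Part n 1) k → Counts (Dilated 0 1 n) l → k ≡ l
  part-1 = part-count 1 0 1 sw sw (λ _ → refl) (λ _ → refl) (λ (y , z) → ℕ.+-comm (T z) (T y))
    (λ { ρ@(v , refl) (w , refl) → (+ 2 * v + w , l₁ v w) , ρ })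
    (λ { (v , refl) ρ@(w , refl) → ρ , v - + 2 * w , l₂ v w })
    where
    l₁ : ∀ v w → + 2 * (v * + 5 + + 1) - + 2 + w * + 5 ≡ (+ 2 * v + w) * + 5 + + 0
    l₁ = solve-∀
    l₂ : ∀ v w → v * + 5 + + 0 ≡ + 2 * (w * + 5 + + 1) - + 2 + (v - + 2 * w) * + 5
    l₂ = solve-∀

  part-2 : ∀ {n k l} → Counts (Part n 2) k → Counts (Dilated 2 2 n) l → k ≡ l
  part-2 = part-count 2 2 2 id id (λ _ → refl) (λ _ → refl) (λ _ → refl)
    (λ { ρ@(v , refl) (w , refl) → ρ , (+ 2 * v + w , l₁ v w) })
    (λ { ρ@(v , refl) (w , refl) → ρ , w - + 2 * v , l₂ v w })
    where
    l₁ : ∀ v w → + 2 * (v * + 5 + + 2) - + 2 + w * + 5 ≡ (+ 2 * v + w) * + 5 + + 2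
    l₁ = solve-∀
    l₂ : ∀ v w → w * + 5 + + 2 ≡ + 2 * (v * + 5 + + 2) - + 2 + (w - + 2 * v) * + 5
    l₂ = solve-∀

  part-3 : ∀ {n k l} → Counts (Part n 3) k → Counts (Dilated 0 1 n) l → k ≡ l
  part-3 = part-count 3 0 1 rsw rsw (λ (y , z) → cong₂ _,_ (reflect-reflect y) (reflect-reflect z))
    (λ (y , z) → cong₂ _,_ (reflect-reflect y) (reflect-reflect z))
    (λ (y , z) → trans (cong₂ ℕ._+_ (T-reflect z) (T-reflect y)) (ℕ.+-comm (T z) (T y)))
    (λ { (v , refl) (w , refl) → (- (+ 1) - + 2 * v - w , l₁ v w) , Res-reflect {3} {1} refl (v , refl) })
    (λ { (v , refl) (w , refl) → Res-reflect {1} {3} refl (w , refl) , - v + + 2 * w + + 1 , l₂ v w })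
    where
    l₁ : ∀ v w → - (+ 1) - (+ 2 * (v * + 5 + + 3) - + 2 + w * + 5) ≡ (- (+ 1) - + 2 * v - w) * + 5 + + 0
    l₁ = solve-∀
    l₂ : ∀ v w → - (+ 1) - (v * + 5 + + 0) ≡ + 2 * (- (+ 1) - (w * + 5 + + 1)) - + 2 + (- v + + 2 * w + + 1) * + 5
    l₂ = solve-∀

  part-4 : ∀ {n k l} → Counts (Part n 4) k → Counts (Dilated 0 1 n) l → k ≡ l
  part-4 = part-count 4 0 1 r₁ r₁ (λ (y , z) → cong (_, z) (reflect-reflect y)) (λ (y , z) → cong (_, z) (reflect-reflect y))
    (λ (y , z) → cong (ℕ._+ T z) (T-reflect y))
    (λ { (v , refl) (w , refl) → Res-reflect {4} {0} refl (v , refl) , (+ 2 * v + w + + 1 , l₁ v w) })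
    (λ { (v , refl) (w , refl) → Res-reflect {0} {4} refl (v , refl) , w + + 2 * v + + 1 , l₂ v w })
    where
    l₁ : ∀ v w → + 2 * (v * + 5 + + 4) - + 2 + w * + 5 ≡ (+ 2 * v + w + + 1) * + 5 + + 1
    l₁ = solve-∀
    l₂ : ∀ v w → w * + 5 + + 1 ≡ + 2 * (- (+ 1) - (v * + 5 + + 0)) - + 2 + (w + + 2 * v + + 1) * + 5
    l₂ = solve-∀

  -- Dilated pairs have residues (0, 3), (1, 0), (2, 2), (3, 4) or (4, 1) modulo 5. Swapping and
  -- reflecting coordinates carries all but (2, 2) to (0, 1), hence four copies of the count for αβ
  -- and one for c².
  pairs-split : ∀ {n s ab cc} → Counts (PairSum n) s → Counts (Dilated 0 1 n) ab → Counts (Dilated 2 2 n) cc →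
                s ≡ ab ℕ.+ ab ℕ.+ (ab ℕ.+ ab) ℕ.+ cc
  pairs-split {n} {s} {ab} {cc} S AB CC = counts-unique S (counts-⇔ (λ {p} → to {p}) (λ {p} → from {p})
    (counts-⊎ (counts-⊎ (counts-⊎ (part 0 part-0) (part 1 part-1) (λ (_ , ρ) (_ , σ) → residue-distinct 0 1 ρ σ))
                        (counts-⊎ (part 3 part-3) (part 4 part-4) (λ (_ , ρ) (_ , σ) → residue-distinct 3 4 ρ σ))
                        (λ { (inj₁ (_ , ρ)) (inj₁ (_ , σ)) → residue-distinct 0 3 ρ σ
                           ; (inj₁ (_ , ρ)) (inj₂ (_ , σ)) → residue-distinct 0 4 ρ σ
                           ; (inj₂ (_ , ρ)) (inj₁ (_ , σ)) → residue-distinct 1 3 ρ σ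
                           ; (inj₂ (_ , ρ)) (inj₂ (_ , σ)) → residue-distinct 1 4 ρ σ }))
              (counts-≡ (part-2 (proj₂ (sub 2)) CC) (proj₂ (sub 2)))
              (λ { (inj₁ (inj₁ (_ , ρ))) (_ , σ) → residue-distinct 0 2 ρ σ
                 ; (inj₁ (inj₂ (_ , ρ))) (_ , σ) → residue-distinct 1 2 ρ σ
                 ; (inj₂ (inj₁ (_ , ρ))) (_ , σ) → residue-distinct 3 2 ρ σ
                 ; (inj₂ (inj₂ (_ , ρ))) (_ , σ) → residue-distinct 4 2 ρ σ })))
    where
    sub : ∀ r → ∃[ k ] Counts (Part n r) k
    sub r = counts-filter (λ p → Res? r (proj₁ (dilate p))) S
    part : ∀ r → (∀ {k} → Counts (Part n r) k → Counts (Dilated 0 1 n) ab → k ≡ ab) → Counts (Part n r) ab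
    part r f = counts-≡ (f (proj₂ (sub r)) AB) (proj₂ (sub r))
    to : ∀ {p} → ((Part n 0 p ⊎ Part n 1 p) ⊎ (Part n 3 p ⊎ Part n 4 p)) ⊎ Part n 2 p → PairSum n p
    to (inj₁ (inj₁ (inj₁ (s , _)))) = s
    to (inj₁ (inj₁ (inj₂ (s , _)))) = s
    to (inj₁ (inj₂ (inj₁ (s , _)))) = s
    to (inj₁ (inj₂ (inj₂ (s , _)))) = s
    to (inj₂ (s , _)) = s
    from : ∀ {p} → PairSum n p → ((Part n 0 p ⊎ Part n 1 p) ⊎ (Part n 3 p ⊎ Part n 4 p)) ⊎ Part n 2 p
    from {p} s with residue-cases (proj₁ (dilate p))
    ... | inj₁ ρ = inj₁ (inj₁ (inj₁ (s , ρ)))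
    ... | inj₂ (inj₁ ρ) = inj₁ (inj₁ (inj₂ (s , ρ)))
    ... | inj₂ (inj₂ (inj₁ ρ)) = inj₂ (s , ρ)
    ... | inj₂ (inj₂ (inj₂ (inj₁ ρ))) = inj₁ (inj₂ (inj₁ (s , ρ)))
    ... | inj₂ (inj₂ (inj₂ (inj₂ ρ))) = inj₁ (inj₂ (inj₂ (s , ρ)))

  θ² : θ A.* θ A.≈ α A.* β A.+ α A.* β A.+ (α A.* β A.+ α A.* β) A.+ x A.* (section 3 θ A.* section 3 θ)
  θ² n =
    let s , S , es = counts-pairs n
        ab , AB , eab = counts-αβ n
        cc , CC , ecc = counts-cc n
        q = reflexive₅ eab
    in trans₅ (reflexive₅ (trans (sym es) (trans (cong +_ (pairs-split S AB CC)) (split ab cc))))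
         (+-cong₅ (+-cong₅ (+-cong₅ q q) (+-cong₅ q q)) ecc)
    where
    split : ∀ a c → + (a ℕ.+ a ℕ.+ (a ℕ.+ a) ℕ.+ c) ≡ + a + + a + (+ a + + a) + + c
    split a c = trans (ℤ.pos-+ (a ℕ.+ a ℕ.+ (a ℕ.+ a)) c) (cong (_+ + c) (ℤ.pos-+ (a ℕ.+ a) (a ℕ.+ a)))

  TripleSum : ℕ → ℤ × ℤ × ℤ → Set
  TripleSum n (a , b , c) = T a ℕ.+ (T b ℕ.+ T c) ≡ n

  counts-triples : ∀ n → ∃[ c ] (Counts (TripleSum n) c × + c ≡₅ (θ A.* (θ A.* θ)) n)
  counts-triples n =
    let c , C , e = counts-convolve {P = λ i y → T y ≡ i} {PairSum} counts-T (proj₁ ∘ proj₂ ∘ counts-pairs) (λ p q → trans (sym p) q) n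
    in c , counts-⇔ (λ { (i , j , s , refl , refl) → s }) (λ { {a , b , c} s → T a , T b ℕ.+ T c , s , refl , refl }) C ,
       trans₅ (reflexive₅ e) (convolve-cong (λ _ → reflexive₅ refl) (λ j → reflexive₅ (proj₂ (proj₂ (counts-pairs j)))) n)

-- The generating function of pod and Gauss' identity

module Gauss where
  open Counting
  open Shanks using (tri; module Identity)
  open Modulo5
  open ThetaSeries
  open import Data.Integer using (ℤ; +_; -_; _+_; _*_)
  open import Data.List.Properties using (filter-accept; filter-reject)
  open import Data.List.Relation.Unary.Linked using (Linked; [])
  open import Data.List.Relation.Unary.Linked.Properties using (Linked⇒AllPairs; AllPairs⇒Linked)
  open import Data.Nat using (_≤_; _<_; _≥_)
  open import Data.Nat.Divisibility using (_∣_)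
  open ≡

  open CommutativeRing ℤ/5 using () renaming (trans to trans₅; sym to sym₅; +-cong to +-cong₅; *-cong to *-cong₅; reflexive to reflexive₅)
  open Algebra.Properties.Semiring.Exp A.semiring using () renaming (_^_ to _^ₛ_)

  -- A bound on the parts truncates the generating product; at k = 2s there remain the factors (1 +
  -- q^(2i-1))/(1 - q^(2i)) with i ≤ s.
  BoundedPod : ℕ → ℕ → List ℕ → Set
  BoundedPod k n xs = IsPodPartition n xs × All (_≤ k) xs

  counts-pod : ∀ n → Counts (IsPodPartition n) (pod n)
  counts-pod n = counts (podPartitions n) (podPartitions-unique n)
    (Equivalence.to (podPartitions-complete n)) (Equivalence.from (podPartitions-complete n)) refl

  opaque
    counts-boundedPod : ∀ k n → ∃[ c ] Counts (BoundedPod k n) c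
    counts-boundedPod k n = counts-filter (all? (ℕ._≤? k)) (counts-pod n)

  boundedPod : ℕ → ℕ → ℕ
  boundedPod k n = proj₁ (counts-boundedPod k n)

  boundedPod-counts : ∀ k n → Counts (BoundedPod k n) (boundedPod k n)
  boundedPod-counts k n = proj₂ (counts-boundedPod k n)

  sum-bounds : ∀ xs → All (_≤ sum xs) xs
  sum-bounds [] = []
  sum-bounds (x ∷ xs) = ℕ.m≤m+n x (sum xs) ∷ All.map (λ y≤ → ℕ.≤-trans y≤ (ℕ.m≤n+m (sum xs) x)) (sum-bounds xs)

  boundedPod-pod : ∀ {k n} → n ≤ k → boundedPod k n ≡ pod n
  boundedPod-pod {k} {n} n≤k = counts-unique (boundedPod-counts k n) (counts-⇔
    (λ { {xs} h@(isPartition _ _ refl , _) → h , All.map (λ y≤ → ℕ.≤-trans y≤ n≤k) (sum-bounds xs) }) proj₁ (counts-pod n))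

  boundedPod-0-0 : boundedPod 0 0 ≡ 1
  boundedPod-0-0 = counts-unique (boundedPod-counts 0 0) (counts ([] ∷ []) ([] ∷ [])
    (λ { (here refl) → (isPartition [] [] refl , []) , [] }) empty refl)
    where
    empty : ∀ {xs} → BoundedPod 0 0 xs → xs ∈ [] ∷ []
    empty {[]} _ = here refl
    empty {_ ∷ _} ((isPartition _ (0<x ∷ _) _ , _) , x≤0 ∷ _) = ⊥-elim (ℕ.<⇒≱ 0<x x≤0)

  boundedPod-0-suc : ∀ n → boundedPod 0 (suc n) ≡ 0
  boundedPod-0-suc n = counts-unique (boundedPod-counts 0 (suc n)) (counts-∅ none)
    where
    none : ∀ {xs} → ¬ BoundedPod 0 (suc n) xs
    none {[]} ((isPartition _ _ () , _) , _)
    none {_ ∷ _} ((isPartition _ (0<x ∷ _) _ , _) , x≤0 ∷ _) = ℕ.<⇒≱ 0<x x≤0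

  ≥-trans : ∀ {i j k} → i ≥ j → j ≥ k → i ≥ k
  ≥-trans p q = ℕ.≤-trans q p

  uncons : ∀ {x xs} → Linked _≥_ (x ∷ xs) → All (_≤ x) xs × Linked _≥_ xs
  uncons l with Linked⇒AllPairs ≥-trans l
  ... | ps ∷ pss = ps , AllPairs⇒Linked pss

  cons : ∀ {x xs} → All (_≤ x) xs → Linked _≥_ xs → Linked _≥_ (x ∷ xs)
  cons ps l = AllPairs⇒Linked (ps ∷ Linked⇒AllPairs ≥-trans l)

  TopPart : ℕ → ℕ → List ℕ → Set
  TopPart k n xs = BoundedPod (suc k) n xs × ∃[ ys ] xs ≡ suc k ∷ ys

  boundedPod-split : ∀ {k n c} → Counts (TopPart k n) c → boundedPod (suc k) n ≡ boundedPod k n ℕ.+ c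
  boundedPod-split {k} {n} C = counts-unique (boundedPod-counts (suc k) n) (counts-⇔ to from
    (counts-⊎ (boundedPod-counts k n) C (λ { (_ , 1+k≤k ∷ _) (_ , _ , refl) → ℕ.1+n≰n 1+k≤k })))
    where
    to : ∀ {xs} → BoundedPod k n xs ⊎ TopPart k n xs → BoundedPod (suc k) n xs
    to (inj₁ (h , b)) = h , All.map ℕ.m≤n⇒m≤1+n b
    to (inj₂ (h , _)) = h
    from : ∀ {xs} → BoundedPod (suc k) n xs → BoundedPod k n xs ⊎ TopPart k n xs
    from {[]} (h , []) = inj₁ (h , [])
    from {x ∷ xs} (h@(isPartition l _ _ , _) , x≤ ∷ b) with ℕ.m≤n⇒m<n∨m≡n x≤
    ... | inj₁ x<1+k = inj₁ (h , ℕ.≤-pred x<1+k ∷ All.map (λ y≤x → ℕ.≤-trans y≤x (ℕ.≤-pred x<1+k)) (proj₁ (uncons l)))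
    ... | inj₂ refl = inj₂ ((h , x≤ ∷ b) , xs , refl)

  boundedPod-< : ∀ {k n} → n < suc k → boundedPod (suc k) n ≡ boundedPod k n
  boundedPod-< {k} {n} n<1+k = trans (boundedPod-split (counts-∅ none)) (ℕ.+-identityʳ _)
    where
    none : ∀ {xs} → ¬ TopPart k n xs
    none (((isPartition _ _ refl , _) , _) , ys , refl) = ℕ.<⇒≱ n<1+k (ℕ.m≤m+n (suc k) (sum ys))

  -- One part k + 1 is removed. The rest is bounded by k + 1 if that part may repeat and by k if it
  -- may not; the two hypotheses hide this difference in l.
  counts-top : ∀ {k m l} → (∀ {ys} → OddPartsDistinct (suc k ∷ ys) → All (_≤ suc k) ys → OddPartsDistinct ys × All (_≤ l) ys) →
               (∀ {ys} → OddPartsDistinct ys → All (_≤ l) ys → OddPartsDistinct (suc k ∷ ys) × All (_≤ suc k) ys) →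
               Counts (TopPart k (suc k ℕ.+ m)) (boundedPod l m)
  counts-top {k} {m} {l} down up = counts-image {Q = TopPart k (suc k ℕ.+ m)} (suc k ∷_) (boundedPod-counts l m)
    (λ {ys} ((isPartition d p s , o) , b) →
      let o′ , b′ = up o b
      in ((isPartition (cons b′ d) (ℕ.s≤s ℕ.z≤n ∷ p) (cong (suc k ℕ.+_) s) , o′) , ℕ.≤-refl ∷ b′) , ys , refl)
    (λ { _ _ refl → refl })
    (λ { (((isPartition d (_ ∷ p) s , o) , _ ∷ b) , ys , refl) →
      let o′ , b′ = down o b
      in ys , ((isPartition (proj₂ (uncons d)) p (ℕ.+-cancelˡ-≡ (suc k) (sum ys) m s) , o′) , b′) , refl })

  boundedPod-even : ∀ {k} → 2 ∣ suc k → ∀ m →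
                    boundedPod (suc k) (suc k ℕ.+ m) ≡ boundedPod k (suc k ℕ.+ m) ℕ.+ boundedPod (suc k) m
  boundedPod-even {k} even m = boundedPod-split (counts-top
    (λ {ys} o b → subst Unique (filter-reject odd? {x = suc k} {xs = ys} (λ odd → odd even)) o , b)
    (λ {ys} o b → subst Unique (sym (filter-reject odd? {x = suc k} {xs = ys} (λ odd → odd even))) o , b))

  boundedPod-odd : ∀ {k} → Odd (suc k) → ∀ m →
                   boundedPod (suc k) (suc k ℕ.+ m) ≡ boundedPod k (suc k ℕ.+ m) ℕ.+ boundedPod k m
  boundedPod-odd {k} odd m = boundedPod-split (counts-top down up)
    where
    down : ∀ {ys} → OddPartsDistinct (suc k ∷ ys) → All (_≤ suc k) ys → OddPartsDistinct ys × All (_≤ k) ys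
    down {ys} o b with subst Unique (filter-accept odd? {x = suc k} {xs = ys} odd) o
    ... | ∉ys ∷ o′ = o′ , All.tabulate (λ {y} y∈ →
      [ ℕ.≤-pred , (λ { refl → ⊥-elim (All.lookup ∉ys (∈-filter⁺ odd? y∈ odd) refl) }) ]′ (ℕ.m≤n⇒m<n∨m≡n (All.lookup b y∈)))
    up : ∀ {ys} → OddPartsDistinct ys → All (_≤ k) ys → OddPartsDistinct (suc k ∷ ys) × All (_≤ suc k) ys
    up {ys} o b = subst Unique (sym (filter-accept odd? {x = suc k} {xs = ys} odd))
        (All.tabulate (λ y∈ → λ { refl → ℕ.1+n≰n (All.lookup b (proj₁ (∈-filter⁻ odd? {xs = ys} y∈))) }) ∷ o) ,
      All.map ℕ.m≤n⇒m≤1+n b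

  sign : ℕ → ℤ
  sign zero = + 1
  sign (suc n) = - sign n

  sign-+ : ∀ m n → sign (m ℕ.+ n) ≡ sign m * sign n
  sign-+ zero n = sym (ℤ.*-identityˡ (sign n))
  sign-+ (suc m) n = trans (cong -_ (sign-+ m n)) (ℤ.neg-distribˡ-* (sign m) (sign n))

  sign-double : ∀ s → sign (s ℕ.+ s) ≡ + 1
  sign-double zero = refl
  sign-double (suc s) = trans (cong (λ n → - sign n) (ℕ.+-suc s s)) (trans (ℤ.neg-involutive (sign (s ℕ.+ s))) (sign-double s))

  -- The sign replaces q by -q and thus 1 + q^(2i-1) by 1 - q^(2i-1), which makes the product the
  -- reciprocal of the one in Gauss' identity.
  signed : ℕ → Series
  signed k n = sign n * + boundedPod k n

  double-even : ∀ s → 2 ∣ s ℕ.+ s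
  double-even s = ℕ.divides s (trans (cong (s ℕ.+_) (sym (ℕ.+-identityʳ s))) (ℕ.*-comm 2 s))

  1+double-odd : ∀ s → Odd (suc (s ℕ.+ s))
  1+double-odd s 2∣ with () ← ℕ.∣1⇒≡1 (ℕ.∣m+n∣m⇒∣n {2} {s ℕ.+ s} {1} (subst (2 ∣_) (ℕ.+-comm 1 (s ℕ.+ s)) 2∣) (double-even s))

  2+double-even : ∀ s → 2 ∣ suc (suc (s ℕ.+ s))
  2+double-even s = ℕ.divides (suc s) (cong (2 ℕ.+_) (trans (cong (s ℕ.+_) (sym (ℕ.+-identityʳ s))) (ℕ.*-comm 2 s)))

  -- Admitting the odd part 2s + 1 multiplies the series by 1 - x^(2s+1); the next lemma divides it
  -- by 1 - x^(2s+2) for the even part. Together they give the recurrence that Shanks' identity asks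
  -- of Q.
  signed-odd : ∀ s → signed (suc (s ℕ.+ s)) A.+ x ^ₛ suc (s ℕ.+ s) A.* signed (s ℕ.+ s) A.≈ signed (s ℕ.+ s)
  signed-odd s n with n ℕ.<? suc (s ℕ.+ s)
  ... | yes n<k = trans₅ (+-cong₅ (reflexive₅ (cong (λ c → sign n * + c) (boundedPod-< n<k))) (x^-below (suc (s ℕ.+ s)) (signed (s ℕ.+ s)) n<k))
                         (reflexive₅ (ℤ.+-identityʳ _))
  ... | no n≮k with ℕ.m≤n⇒∃[o]m+o≡n (ℕ.≮⇒≥ n≮k)
  ... | m , refl = trans₅ (+-cong₅ (reflexive₅ {signed (suc k) n} refl) (x^-above (suc (s ℕ.+ s)) (signed (s ℕ.+ s)) m)) (reflexive₅ (begin
    σ * + boundedPod (suc k) n + sign m * + boundedPod k m ≡⟨ cong (λ c → σ * + c + sign m * + boundedPod k m) (boundedPod-odd (1+double-odd s) m) ⟩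
    σ * + (boundedPod k n ℕ.+ boundedPod k m) + sign m * + boundedPod k m ≡⟨ cong₂ (λ a b → σ * a + b * + boundedPod k m) (ℤ.pos-+ (boundedPod k n) (boundedPod k m)) sm ⟩
    σ * (+ boundedPod k n + + boundedPod k m) + - σ * + boundedPod k m ≡⟨ lemma σ _ _ ⟩
    σ * + boundedPod k n ∎))
    where
    open ≡-Reasoning
    k : ℕ
    k = s ℕ.+ s
    σ : ℤ
    σ = sign n
    sm : sign m ≡ - σ
    sm = sym (trans (ℤ.neg-involutive (sign (k ℕ.+ m))) (trans (sign-+ k m) (trans (cong (_* sign m) (sign-double s)) (ℤ.*-identityˡ (sign m)))))
    lemma : ∀ σ a b → σ * (a + b) + - σ * b ≡ σ * a
    lemma = solve-∀

  signed-even : ∀ s → signed (suc (suc (s ℕ.+ s))) A.≈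
                signed (suc (s ℕ.+ s)) A.+ x ^ₛ suc (suc (s ℕ.+ s)) A.* signed (suc (suc (s ℕ.+ s)))
  signed-even s n with n ℕ.<? suc (suc (s ℕ.+ s))
  ... | yes n<k = sym₅ (trans₅ (+-cong₅ (reflexive₅ (cong (λ c → sign n * + c) (sym (boundedPod-< n<k)))) (x^-below (suc (suc (s ℕ.+ s))) (signed (suc (suc (s ℕ.+ s)))) n<k))
                         (reflexive₅ (ℤ.+-identityʳ _)))
  ... | no n≮k with ℕ.m≤n⇒∃[o]m+o≡n (ℕ.≮⇒≥ n≮k)
  ... | m , refl = sym₅ (trans₅ (+-cong₅ (reflexive₅ {signed k n} refl) (x^-above (suc (suc (s ℕ.+ s))) (signed (suc (suc (s ℕ.+ s)))) m)) (reflexive₅ (begin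
    σ * + boundedPod k n + sign m * + boundedPod (suc k) m ≡⟨ cong (λ a → σ * + boundedPod k n + a * + boundedPod (suc k) m) sm ⟩
    σ * + boundedPod k n + σ * + boundedPod (suc k) m ≡⟨ sym (ℤ.*-distribˡ-+ σ _ _) ⟩
    σ * (+ boundedPod k n + + boundedPod (suc k) m) ≡⟨ cong (σ *_) (sym (ℤ.pos-+ (boundedPod k n) (boundedPod (suc k) m))) ⟩
    σ * + (boundedPod k n ℕ.+ boundedPod (suc k) m) ≡⟨ cong (λ c → σ * + c) (sym (boundedPod-even (2+double-even s) m)) ⟩
    σ * + boundedPod (suc k) n ∎)))
    where
    open ≡-Reasoning
    k : ℕ
    k = suc (s ℕ.+ s)
    σ : ℤ
    σ = sign n
    sm : sign m ≡ σ
    sm = sym (trans (ℤ.neg-involutive (sign (s ℕ.+ s ℕ.+ m))) (trans (sign-+ (s ℕ.+ s) m) (trans (cong (_* sign m) (sign-double s)) (ℤ.*-identityˡ (sign m)))))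

  partial : ℕ → Series
  partial s = signed (s ℕ.+ s)

  partial-zero : partial 0 A.≈ A.1#
  partial-zero zero = reflexive₅ (cong (λ c → + 1 * + c) boundedPod-0-0)
  partial-zero (suc n) = reflexive₅ (trans (cong (λ c → sign (suc n) * + c) (boundedPod-0-suc n)) (ℤ.*-zeroʳ (sign (suc n))))

  partial-suc : ∀ s → partial (suc s) A.+ x A.* x ^ₛ (s ℕ.+ s) A.* partial s A.≈
                      partial s A.+ x A.* (x A.* x ^ₛ (s ℕ.+ s)) A.* partial (suc s)
  partial-suc s rewrite ℕ.+-suc s s = λ n → trans₅
    (+-cong₅ (signed-even s n) (reflexive₅ {odd n} refl))
    (trans₅ (reflexive₅ (lemma (signed (suc (s ℕ.+ s)) n) (even n) (odd n)))
      (+-cong₅ (signed-odd s n) (reflexive₅ {even n} refl)))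
    where
    odd even : Series
    odd = x ^ₛ suc (s ℕ.+ s) A.* signed (s ℕ.+ s)
    even = x ^ₛ suc (suc (s ℕ.+ s)) A.* signed (suc (suc (s ℕ.+ s)))
    lemma : ∀ a b c → a + b + c ≡ a + c + b
    lemma = solve-∀

  signedPod : Series
  signedPod n = sign n * + pod n

  open Identity seriesRing

  ψ : Series
  ψ n = + occurrences (suc n) n

  power-coefficient : ∀ j n → (x ^ₛ j) n ≡₅ + δ j n
  power-coefficient j n with j ℕ.≟ n
  ... | yes refl = trans₅ (sym₅ (A.*-identityʳ (x ^ₛ j) j))
    (subst (λ m → (x ^ₛ j A.* A.1#) m ≡₅ + 1) (ℕ.+-identityʳ j) (x^-above j A.1# 0))
  ... | no j≢n with n ℕ.<? j
  ... | yes n<j = trans₅ (sym₅ (A.*-identityʳ (x ^ₛ j) n)) (x^-below j A.1# n<j)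
  ... | no n≮j with ℕ.m≤n⇒∃[o]m+o≡n (ℕ.≮⇒≥ n≮j)
  ... | zero , refl = ⊥-elim (j≢n (sym (ℕ.+-identityʳ j)))
  ... | suc m , refl = trans₅ (sym₅ (A.*-identityʳ (x ^ₛ j) (j ℕ.+ suc m))) (x^-above j A.1# (suc m))

  triangular-coefficient : ∀ m n → sumTo m (λ k → x ^ₛ tri k) n ≡₅ + occurrences m n
  triangular-coefficient zero n = reflexive₅ refl
  triangular-coefficient (suc m) n = trans₅ (+-cong₅ (triangular-coefficient m n) (power-coefficient (tri m) n))
    (reflexive₅ (sym (ℤ.pos-+ (occurrences m n) (δ (tri m) n))))

  -- Compare coefficients of xᵐ in Shanks' identity for n > m. On the left only the term s = 0
  -- survives, since all others contain y = x^(2n+1). On the right both truncated factors already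
  -- agree with their limits up to degree m.
  signedPod-ψ : signedPod A.* ψ A.≈ A.1#
  signedPod-ψ m = trans₅ (sym₅ limit) (trans₅ (sym₅ (shanks x partial partial-zero partial-suc x^-cancel n m)) (low m))
    where
    n : ℕ
    -- One more than m, so that the term s = 0 is present even for m = 0, and so that m < 2n.
    n = suc m
    y : Series
    y = x ^ₛ suc (n ℕ.+ n)
    m<2n : m < n ℕ.+ n
    m<2n = ℕ.m≤m+n (suc m) n
    limit : (partial n A.* triangular x partial partial-zero partial-suc x^-cancel (n ℕ.+ n)) m ≡₅ (signedPod A.* ψ) m
    limit = convolve-cong-≤ m
      (λ i i≤m → reflexive₅ (cong (λ c → sign i * + c) (boundedPod-pod (ℕ.≤-trans i≤m (ℕ.<⇒≤ m<2n)))))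
      (λ i i≤m → trans₅ (triangular-coefficient (n ℕ.+ n) i)
        (reflexive₅ (cong +_ (occurrences-stable (ℕ.≤-<-trans i≤m m<2n)))))
    term : ∀ s → (partial (suc s) A.* (y A.* y ^ₛ s)) m ≡₅ + 0
    term s = trans₅ (swap m) (x^-below (suc (n ℕ.+ n)) (partial (suc s) A.* y ^ₛ s) (ℕ.m≤n⇒m≤1+n m<2n))
      where
      swap : partial (suc s) A.* (y A.* y ^ₛ s) A.≈ y A.* (partial (suc s) A.* y ^ₛ s)
      swap = A.trans (A.sym (A.*-assoc (partial (suc s)) y (y ^ₛ s)))
        (A.trans (A.*-congʳ {y ^ₛ s} (A.*-comm (partial (suc s)) y)) (A.*-assoc y (partial (suc s)) (y ^ₛ s)))
    low : ∀ j → sumTo (suc j) (λ s → partial s A.* y ^ₛ s) m ≡₅ A.1# m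
    low zero = trans₅ (reflexive₅ (ℤ.+-identityˡ _)) (trans₅ (A.*-identityʳ (partial 0) m) (partial-zero m))
    low (suc j) = trans₅ (+-cong₅ (low j) (term j)) (reflexive₅ (ℤ.+-identityʳ _))

  signedPod-θ : signedPod A.* θ A.≈ A.1# A.+ A.1#
  signedPod-θ = A.trans (A.*-congˡ {signedPod} (λ n → reflexive₅ (ℤ.pos-+ (occurrences (suc n) n) (occurrences (suc n) n))))
    (A.trans (A.distribˡ signedPod ψ ψ) (A.+-cong signedPod-ψ signedPod-ψ))

-- Three triangular numbers and three odd squares

module OddSquares where
  open Quaternion
  open Counting
  open Hecke using (Sphere)
  open Triangular
  open ThetaSeries
  open import Data.Integer using (ℤ; +_; -_; _+_; _*_; _-_; _/ℕ_; _%ℕ_)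
  open import Data.Integer.DivMod using (a≡a%ℕn+[a/ℕn]*n; n%ℕd<d)
  open import Data.Integer.Divisibility.Signed
  open ≡

  parity : ∀ z → ∃[ a ] (z ≡ + 2 * a + + 0 ⊎ z ≡ + 2 * a + + 1)
  parity z = z /ℕ 2 , go (z %ℕ 2) (n%ℕd<d z 2) (trans (a≡a%ℕn+[a/ℕn]*n z 2) (lemma (+ (z %ℕ 2)) (z /ℕ 2)))
    where
    lemma : ∀ r q → r + q * + 2 ≡ + 2 * q + r
    lemma = solve-∀
    go : ∀ r → r ℕ.< 2 → z ≡ + 2 * (z /ℕ 2) + + r → z ≡ + 2 * (z /ℕ 2) + + 0 ⊎ z ≡ + 2 * (z /ℕ 2) + + 1
    go 0 _ e = inj₁ e
    go 1 _ e = inj₂ e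
    go (suc (suc _)) (ℕ.s≤s (ℕ.s≤s ()))

  double+1 : ℤ → ℤ
  double+1 a = + 2 * a + + 1

  odd-vector : ℤ × ℤ × ℤ → ℍ
  odd-vector (a , b , c) = quat (+ 0) (double+1 a) (double+1 b) (double+1 c)

  -- Modulo 4 each square reduces to that of its parity e, f or g, so a sum congruent to 3 forces
  -- all three to be 1. For every other choice of parities the implicit argument is found by
  -- computation.
  not-3-mod-4 : ∀ n a b c e f g →
    + 0 * + 0 + (+ 2 * a + e) * (+ 2 * a + e) + (+ 2 * b + f) * (+ 2 * b + f) + (+ 2 * c + g) * (+ 2 * c + g) ≡ n * + 8 + + 3 →
    {False (+ 4 ∣? (+ 3 - (e * e + f * f + g * g)))} → ⊥
  not-3-mod-4 n a b c e f g eq {ne} = toWitnessFalse ne (divides (a * (a + e) + b * (b + f) + c * (c + g) - + 2 * n)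
    (trans (l₁ n (e * e + f * f + g * g)) (trans (cong (λ s → s - + 2 * n * + 4 - (e * e + f * f + g * g)) (sym eq)) (l₂ a b c e f g n))))
    where
    l₁ : ∀ n s → + 3 - s ≡ (n * + 8 + + 3) - + 2 * n * + 4 - s
    l₁ = solve-∀
    l₂ : ∀ a b c e f g n →
      (+ 0 * + 0 + (+ 2 * a + e) * (+ 2 * a + e) + (+ 2 * b + f) * (+ 2 * b + f) + (+ 2 * c + g) * (+ 2 * c + g))
        - + 2 * n * + 4 - (e * e + f * f + g * g)
      ≡ (a * (a + e) + b * (b + f) + c * (c + g) - + 2 * n) * + 4
    l₂ = solve-∀

  all-odd : ∀ n x y z → + 0 * + 0 + x * x + y * y + z * z ≡ n * + 8 + + 3 → ∃[ t ] odd-vector t ≡ quat (+ 0) x y z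
  all-odd n x y z eq with parity x | parity y | parity z
  ... | a , inj₂ refl | b , inj₂ refl | c , inj₂ refl = (a , b , c) , refl
  ... | a , inj₁ refl | b , inj₁ refl | c , inj₁ refl = ⊥-elim (not-3-mod-4 n a b c (+ 0) (+ 0) (+ 0) eq)
  ... | a , inj₁ refl | b , inj₁ refl | c , inj₂ refl = ⊥-elim (not-3-mod-4 n a b c (+ 0) (+ 0) (+ 1) eq)
  ... | a , inj₁ refl | b , inj₂ refl | c , inj₁ refl = ⊥-elim (not-3-mod-4 n a b c (+ 0) (+ 1) (+ 0) eq)
  ... | a , inj₁ refl | b , inj₂ refl | c , inj₂ refl = ⊥-elim (not-3-mod-4 n a b c (+ 0) (+ 1) (+ 1) eq)
  ... | a , inj₂ refl | b , inj₁ refl | c , inj₁ refl = ⊥-elim (not-3-mod-4 n a b c (+ 1) (+ 0) (+ 0) eq)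
  ... | a , inj₂ refl | b , inj₁ refl | c , inj₂ refl = ⊥-elim (not-3-mod-4 n a b c (+ 1) (+ 0) (+ 1) eq)
  ... | a , inj₂ refl | b , inj₂ refl | c , inj₁ refl = ⊥-elim (not-3-mod-4 n a b c (+ 1) (+ 1) (+ 0) eq)

  opaque
    unfolding _·_

    odd-vector-norm : ∀ a b c → norm (odd-vector (a , b , c)) ≡ + (T a ℕ.+ (T b ℕ.+ T c)) * + 8 + + 3
    odd-vector-norm a b c = begin
      norm (odd-vector (a , b , c)) ≡⟨ l₁ a b c ⟩
      (a * (a + + 1) + (b * (b + + 1) + c * (c + + 1))) * + 4 + + 3 ≡⟨ cong (λ s → s * + 4 + + 3) (sym (cong₂ _+_ (double-T a) (cong₂ _+_ (double-T b) (double-T c)))) ⟩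
      (+ 2 * + T a + (+ 2 * + T b + + 2 * + T c)) * + 4 + + 3 ≡⟨ l₂ (+ T a) (+ T b) (+ T c) ⟩
      (+ T a + (+ T b + + T c)) * + 8 + + 3 ≡⟨ cong (λ s → s * + 8 + + 3) (sym (trans (ℤ.pos-+ (T a) (T b ℕ.+ T c)) (cong (_+_ (+ T a)) (ℤ.pos-+ (T b) (T c))))) ⟩
      + (T a ℕ.+ (T b ℕ.+ T c)) * + 8 + + 3 ∎
      where
      open ≡-Reasoning
      l₁ : ∀ a b c → + 0 * + 0 + (+ 2 * a + + 1) * (+ 2 * a + + 1) + (+ 2 * b + + 1) * (+ 2 * b + + 1) + (+ 2 * c + + 1) * (+ 2 * c + + 1)
           ≡ (a * (a + + 1) + (b * (b + + 1) + c * (c + + 1))) * + 4 + + 3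
      l₁ = solve-∀
      l₂ : ∀ a b c → (+ 2 * a + (+ 2 * b + + 2 * c)) * + 4 + + 3 ≡ (a + (b + c)) * + 8 + + 3
      l₂ = solve-∀

    sphere-odd : ∀ n {v} → Sphere (n * + 8 + + 3) v → ∃[ t ] odd-vector t ≡ v
    sphere-odd n {quat _ x y z} (refl , e) = all-odd n x y z e

  odd-vector-injective : ∀ {s t} → odd-vector s ≡ odd-vector t → s ≡ t
  odd-vector-injective {a , b , c} {a′ , b′ , c′} eq =
    cong₂ _,_ (inj (cong ℍ.i eq)) (cong₂ _,_ (inj (cong ℍ.j eq)) (inj (cong ℍ.k eq)))
    where
    inj : ∀ {a b} → double+1 a ≡ double+1 b → a ≡ b
    inj {a} {b} e = ℤ.*-cancelˡ-≡ (+ 2) a b (trans (l a) (trans (cong (_- + 1) e) (sym (l b))))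
      where
      l : ∀ a → + 2 * a ≡ (+ 2 * a + + 1) - + 1
      l = solve-∀

  counts-odd-sphere : ∀ {n c} → Counts (TripleSum n) c → Counts (Sphere (+ n * + 8 + + 3)) c
  counts-odd-sphere {n} C = counts-image {Q = Sphere (+ n * + 8 + + 3)} odd-vector C
    (λ {(a , b , c)} s → refl , trans (odd-vector-norm a b c) (cong (λ m → + m * + 8 + + 3) s))
    (λ _ _ → odd-vector-injective)
    (λ {v} h@(_ , e) → let (a , b , c) , o = sphere-odd (+ n) h in (a , b , c) ,
      ℤ.+-injective (ℤ.*-cancelʳ-≡ (+ (T a ℕ.+ (T b ℕ.+ T c))) (+ n) (+ 8)
        (trans (l (+ (T a ℕ.+ (T b ℕ.+ T c)))) (trans (cong (_- + 3) (trans (sym (odd-vector-norm a b c)) (trans (cong norm o) e))) (sym (l (+ n)))))) , o)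
    where
    l : ∀ a → a * + 8 ≡ (a * + 8 + + 3) - + 3
    l = solve-∀

-- From spheres to partitions: the congruence and its exponents

open Counting
open Hecke using (Sphere)
open Spheres
open Shanks using (tri)
open Modulo5
open Sections
open ThetaSeries
open Gauss
open OddSquares
open CommutativeRing ℤ/5 using () renaming (trans to trans₅; sym to sym₅; +-cong to +-cong₅)
open import Data.Integer as ℤ using (ℤ; +_)
open import Data.Integer.Divisibility.Signed as Signed using (∣⇒∣ᵤ; ∣ᵤ⇒∣)
open import Data.Nat using (ℕ; _+_; _*_; _^_; _/_; _%_; _≤_)
open import Data.Nat.Divisibility using (_∣_)
open import Data.Nat.Solver using (module +-*-Solver)
open import Relation.Binary.PropositionalEquality

abs-sign : ∀ n m → ℤ.∣ sign n ℤ.* + m ∣ ≡ m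
abs-sign n m = trans (ℤ.abs-* (sign n) (+ m)) (trans (cong (_* m) (unit n)) (ℕ.*-identityˡ m))
  where
  unit : ∀ n → ℤ.∣ sign n ∣ ≡ 1
  unit zero = refl
  unit (suc n) = trans (ℤ.∣-i∣≡∣i∣ (sign n)) (unit n)

≡₅0⇒∣ : ∀ {a} → a ≡₅ + 0 → + 5 Signed.∣ a
≡₅0⇒∣ {a} (mod₅ d) = subst (+ 5 Signed.∣_) (ℤ.+-identityʳ a) d

pod-spheres : ∀ n {r} → Counts (Sphere (+ (n * 8 + 3))) r → 5 ∣ r → 5 ∣ pod (n * 5 + 2)
pod-spheres n {r} C 5∣r = subst (5 ∣_) (abs-sign (n * 5 + 2) (pod (n * 5 + 2))) (∣⇒∣ᵤ (≡₅0⇒∣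
    (trans₅ (section-2-inverse θ α β (section 3 θ) θ₀ θ₁ θ₂ A.refl θ₄ θ² signedPod signedPod-θ n) (+-cong₅ triples triples))))
  where
  c : ℕ
  c = proj₁ (counts-triples n)
  r≡c : r ≡ c
  r≡c = counts-unique C (subst (λ m → Counts (Sphere m) c)
    (trans (cong (ℤ._+ + 3) (sym (ℤ.pos-* n 8))) (sym (ℤ.pos-+ (n * 8) 3)))
    (counts-odd-sphere (proj₁ (proj₂ (counts-triples n)))))
  triples : (θ A.* (θ A.* θ)) n ≡₅ + 0
  triples = trans₅ (sym₅ (proj₂ (proj₂ (counts-triples n))))
    (mod₅ (subst (+ 5 Signed.∣_) (sym (ℤ.+-identityʳ (+ c))) (∣ᵤ⇒∣ (subst (5 ∣_) r≡c 5∣r))))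

odd-square : ∀ h → (1 + 2 * h) * (1 + 2 * h) ≡ 1 + tri h * 8
odd-square zero = refl
odd-square (suc h) = trans (l₁ h) (trans (cong (_+ suc h * 8) (odd-square h)) (l₂ h (tri h)))
  where
  open +-*-Solver
  l₁ : ∀ h → (1 + 2 * suc h) * (1 + 2 * suc h) ≡ (1 + 2 * h) * (1 + 2 * h) + suc h * 8
  l₁ = solve 1 (λ h → (con 1 :+ con 2 :* (con 1 :+ h)) :* (con 1 :+ con 2 :* (con 1 :+ h))
         := (con 1 :+ con 2 :* h) :* (con 1 :+ con 2 :* h) :+ (con 1 :+ h) :* con 8) refl
  l₂ : ∀ h t → 1 + t * 8 + suc h * 8 ≡ 1 + (suc h + t) * 8
  l₂ = solve 2 (λ h t → con 1 :+ t :* con 8 :+ (con 1 :+ h) :* con 8 := con 1 :+ (con 1 :+ h :+ t) :* con 8) refl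

module _ (p : ℕ) (p-prime : Prime p) (p≢2 : p ≢ 2) where

  p²≡ : p * p ≡ 1 + tri (p / 2) * 8
  p²≡ = trans (cong (λ q → q * q) (trans (Conic.p≡1+2half p p-prime p≢2) (cong suc (ℕ.*-comm (p / 2) 2)))) (odd-square (p / 2))

  -- For odd p one has p² = 1 + 8 · `tri (p / 2)`, so each further factor p² preserves the residue
  -- 3.
  level-mod-8 : ∀ {N} → (p * N) % 8 ≡ 3 → ∀ k → (p ^ (1 + 2 * k) * N) % 8 ≡ 3
  level-mod-8 {N} eq zero = trans (cong (λ q → (q * N) % 8) (ℕ.*-identityʳ p)) eq
  level-mod-8 {N} eq (suc k) = begin
    (p ^ (1 + 2 * suc k) * N) % 8 ≡⟨ cong (_% 8) step ⟩
    (M + (tri (p / 2) * M) * 8) % 8 ≡⟨ ℕ.[m+kn]%n≡m%n M (tri (p / 2) * M) 8 ⟩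
    M % 8 ≡⟨ level-mod-8 eq k ⟩
    3 ∎
    where
    open ≡-Reasoning
    open +-*-Solver
    M : ℕ
    M = p ^ (1 + 2 * k) * N
    step : p ^ (1 + 2 * suc k) * N ≡ M + (tri (p / 2) * M) * 8
    step = begin
      p ^ (1 + 2 * suc k) * N ≡⟨ cong (λ e → p ^ e * N) (solve 1 (λ k → con 1 :+ con 2 :* (con 1 :+ k) := con 2 :+ (con 1 :+ con 2 :* k)) refl k) ⟩
      p * (p * p ^ (1 + 2 * k)) * N ≡⟨ solve 3 (λ p q N → p :* (p :* q) :* N := p :* p :* (q :* N)) refl p (p ^ (1 + 2 * k)) N ⟩
      p * p * M ≡⟨ cong (_* M) p²≡ ⟩
      (1 + tri (p / 2) * 8) * M ≡⟨ solve 2 (λ t M → (con 1 :+ t :* con 8) :* M := M :+ t :* M :* con 8) refl (tri (p / 2)) M ⟩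
      M + (tri (p / 2) * M) * 8 ∎

  pod-level : ∀ {N} → ¬ p ∣ N → (p * N) % 8 ≡ 3 → ∀ k → 5 ∣ geometric p (suc k) →
              5 ∣ pod ((5 * p ^ (1 + 2 * k) * N + 1) / 8)
  pod-level {N} p∤N eq k 5∣ = subst (λ m → 5 ∣ pod m) (sym index)
    (pod-spheres n C (sphere-divisible p p-prime p≢2 N p∤N k 5∣ C′))
    where
    open ≡-Reasoning
    open +-*-Solver
    M n : ℕ
    M = p ^ (1 + 2 * k) * N
    n = M / 8
    M≡ : M ≡ n * 8 + 3
    M≡ = trans (ℕ.m≡m%n+[m/n]*n M 8) (trans (cong (_+ n * 8) (level-mod-8 eq k)) (ℕ.+-comm 3 (n * 8)))
    C : Counts (Sphere (+ (n * 8 + 3))) (proj₁ (counts-sphere (+ (n * 8 + 3))))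
    C = proj₂ (counts-sphere (+ (n * 8 + 3)))
    C′ : Counts (Sphere (+ M)) (proj₁ (counts-sphere (+ (n * 8 + 3))))
    C′ = subst (λ m → Counts (Sphere (+ m)) (proj₁ (counts-sphere (+ (n * 8 + 3))))) (sym M≡) C
    index : (5 * p ^ (1 + 2 * k) * N + 1) / 8 ≡ n * 5 + 2
    index = begin
      (5 * p ^ (1 + 2 * k) * N + 1) / 8 ≡⟨ cong (λ m → (m + 1) / 8) (trans (ℕ.*-assoc 5 (p ^ (1 + 2 * k)) N) (cong (5 *_) M≡)) ⟩
      (5 * (n * 8 + 3) + 1) / 8 ≡⟨ cong (_/ 8) (solve 1 (λ n → con 5 :* (n :* con 8 :+ con 3) :+ con 1 := (n :* con 5 :+ con 2) :* con 8) refl n) ⟩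
      (n * 5 + 2) * 8 / 8 ≡⟨ ℕ.m*n/n≡m (n * 5 + 2) 8 ⟩
      n * 5 + 2 ∎

theorem6 : ∀ (p : ℕ) → Prime p → 3 ≤ p →
    ∀ (N : ℕ) → 1 ≤ N → ¬ (p ∣ N) → (p * N) % 8 ≡ 3 →
    ∀ (α : ℕ) →
    (p % 5 ≡ 1 →
    5 ∣ pod ((5 * p ^ (10 * α + 9) * N + 1) / 8))
    × (p % 5 ≡ 2 ⊎ p % 5 ≡ 3 ⊎ p % 5 ≡ 4 →
    5 ∣ pod ((5 * p ^ (8 * α + 7) * N + 1) / 8))
theorem6 p p-prime 3≤p N _ p∤N eq α =
  -- The number of terms of the geometric sum must be a multiple of 5 here and of 4 in the second
  -- case. With k + 1 = 5(α + 1) the exponent 2k + 1 is 10α + 9; with k + 1 = 4(α + 1) it is 8α + 7.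
  (λ p≡1 → at (solve 1 (λ a → con 1 :+ con 2 :* (con 4 :+ a :* con 5) := con 10 :* a :+ con 9) refl α)
    (pod-level p p-prime p≢2 p∤N eq (4 + α * 5) (geometric-∣ p 5 (5∣geometric-5 {p} p≡1) (suc α)))) ,
  (λ p≢1 → at (solve 1 (λ a → con 1 :+ con 2 :* (con 3 :+ a :* con 4) := con 8 :* a :+ con 7) refl α)
    (pod-level p p-prime p≢2 p∤N eq (3 + α * 4) (geometric-∣ p 4 (5∣geometric-4 {p} p≢1) (suc α))))
  where
  open +-*-Solver
  p≢2 : p ≢ 2
  p≢2 p≡2 = ℕ.<⇒≢ 3≤p (sym p≡2)
  at : ∀ {e f} → e ≡ f → 5 ∣ pod ((5 * p ^ e * N + 1) / 8) → 5 ∣ pod ((5 * p ^ f * N + 1) / 8)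
  at refl d = d
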